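{- Let $N,k$ be positive integers with $N\ge 2k+1$ and let $m\ge 2$. Assume that all roots of $D_{k,m}(x)$ are simple, and denote them by $\phi_{m,1},\ldots,\phi_{m,k}$. Put $$\mathcal G_{m,c}(\ell)=\frac{N\left(\rho_{m,c}^{\ell}+\rho_{m,c}^{N-\ell}\right)}{\left(\rho_{m,c}-\rho_{m,c}^{ -1}\right)\left(\rho_{m,c}^{N}-1\right)}.$$ Then, for $a,b\in V(K_m)$ and $0\le\ell\le N-1$, we have $$h_{C_N^k\square K_m}((0,a),(\ell,b))=\frac{2k+m-1}{2k}h_{C_N^k}(0,\ell)-\frac{2k+m-1}{2}\sum_{c=1}^{k}\frac{(m-1)\mathcal G_{m,c}(0)-(m\delta_{ab}-1)\mathcal G_{m,c}(\ell)}{D_{k,m}'(\phi_{m,c})}.$$ In particular, when $a=b$, $$h_{C_N^k\square K_m}((0,a),(\ell,a))=\frac{2k+m-1}{2k}h_{C_N^k}(0,\ell)-\frac{N(2k+m-1)(m-1)}{2}\mathcal A_{k,m}^{(N)}(\ell).$$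
   Context: All graphs are finite, simple and undirected; $\mathbb Z_N=\mathbb Z/N\mathbb Z$. $C_N^k$ is the graph with vertex set $\mathbb Z_N$ in which $x,y$ are adjacent iff $x-y\equiv\pm s\pmod N$ for some $1\le s\le k$. $K_m$ is the complete graph on $m$ vertices, $\delta_{ab}$ is the Kronecker delta. The Cartesian product $C_N^k\square G$ has vertex set $\mathbb Z_N\times V(G)$, with $(x,a)$ and $(y,b)$ adjacent iff ($a=b$ and $x,y$ are adjacent in $C_N^k$) or ($x=y$ and $a,b$ are adjacent in $G$). For a finite connected graph $Y$ and $u,v\in V(Y)$, $h_Y(u,v)$ is the expected value of $T_v=\inf\{t\ge 0: Z_t=v\}$ for the simple random walk $(Z_t)$ on $Y$ started at $u$ (each step moves to a uniformly random neighbour). For $\nu>0$, $D_{k,\nu}(x)=k+\frac{\nu}{2}-\sum_{s=1}^{k}T_s\left(\frac{x}{2}\right)$, where $T_s$ is the Chebyshev polynomial of the first kind; it has degree $k$. When its roots are simple, they are denoted $\phi_{\nu,1},\ldots,\phi_{\nu,k}\in\mathbb C$, and one chooses complex numbers with $\rho_{\nu,c}+\rho_{\nu,c}^{ -1}=\phi_{\nu,c}$, $\rho_{\nu,c}=\eta_{\nu,c}^{2}$, and puts $\gamma_{\nu,c}=\eta_{\nu,c}+\eta_{\nu,c}^{ -1}$. The sequence $(V_n^{(\nu,c)})_{n\ge0}$ is defined by $V_0^{(\nu,c)}=0$, $V_1^{(\nu,c)}=1$, $V_{n+2}^{(\nu,c)}=\gamma_{\nu,c}V_{n+1}^{(\nu,c)}-V_n^{(\nu,c)}$,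 and $$\mathcal A_{k,\nu}^{(N)}(\ell)=\sum_{c=1}^{k}\frac{1}{\gamma_{\nu,c}D_{k,\nu}'(\phi_{\nu,c})}\frac{V_\ell^{(\nu,c)}V_{N-\ell}^{(\nu,c)}}{V_N^{(\nu,c)}}.$$ In this statement these are used with $\nu=m$. -}

module Defs where

open import Algebra.Apartness.Bundles using (HeytingField; HeytingCommutativeRing)
open import Algebra.Bundles using (CommutativeRing; Semiring)
import Algebra.Definitions.RawSemiring as RawSemiringDefinitions
open import Data.Bool.Base using (if_then_else_)
open import Data.Fin.Base using (Fin; toℕ)
open import Data.Fin.Properties using (any?; *↔×; toℕ<n) renaming (_≟_ to _≟ᶠ_)
open import Data.Integer.Base as ℤ using (ℤ; +_; -[1+_])
import Data.Integer.Divisibility as ℤ∣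
import Data.Integer.Properties as ℤₚ
open import Data.Integer.Tactic.RingSolver using (solve-∀)
open import Data.List.Base as List
  using (List; []; _∷_; allFin; filter; length; cartesianProductWith)
open import Data.Nat.Base as ℕ using (ℕ; zero; suc; NonZero; _≤_; _<_; _∸_)
import Data.Nat.Divisibility as ℕ∣
import Data.Nat.Properties as ℕₚ
open import Data.Product.Base as Product using (∃; _×_; _,_; proj₁)
open import Data.Product.Function.NonDependent.Propositional using (_×-↔_)
open import Data.Rational.Base as ℚ using (ℚ; 0ℚ; 1ℚ)
open import Data.Sum.Base as Sum using (_⊎_; inj₁; inj₂)
open import Data.Vec.Base using (Vec; []; _∷_; init; last)
open import Data.Vec.Relation.Unary.All using (All; all?)
open import Function.Bundles using (_↔_; Inverse)
open import Function.Construct.Composition using (_↔-∘_)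
open import Function.Construct.Identity using (↔-id)
open import Function.Construct.Symmetry using (↔-sym)
open import Function.Properties.Inverse using (↔⇒↣)
open import Level using (_⊔_)
open import Relation.Binary.Definitions
  using (Decidable; DecidableEquality; Irreflexive; Symmetric)
open import Relation.Binary.PropositionalEquality
  using (_≡_; _≢_; refl; sym; cong; subst; ≢-sym)
open import Relation.Nullary.Decidable
  using (Dec; does; ¬?; _×-dec_; _⊎-dec_; via-injection)

------------------------------------------------------------------------
-- Finite simple graphs

record Graph : Set₁ where
  field
    V          : Set
    order      : ℕ
    enum       : Fin order ↔ V
    Adj        : V → V → Set
    adj?       : Decidable Adj
    adj-sym    : Symmetric Adj
    adj-irrefl : Irreflexive _≡_ Adj

  vertices : List V
  vertices = List.map (Inverse.to enum) (allFin order)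

  _≟_ : DecidableEquality V
  _≟_ = via-injection (↔⇒↣ (↔-sym enum)) _≟ᶠ_

  degree : V → ℕ
  degree x = length (filter (adj? x) vertices)

_≡_[mod_] : ℤ → ℤ → ℕ → Set
i ≡ j [mod N ] = + N ℤ∣.∣ i ℤ.- j

-- ℤ/Nℤ is represented by its least residues Fin N, and s = 1, …, k by
-- suc (toℕ i) for i : Fin k.
CirculantAdj : (N k : ℕ) → Fin N → Fin N → Set
CirculantAdj N k x y = ∃ λ (i : Fin k) →
  let d = + toℕ x ℤ.- + toℕ y
      s = + suc (toℕ i)
  in (d ≡ s [mod N ]) ⊎ (d ≡ ℤ.- s [mod N ])

private
  ∣-neg : ∀ {n i j} → i ≡ ℤ.- j → n ℤ∣.∣ i → n ℤ∣.∣ j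
  ∣-neg {n} {j = j} refl = subst (ℤ.∣ n ∣ ℕ∣.∣_) (ℤₚ.∣-i∣≡∣i∣ j)

  swap₁ : ∀ x y s → (x ℤ.- y) ℤ.- s ≡ ℤ.- ((y ℤ.- x) ℤ.- (ℤ.- s))
  swap₁ = solve-∀

  swap₂ : ∀ x y s → (x ℤ.- y) ℤ.- (ℤ.- s) ≡ ℤ.- ((y ℤ.- x) ℤ.- s)
  swap₂ = solve-∀

  loop₁ : ∀ x s → (x ℤ.- x) ℤ.- s ≡ ℤ.- s
  loop₁ = solve-∀

  loop₂ : ∀ x s → (x ℤ.- x) ℤ.- (ℤ.- s) ≡ ℤ.- (ℤ.- s)
  loop₂ = solve-∀

circulantAdj-sym : ∀ N k → Symmetric (CirculantAdj N k)
circulantAdj-sym N k {x} {y} (i , inj₁ p) =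
  i , inj₂ (∣-neg {+ N} (swap₁ (+ toℕ x) (+ toℕ y) (+ suc (toℕ i))) p)
circulantAdj-sym N k {x} {y} (i , inj₂ p) =
  i , inj₁ (∣-neg {+ N} (swap₂ (+ toℕ x) (+ toℕ y) (+ suc (toℕ i))) p)

circulantAdj-irrefl : ∀ N k → k < N → Irreflexive _≡_ (CirculantAdj N k)
circulantAdj-irrefl N k k<N {x} refl (i , p) =
  ℕ∣.>⇒∤ (ℕₚ.≤-<-trans (toℕ<n i) k<N) (N∣s p)
  where
  s = + suc (toℕ i)
  N∣s : _ ⊎ _ → N ℕ∣.∣ suc (toℕ i)
  N∣s (inj₁ q) = ∣-neg {+ N} {j = s} (loop₁ (+ toℕ x) s) q
  N∣s (inj₂ q) = subst (N ℕ∣.∣_) (cong ℤ.∣_∣ (loop₂ (+ toℕ x) s)) q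

private
  2k+1≤N⇒k<N : ∀ {N k} → 2 ℕ.* k ℕ.+ 1 ≤ N → k < N
  2k+1≤N⇒k<N {N} {k} p = ℕₚ.≤-trans
    (subst (suc k ≤_) (ℕₚ.+-comm 1 (2 ℕ.* k)) (ℕ.s≤s (ℕₚ.m≤m+n k _))) p

-- The bound on N is what excludes loops.
C : (N k : ℕ) → 2 ℕ.* k ℕ.+ 1 ≤ N → Graph
C N k 2k+1≤N = record
  { V          = Fin N
  ; order      = N
  ; enum       = ↔-id (Fin N)
  ; Adj        = CirculantAdj N k
  ; adj?       = λ x y → any? λ i → (N ℕ∣.∣? _) ⊎-dec (N ℕ∣.∣? _)
  ; adj-sym    = λ {x} {y} → circulantAdj-sym N k {x} {y}
  ; adj-irrefl = circulantAdj-irrefl N k (2k+1≤N⇒k<N 2k+1≤N)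
  }

complete : ℕ → Graph
complete m = record
  { V          = Fin m
  ; order      = m
  ; enum       = ↔-id (Fin m)
  ; Adj        = _≢_
  ; adj?       = λ a b → ¬? (a ≟ᶠ b)
  ; adj-sym    = ≢-sym
  ; adj-irrefl = λ a≡b a≢b → a≢b a≡b
  }

_□_ : Graph → Graph → Graph
X □ Y = record
  { V          = X.V × Y.V
  ; order      = X.order ℕ.* Y.order
  ; enum       = (X.enum ×-↔ Y.enum) ↔-∘ *↔×
  ; Adj        = λ (x , a) (y , b) → (a ≡ b × X.Adj x y) ⊎ (x ≡ y × Y.Adj a b)
  ; adj?       = λ (x , a) (y , b) →
      (a Y.≟ b ×-dec X.adj? x y) ⊎-dec (x X.≟ y ×-dec Y.adj? a b)
  ; adj-sym    = Sum.map (Product.map sym X.adj-sym) (Product.map sym Y.adj-sym)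
  ; adj-irrefl = λ { refl (inj₁ (_ , e)) → X.adj-irrefl refl e
                   ; refl (inj₂ (_ , e)) → Y.adj-irrefl refl e }
  }
  where
  module X = Graph X
  module Y = Graph Y

------------------------------------------------------------------------
-- Simple random walk and expected hitting times

∑< : ℕ → (ℕ → ℚ) → ℚ
∑< zero    f = 0ℚ
∑< (suc n) f = ∑< n f ℚ.+ f n

_⟶_ : (ℕ → ℚ) → ℚ → Set
s ⟶ L = ∀ ε → 0ℚ ℚ.< ε → ∃ λ n₀ → ∀ n → n₀ ≤ n → ℚ.∣ s n ℚ.- L ∣ ℚ.< ε

-- The value at 0 is never used: a vertex with a neighbour has positive degree.
recip : ℕ → ℚ
recip zero    = 0ℚ
recip (suc n) = + 1 ℚ./ suc n

module RandomWalk (Y : Graph) where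
  open Graph Y

  transition : V → V → ℚ
  transition x y = if does (adj? x y) then recip (degree x) else 0ℚ

  -- A vector z₁, …, z_t stands for the event Z₁ = z₁, …, Z_t = z_t of the
  -- walk started at Z₀ = u.
  trajectories : ∀ t → List (Vec V t)
  trajectories zero    = List.[ [] ]
  trajectories (suc t) = cartesianProductWith _∷_ vertices (trajectories t)

  probability : ∀ {t} → V → Vec V t → ℚ
  probability u []       = 1ℚ
  probability u (z ∷ zs) = transition u z ℚ.* probability z zs

  -- T_v = t, i.e. Z_t = v and Z_s ≠ v for all s < t.
  FirstHit : ∀ {t} → V → V → Vec V t → Set
  FirstHit v u zs = last (u ∷ zs) ≡ v × All (_≢ v) (init (u ∷ zs))

  firstHit? : ∀ {t} v u (zs : Vec V t) → Dec (FirstHit v u zs)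
  firstHit? v u zs = (last (u ∷ zs) ≟ v) ×-dec all? (λ z → ¬? (z ≟ v)) (init (u ∷ zs))

  -- P_u(T_v = t)
  hitProbability : V → V → ℕ → ℚ
  hitProbability u v t =
    List.foldr ℚ._+_ 0ℚ
      (List.map (probability u) (filter (firstHit? v u) (trajectories t)))

-- h_Y(u,v) = h.  A finite value of E_u[T_v] requires P_u(T_v < ∞) = 1 in
-- addition to the convergence of Σ_t t · P_u(T_v = t).
record ExpectedHittingTime (Y : Graph) (u v : Graph.V Y) (h : ℚ) : Set where
  open RandomWalk Y
  field
    almostSurelyFinite : (λ n → ∑< n (hitProbability u v)) ⟶ 1ℚ
    expectation        : (λ n → ∑< n (λ t → (+ t ℚ./ 1) ℚ.* hitProbability u v t)) ⟶ h

------------------------------------------------------------------------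
-- Fields of characteristic zero

module Operations {c ℓ₁ ℓ₂} (K : HeytingField c ℓ₁ ℓ₂) where
  open HeytingCommutativeRing (HeytingField.heytingCommutativeRing K)
    using (commutativeRing)
  open RawSemiringDefinitions
    (Semiring.rawSemiring (CommutativeRing.semiring commutativeRing)) public
    using (_^_; sum) renaming (_×_ to _·_)

-- Apartness _#_ is the constructive reading of ≠; for a field with decidable
-- equality (in particular classically for ℂ) it may be taken to be ≉.
CharacteristicZero : ∀ {c ℓ₁ ℓ₂} → HeytingField c ℓ₁ ℓ₂ → Set ℓ₂
CharacteristicZero K = ∀ n .{{_ : NonZero n}} → (n · 1#) # 0#
  where
  open HeytingField K
  open Operations K

module OverField {c ℓ₁ ℓ₂} (K : HeytingField c ℓ₁ ℓ₂) (char0 : CharacteristicZero K) where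
  open HeytingField K renaming (Carrier to F) hiding (refl; sym; trans)
  open Operations K

  ⟦_⟧ : ℕ → F
  ⟦ n ⟧ = n · 1#

  -- #⇒invertible provides an inverse of y - 0#.
  inv : (y : F) → y # 0# → F
  inv y y#0 = proj₁ (#⇒invertible y#0)

  infixl 7 _/_[_]
  _/_[_] : F → (y : F) → y # 0# → F
  x / y [ y#0 ] = x * inv y y#0

  fromℤ : ℤ → F
  fromℤ (+ n)    = ⟦ n ⟧
  fromℤ -[1+ n ] = - ⟦ suc n ⟧

  fromℚ : ℚ → F
  fromℚ q = fromℤ (ℚ.↥ q) / ⟦ ℚ.↧ₙ q ⟧ [ char0 (ℚ.↧ₙ q) ]

  half : F
  half = inv ⟦ 2 ⟧ (char0 2)

  ----------------------------------------------------------------------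
  -- Polynomials, as coefficient lists with the constant term first

  Poly : Set c
  Poly = List F

  eval : Poly → F → F
  eval []      x = 0#
  eval (a ∷ p) x = a + x * eval p x

  infixl 6 _⊕_
  _⊕_ : Poly → Poly → Poly
  []      ⊕ q       = q
  p       ⊕ []      = p
  (a ∷ p) ⊕ (b ∷ q) = (a + b) ∷ (p ⊕ q)

  scale : F → Poly → Poly
  scale a = List.map (a *_)

  ⊖_ : Poly → Poly
  ⊖_ = List.map λ a → - a

  -- p(x) ↦ p(a x)
  dilate : F → Poly → Poly
  dilate a []      = []
  dilate a (b ∷ p) = b ∷ scale a (dilate a p)

  derivative : Poly → Poly
  derivative []      = []
  derivative (_ ∷ p) = go 1 p
    where
    go : ℕ → Poly → Poly
    go n []      = []
    go n (a ∷ p) = (n · a) ∷ go (suc n) p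

  chebyshevT : ℕ → Poly
  chebyshevT 0             = 1# ∷ []
  chebyshevT 1             = 0# ∷ 1# ∷ []
  chebyshevT (suc (suc s)) = scale ⟦ 2 ⟧ (0# ∷ chebyshevT (suc s)) ⊕ ⊖ chebyshevT s

  -- Σ_{s=1}^k T_s(x/2)
  chebyshevSum : ℕ → Poly
  chebyshevSum zero    = []
  chebyshevSum (suc k) = chebyshevSum k ⊕ dilate half (chebyshevT (suc k))

  D : ℕ → F → Poly
  D k ν = (⟦ k ⟧ + ν * half ∷ []) ⊕ ⊖ chebyshevSum k

  D′ : ℕ → F → Poly
  D′ k ν = derivative (D k ν)

  AllRootsSimple : ℕ → F → Set (c ⊔ ℓ₁ ⊔ ℓ₂)
  AllRootsSimple k ν = ∀ x → eval (D k ν) x ≈ 0# → eval (D′ k ν) x # 0#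

  -- The φ c are k distinct roots of the degree-k polynomial D k ν, hence all
  -- of its roots.
  record Roots (k : ℕ) (ν : F) : Set (c ⊔ ℓ₁ ⊔ ℓ₂) where
    field
      φ          : Fin k → F
      φ-root     : ∀ c → eval (D k ν) (φ c) ≈ 0#
      φ-distinct : ∀ c d → c ≢ d → φ c # φ d
      ρ          : Fin k → F
      ρ#0        : ∀ c → ρ c # 0#
      ρ+ρ⁻¹      : ∀ c → ρ c + inv (ρ c) (ρ#0 c) ≈ φ c
      η          : Fin k → F
      η#0        : ∀ c → η c # 0#
      ρ≈η²       : ∀ c → ρ c ≈ η c ^ 2

    ρ⁻¹ : Fin k → F
    ρ⁻¹ c = inv (ρ c) (ρ#0 c)

    γ : Fin k → F
    γ c = η c + inv (η c) (η#0 c)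

    V : Fin k → ℕ → F
    V c 0             = 0#
    V c 1             = 1#
    V c (suc (suc n)) = γ c * V c (suc n) - V c n

    D′φ : Fin k → F
    D′φ c = eval (D′ k ν) (φ c)

    𝒢-denominator : ℕ → Fin k → F
    𝒢-denominator N c = (ρ c - ρ⁻¹ c) * (ρ c ^ N - 1#)

    -- The quantities by which 𝒢, 𝒜 and the hitting-time formula divide.
    record DenominatorsNonzero (N : ℕ) : Set ℓ₂ where
      field
        D′φ#0   : ∀ c → D′φ c # 0#
        𝒢-den#0 : ∀ c → 𝒢-denominator N c # 0#
        γD′φ#0  : ∀ c → (γ c * D′φ c) # 0#
        V#0     : ∀ c → V c N # 0#

    module Sums (N : ℕ) (nz : DenominatorsNonzero N) where
      open DenominatorsNonzero nz

      𝒢 : Fin k → ℕ → F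
      𝒢 c ℓ = ⟦ N ⟧ * (ρ c ^ ℓ + ρ c ^ (N ∸ ℓ)) / 𝒢-denominator N c [ 𝒢-den#0 c ]

      𝒜 : ℕ → F
      𝒜 ℓ = sum λ c →
        (1# / (γ c * D′φ c) [ γD′φ#0 c ]) * (V c ℓ * V c (N ∸ ℓ) / V c N [ V#0 c ])

      δ : ∀ {m} → Fin m → Fin m → F
      δ a b = if does (a ≟ᶠ b) then 1# else 0#

      -- Σ_c ((m-1) 𝒢_c(0) - (m δ_ab - 1) 𝒢_c(ℓ)) / D′(φ_c)
      correction : ∀ {m} → Fin m → Fin m → ℕ → F
      correction {m} a b ℓ = sum λ c →
        ((⟦ m ⟧ - 1#) * 𝒢 c 0 - (⟦ m ⟧ * δ a b - 1#) * 𝒢 c ℓ) / D′φ c [ D′φ#0 c ]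

module Submission where

-- Off the target v the hitting time is 1 plus its average over the neighbours,
-- and it vanishes at v; any such function is nonnegative by the minimum
-- principle and dominates the iterates of the killed walk, which yields the
-- convergence of both defining series. Summing L h over the graph gives
-- L h = d (1 - |V| δ_v). On C_N^k □ K_m split δ_(ℓ,b) into its part constant
-- along K_m, solved by (d / 2k) h_C, and its part of mean zero along K_m, on
-- which L acts as L_C + m. So h is explicit in terms of h_C and the Green
-- function G of L_C + m on ℤ/N, both of which exist over ℚ because the energy
-- form is definite. Over K, the functions ρ_c^x + ρ_c^(N-x) solve the
-- homogeneous equation except near 0, where the defects are Chebyshev
-- polynomials of the second kind in φ_c; Euler's identity
-- Σ_c p(φ_c) / D′(φ_c) = 0 for deg p < k - 1 turns their weighted sum into δ_0,
-- and uniqueness identifies it with the image of G.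

-- `K` carries no order and only an apartness relation, and this shapes the argument twice.
-- Positivity of the energy is available over ℚ alone, so over `K` uniqueness comes from pairing
-- with the rational Green function, an algebraic argument valid in every commutative ring that
-- receives ℚ. And the denominators have to be shown apart from zero, for which a proof by
-- contradiction is not enough: the pairing is instead carried out in K / (ρ^M - 1), and the
-- relation 1 = 0 obtained there carries an explicit inverse of ρ^M - 1 in `K`.
--
-- On the probabilistic side the limit h is a rational known in advance, so what the series need is
-- an explicit rate. A gap of order 1 / n is enough for each of them, but the tail of the second one
-- contains n P(T ≥ n); hence the iterates of the killed walk are bounded to order 1 / n².
-- Comparison with h gives this bound, because one step of the walk lowers h by exactly 1.

open import Defs

-- Polynomial identities with integer coefficients in a commutative ring.

module IntegerSolver where

  open import Algebra.Bundles using (CommutativeRing)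
  open import Algebra.Bundles.Raw using (RawRing)
  open import Algebra.Solver.Ring.AlmostCommutativeRing using (fromCommutativeRing; _-Raw-AlmostCommutative⟶_)
  import Algebra.Properties.Ring
  import Algebra.Properties.Semiring.Mult
  import Algebra.Solver.Ring
  open import Data.Integer.Base as ℤ using (ℤ; +_; -[1+_])
  import Data.Integer.Properties as ℤₚ
  import Data.Nat.Properties as ℕₚ
  open import Data.Maybe.Base using (Maybe; just; nothing)
  open import Data.Nat.Base as ℕ using (ℕ; zero; suc)
  import Relation.Binary.PropositionalEquality as ≡
  import Relation.Binary.Reasoning.Setoid
  open import Relation.Nullary.Decidable using (yes; no)

  module IntegerCoefficients {c ℓ} (R : CommutativeRing c ℓ) where
    open CommutativeRing R
    open Algebra.Properties.Ring ring
    open Algebra.Properties.Semiring.Mult semiring public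
      using (×-homo-+; ×1-homo-*; ×-assoc-*) renaming (_×_ to _·_)
    open Relation.Binary.Reasoning.Setoid setoid

    -- The clauses repeat those of `fromℤ`, so that over a field the two agree by computation.
    embed : ℤ → Carrier
    embed (+ n)    = n · 1#
    embed -[1+ n ] = - (suc n · 1#)

    embed-⊖ : ∀ m n → embed (m ℤ.⊖ n) ≈ m · 1# - n · 1#
    embed-⊖ zero    zero    = sym (-‿inverseʳ 0#)
    embed-⊖ zero    (suc n) = sym (+-identityˡ _)
    embed-⊖ (suc m) zero    = sym (trans (+-congˡ -0#≈0#) (+-identityʳ _))
    embed-⊖ (suc m) (suc n) = begin
      embed (suc m ℤ.⊖ suc n)                ≡⟨ ≡.cong embed (ℤₚ.[1+m]⊖[1+n]≡m⊖n m n) ⟩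
      embed (m ℤ.⊖ n)                        ≈⟨ embed-⊖ m n ⟩
      m′ - n′                                ≈⟨ +-congʳ (xyx⁻¹≈y 1# m′) ⟨
      (1# + m′) - 1# - n′                    ≈⟨ +-assoc _ _ _ ⟩
      (1# + m′) + (- 1# - n′)                ≈⟨ +-congˡ (-‿+-comm 1# n′) ⟩
      (1# + m′) - (1# + n′)                  ∎
      where
      m′ = m · 1#
      n′ = n · 1#

    embed-neg : ∀ i → embed (ℤ.- i) ≈ - embed i
    embed-neg (+ zero)  = sym -0#≈0#
    embed-neg (+ suc n) = refl
    embed-neg -[1+ n ]  = sym (-‿involutive _)

    embed-+ : ∀ i j → embed (i ℤ.+ j) ≈ embed i + embed j
    embed-+ (+ m)    (+ n)    = ×-homo-+ 1# m n
    embed-+ (+ m)    -[1+ n ] = embed-⊖ m (suc n)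
    embed-+ -[1+ m ] (+ n)    = trans (embed-⊖ n (suc m)) (+-comm _ _)
    embed-+ -[1+ m ] -[1+ n ] = begin
      - (suc (suc (m ℕ.+ n)) · 1#)          ≡⟨ ≡.cong (λ i → - (i · 1#)) (≡.cong suc (ℕₚ.+-suc m n)) ⟨
      - ((suc m ℕ.+ suc n) · 1#)            ≈⟨ -‿cong (×-homo-+ 1# (suc m) (suc n)) ⟩
      - (suc m · 1# + suc n · 1#)           ≈⟨ -‿+-comm _ _ ⟨
      - (suc m · 1#) - suc n · 1#           ∎


    private
      embed-*⁺ : ∀ m j → embed (+ m ℤ.* j) ≈ (m · 1#) * embed j
      embed-*⁺ zero    j = trans (reflexive (≡.cong embed (ℤₚ.*-zeroˡ j))) (sym (zeroˡ _))
      embed-*⁺ (suc m) j = begin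
        embed (+ suc m ℤ.* j)                   ≡⟨ ≡.cong embed (ℤₚ.suc-* (+ m) j) ⟩
        embed (j ℤ.+ + m ℤ.* j)                 ≈⟨ embed-+ j (+ m ℤ.* j) ⟩
        embed j + embed (+ m ℤ.* j)             ≈⟨ +-cong (sym (*-identityˡ _)) (embed-*⁺ m j) ⟩
        1# * embed j + (m · 1#) * embed j       ≈⟨ distribʳ _ _ _ ⟨
        (1# + m · 1#) * embed j                 ∎

    embed-* : ∀ i j → embed (i ℤ.* j) ≈ embed i * embed j
    embed-* (+ m)    j = embed-*⁺ m j
    embed-* -[1+ m ] j = begin
      embed (-[1+ m ] ℤ.* j)         ≡⟨ ≡.cong embed (ℤₚ.neg-distribˡ-* (+ suc m) j) ⟨
      embed (ℤ.- (+ suc m ℤ.* j))    ≈⟨ embed-neg (+ suc m ℤ.* j) ⟩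
      - embed (+ suc m ℤ.* j)        ≈⟨ -‿cong (embed-*⁺ (suc m) j) ⟩
      - ((suc m · 1#) * embed j)     ≈⟨ -‿distribˡ-* _ _ ⟩
      - (suc m · 1#) * embed j       ∎

    embed-1 : embed (+ 1) ≈ 1#
    embed-1 = +-identityʳ 1#

    private
      ℤ-rawRing : RawRing _ _
      ℤ-rawRing = CommutativeRing.rawRing ℤₚ.+-*-commutativeRing

      -- Sends 1 to 1# itself rather than to 1# + 0#.
      embed′ : ℤ → Carrier
      embed′ (+ 1) = 1#
      embed′ i     = embed i

      embed′≈embed : ∀ i → embed′ i ≈ embed i
      embed′≈embed (+ 0)           = refl
      embed′≈embed (+ 1)           = sym embed-1
      embed′≈embed (+ suc (suc n)) = refl
      embed′≈embed -[1+ n ]        = refl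

      morphism : ℤ-rawRing -Raw-AlmostCommutative⟶ fromCommutativeRing R
      morphism = record
        { ⟦_⟧    = embed′
        ; +-homo = λ i j → trans (embed′≈embed (i ℤ.+ j)) (trans (embed-+ i j)
                     (sym (+-cong (embed′≈embed i) (embed′≈embed j))))
        ; *-homo = λ i j → trans (embed′≈embed (i ℤ.* j)) (trans (embed-* i j)
                     (sym (*-cong (embed′≈embed i) (embed′≈embed j))))
        ; -‿homo = λ i → trans (embed′≈embed (ℤ.- i)) (trans (embed-neg i)
                     (sym (-‿cong (embed′≈embed i))))
        ; 0-homo = refl
        ; 1-homo = refl
        }

      -- Coefficients are compared in ℤ. Distinct integers may still coincide in the ring, so the
      -- negative case claims nothing.
      embed′≟ : ∀ i j → Maybe (embed′ i ≈ embed′ j)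
      embed′≟ i j with i ℤₚ.≟ j
      ... | yes i≡j = just (reflexive (≡.cong embed′ i≡j))
      ... | no  _   = nothing

    module Solver where
      open Algebra.Solver.Ring ℤ-rawRing (fromCommutativeRing R) morphism embed′≟ public

      :0 :1 : ∀ {n} → Polynomial n
      :0 = con (+ 0)
      :1 = con (+ 1)

-- Periodic sequences and discrete Schrödinger operators on ℤ/N.

module PeriodicSequences where

  open IntegerSolver
  open import Algebra.Bundles using (CommutativeRing)
  import Algebra.Properties.CommutativeSemiring.Exp
  import Algebra.Properties.Semiring.Exp
  import Algebra.Properties.Semiring.Sum
  import Algebra.Properties.Ring
  open import Data.Fin.Base using (Fin; zero; suc; toℕ; fromℕ; inject₁)
  open import Data.Fin.Properties using (toℕ-inject₁; toℕ-fromℕ; toℕ<n)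
  open import Data.Nat.Base as ℕ using (ℕ; zero; suc; NonZero; _≤_; _∸_)
  open import Data.Nat.DivMod using (_%_; _/_; m≡m%n+[m/n]*n)
  import Data.Nat.Properties as ℕₚ
  open import Function.Base using (_∘_)
  import Relation.Binary.PropositionalEquality as ≡

  open ≡ using (_≡_)
  import Relation.Binary.Reasoning.Setoid

  module Powers {c ℓ} (R : CommutativeRing c ℓ) where
    open CommutativeRing R hiding (zero)
    open Algebra.Properties.Semiring.Exp semiring
    open Algebra.Properties.CommutativeSemiring.Exp commutativeSemiring using (^-distrib-*)

    1^n≈1 : ∀ n → 1# ^ n ≈ 1#
    1^n≈1 zero    = refl
    1^n≈1 (suc n) = trans (*-identityˡ _) (1^n≈1 n)

    ^-inverse : ∀ {x y} → x * y ≈ 1# → ∀ n → x ^ n * y ^ n ≈ 1#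
    ^-inverse {x} {y} xy≈1 n = trans (sym (^-distrib-* x y n)) (trans (^-congˡ n xy≈1) (1^n≈1 n))

  module Periodic {c ℓ} (R : CommutativeRing c ℓ) (N : ℕ) where
    open CommutativeRing R hiding (zero)
    open Algebra.Properties.Ring ring
    open Algebra.Properties.Semiring.Sum semiring
      using (sum; sum-cong-≋; ∑-distrib-+; ∑-comm; *-distribˡ-sum; *-distribʳ-sum; sum-init-last)
    open IntegerCoefficients R
    open Solver using (solve; _:=_; _:+_; _:*_; _:-_; :-_; :1)
    open Relation.Binary.Reasoning.Setoid setoid

    -- Functions on ℤ/N are modelled by periodic sequences on ℕ: translation becomes plain addition,
    -- and residues appear only when a statement is reduced to one period.
    IsPeriodic : (ℕ → Carrier) → Set ℓ
    IsPeriodic f = ∀ x → f (x ℕ.+ N) ≈ f x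

    Σ₀ : (ℕ → Carrier) → Carrier
    Σ₀ f = sum {N} (f ∘ toℕ)

    Σ₀-cong : ∀ {f g} → (∀ x → f x ≈ g x) → Σ₀ f ≈ Σ₀ g
    Σ₀-cong f≈g = sum-cong-≋ {N} (f≈g ∘ toℕ)

    private
      shift₁ : ∀ n (f : ℕ → Carrier) →
               sum {n} (f ∘ suc ∘ toℕ) + f 0 ≈ sum {n} (f ∘ toℕ) + f n
      shift₁ n f = begin
        sum {n} (f ∘ suc ∘ toℕ) + f 0                            ≈⟨ +-comm _ _ ⟩
        sum {suc n} (f ∘ toℕ)                                    ≈⟨ sum-init-last {n} (f ∘ toℕ) ⟩
        sum {n} (λ i → f (toℕ (inject₁ i))) + f (toℕ (fromℕ n))  ≈⟨ +-cong
          (sum-cong-≋ {n} λ i → reflexive (≡.cong f (toℕ-inject₁ i)))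
          (reflexive (≡.cong f (toℕ-fromℕ n))) ⟩
        sum {n} (f ∘ toℕ) + f n                                  ∎

    Σ₀-shift : ∀ {f} → IsPeriodic f → ∀ s → Σ₀ (λ x → f (x ℕ.+ s)) ≈ Σ₀ f
    Σ₀-shift {f} per zero    = Σ₀-cong λ x → reflexive (≡.cong f (ℕₚ.+-identityʳ x))
    Σ₀-shift {f} per (suc s) = begin
      Σ₀ (λ x → f (x ℕ.+ suc s))     ≈⟨ Σ₀-cong (λ x → reflexive (≡.cong f (ℕₚ.+-suc x s))) ⟩
      -- `shift₁` leaves the surplus terms f(s) and f(N + s), which periodicity makes equal and
      -- hence cancellable.
      Σ₀ (λ x → f (suc x ℕ.+ s))     ≈⟨ +-cancelʳ (f s) _ _ (trans (shift₁ N (λ x → f (x ℕ.+ s)))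
                                         (+-congˡ (trans (reflexive (≡.cong f (ℕₚ.+-comm N s))) (per s)))) ⟩
      Σ₀ (λ x → f (x ℕ.+ s))         ≈⟨ Σ₀-shift per s ⟩
      Σ₀ f                           ∎

    private
      comm-right : ∀ x s t → x ℕ.+ s ℕ.+ t ≡ x ℕ.+ t ℕ.+ s
      comm-right x s t = ≡.trans (ℕₚ.+-assoc x s t)
        (≡.trans (≡.cong (x ℕ.+_) (ℕₚ.+-comm s t)) (≡.sym (ℕₚ.+-assoc x t s)))

    shift-periodic : ∀ {f} → IsPeriodic f → ∀ s → IsPeriodic (λ x → f (x ℕ.+ s))
    shift-periodic {f} per s x = trans (reflexive (≡.cong f (comm-right x N s))) (per (x ℕ.+ s))

    periodic-+* : ∀ {f} → IsPeriodic f → ∀ x q → f (x ℕ.+ q ℕ.* N) ≈ f x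
    periodic-+* {f} per x zero    = reflexive (≡.cong f (ℕₚ.+-identityʳ x))
    periodic-+* {f} per x (suc q) = begin
      f (x ℕ.+ (N ℕ.+ q ℕ.* N))  ≡⟨ ≡.cong f (ℕₚ.+-assoc x N (q ℕ.* N)) ⟨
      f (x ℕ.+ N ℕ.+ q ℕ.* N)    ≈⟨ periodic-+* per (x ℕ.+ N) q ⟩
      f (x ℕ.+ N)                ≈⟨ per x ⟩
      f x                        ∎

    periodic-% : ∀ {f} → IsPeriodic f → .{{_ : NonZero N}} → ∀ x → f (x % N) ≈ f x
    periodic-% {f} per x = sym (trans (reflexive (≡.cong f (m≡m%n+[m/n]*n x N))) (periodic-+* per (x % N) (x / N)))

    shift-back : ∀ {f} → IsPeriodic f → ∀ {s} → s ≤ N → ∀ x → f (x ℕ.+ s ℕ.+ (N ∸ s)) ≈ f x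
    shift-back {f} per {s} s≤N x = trans
      (reflexive (≡.cong f (≡.trans (ℕₚ.+-assoc x s (N ∸ s)) (≡.cong (x ℕ.+_) (ℕₚ.m+[n∸m]≡n s≤N)))))
      (per x)

    *-periodic : ∀ {f g} → IsPeriodic f → IsPeriodic g → IsPeriodic (λ x → f x * g x)
    *-periodic pf pg x = *-cong (pf x) (pg x)

    -- Along N-periodic sequences x - s is written x + (N ∸ s).
    backward : ∀ (f : ℕ → Carrier) s → ℕ → Carrier
    backward f s x = f (x ℕ.+ (N ∸ s))

    step : ∀ (f : ℕ → Carrier) s → ℕ → Carrier
    step f s x = f (x ℕ.+ s) + backward f s x

    module _ (k : ℕ) where

      neighbourSum : (ℕ → Carrier) → ℕ → Carrier
      neighbourSum f x = sum {k} λ i → step f (suc (toℕ i)) x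

      -- The Laplacian of C_N^k plus the potential κ.
      Schrödinger : (ℕ → Carrier) → (ℕ → Carrier) → ℕ → Carrier
      Schrödinger κ f x = κ x * f x + sum {k} λ i → (f x + f x) - step f (suc (toℕ i)) x

      step-periodic : ∀ {f} → IsPeriodic f → ∀ s → IsPeriodic (step f s)
      step-periodic per s x = +-cong (shift-periodic per s x) (shift-periodic per (N ∸ s) x)

      Schrödinger-periodic : ∀ {κ f} → IsPeriodic κ → IsPeriodic f → IsPeriodic (Schrödinger κ f)
      Schrödinger-periodic pκ pf x = +-cong (*-cong (pκ x) (pf x))
        (sum-cong-≋ {k} λ i → +-cong (+-cong (pf x) (pf x)) (-‿cong (step-periodic pf (suc (toℕ i)) x)))

      Schrödinger-shift : ∀ κ f s x →
        Schrödinger κ f (x ℕ.+ s) ≈ Schrödinger (λ y → κ (y ℕ.+ s)) (λ y → f (y ℕ.+ s)) x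
      Schrödinger-shift κ f s x = +-congˡ (sum-cong-≋ {k} λ i → +-congˡ (-‿cong (+-cong
        (reflexive (≡.cong f (comm-right x s _))) (reflexive (≡.cong f (comm-right x s _))))))

      Schrödinger-cong : ∀ κ {f g} → (∀ x → f x ≈ g x) → ∀ x → Schrödinger κ f x ≈ Schrödinger κ g x
      Schrödinger-cong κ f≈g x = +-cong (*-congˡ (f≈g x))
        (sum-cong-≋ {k} λ i → +-cong (+-cong (f≈g x) (f≈g x)) (-‿cong (+-cong (f≈g _) (f≈g _))))

      Schrödinger-+ : ∀ κ f g x →
        Schrödinger κ (λ y → f y + g y) x ≈ Schrödinger κ f x + Schrödinger κ g x
      Schrödinger-+ κ f g x = trans
        (+-cong (distribˡ _ _ _) (trans
          (sum-cong-≋ {k} λ i → solve 6 (λ f p m g q n →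
            ((f :+ g) :+ (f :+ g)) :- ((p :+ q) :+ (m :+ n)) := ((f :+ f) :- (p :+ m)) :+ ((g :+ g) :- (q :+ n)))
            refl _ _ _ _ _ _)
          (∑-distrib-+ {k} _ _)))
        (solve 4 (λ a b c d → (a :+ b) :+ (c :+ d) := (a :+ c) :+ (b :+ d)) refl _ _ _ _)

      Schrödinger-* : ∀ κ a f x → Schrödinger κ (λ y → a * f y) x ≈ a * Schrödinger κ f x
      Schrödinger-* κ a f x = trans
        (+-cong (solve 3 (λ a κ f → κ :* (a :* f) := a :* (κ :* f)) refl a (κ x) (f x)) (trans
          (sum-cong-≋ {k} λ i → solve 4 (λ a f p m →
            (a :* f :+ a :* f) :- (a :* p :+ a :* m) := a :* ((f :+ f) :- (p :+ m)))
            refl a (f x) _ _)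
          (sym (*-distribˡ-sum {k} _ _))))
        (sym (distribˡ _ _ _))

      Schrödinger-sum : ∀ κ n (a : Fin n → Carrier) (f : Fin n → ℕ → Carrier) x →
        Schrödinger κ (λ y → sum (λ c → a c * f c y)) x ≈ sum (λ c → a c * Schrödinger κ (f c) x)
      Schrödinger-sum κ zero a f x = trans (Schrödinger-cong κ (λ _ → sym (zeroˡ 0#)) x)
        (trans (Schrödinger-* κ 0# (λ _ → 0#) x) (zeroˡ _))
      Schrödinger-sum κ (suc n) a f x = trans (Schrödinger-+ κ (λ y → a zero * f zero y) (λ y → sum (λ c → a (suc c) * f (suc c) y)) x)
        (+-cong (Schrödinger-* κ (a zero) (f zero) x) (Schrödinger-sum κ n (a ∘ suc) (f ∘ suc) x))

      private
        split : ∀ κ f (u : ℕ → Carrier) → Σ₀ (λ x → u x * Schrödinger κ f x) ≈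
          Σ₀ (λ x → u x * (κ x * f x)) + sum {k} λ i → Σ₀ λ x → u x * ((f x + f x) - step f (suc (toℕ i)) x)
        split κ f u = begin
          Σ₀ (λ x → u x * Schrödinger κ f x)
            ≈⟨ sum-cong-≋ {N} (λ i → trans (distribˡ _ _ _) (+-congˡ (*-distribˡ-sum {k} _ _))) ⟩
          Σ₀ (λ x → u x * (κ x * f x) + sum {k} λ i → u x * ((f x + f x) - step f (suc (toℕ i)) x))
            ≈⟨ ∑-distrib-+ {N} _ _ ⟩
          _ ≈⟨ +-congˡ (∑-comm {N} {k} _) ⟩
          _ ∎


      module _ (k≤N : k ≤ N) where

        private
          s≤N : (i : Fin k) → suc (toℕ i) ≤ N
          s≤N i = ℕₚ.≤-trans (toℕ<n i) k≤N

          -- Summation by parts: g(x) is written as g((x - s) + s), after which the product is a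
          -- function of x + s and the summation variable can be translated.
          transfer : ∀ {f g} → IsPeriodic f → IsPeriodic g → ∀ {s} → s ≤ N →
            Σ₀ (λ x → g x * f (x ℕ.+ s)) ≈ Σ₀ (λ x → backward g s x * f x)
          transfer {f} {g} pf pg {s} s≤N = begin
            Σ₀ (λ x → g x * f (x ℕ.+ s))                    ≈⟨ sum-cong-≋ {N} (λ i → *-congʳ (shift-back pg s≤N (toℕ i))) ⟨
            Σ₀ (λ x → backward g s (x ℕ.+ s) * f (x ℕ.+ s))  ≈⟨ Σ₀-shift (*-periodic (shift-periodic pg (N ∸ s)) pf) s ⟩
            Σ₀ (λ x → backward g s x * f x)                  ∎

          -- Forward and backward shifts are adjoint to each other, so under transposition the two
          -- off-diagonal terms of the symmetric combination merely trade places.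
          step-selfAdjoint : ∀ {f g} → IsPeriodic f → IsPeriodic g → ∀ {s} → s ≤ N →
            Σ₀ (λ x → g x * ((f x + f x) - step f s x)) ≈ Σ₀ (λ x → f x * ((g x + g x) - step g s x))
          step-selfAdjoint {f} {g} pf pg {s} s≤N = begin
            Σ₀ (λ x → g x * ((f x + f x) - step f s x))
              ≈⟨ sum-cong-≋ {N} (λ i → solve 4 (λ g f p m → g :* ((f :+ f) :- (p :+ m)) :=
                   ((g :* f :+ g :* f) :+ (:- :1) :* (g :* p)) :+ (:- :1) :* (m :* g)) refl (g (toℕ i)) (f (toℕ i)) _ _) ⟩
            Σ₀ (λ x → ((g x * f x + g x * f x) + - 1# * (g x * f (x ℕ.+ s))) + - 1# * (backward f s x * g x))
              ≈⟨ trans (∑-distrib-+ {N} _ _) (+-cong (∑-distrib-+ {N} _ _) (sym (*-distribˡ-sum {N} _ _))) ⟩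
            (Σ₀ (λ x → g x * f x + g x * f x) + Σ₀ (λ x → - 1# * (g x * f (x ℕ.+ s)))) + - 1# * Σ₀ (λ x → backward f s x * g x)
              ≈⟨ +-cong (+-cong (sum-cong-≋ {N} λ i → +-cong (*-comm _ _) (*-comm _ _))
                   (trans (sym (*-distribˡ-sum {N} _ _)) (*-congˡ (transfer pf pg s≤N))))
                   (*-congˡ (sym (transfer pg pf s≤N))) ⟩
            (Σ₀ (λ x → f x * g x + f x * g x) + - 1# * Σ₀ (λ x → backward g s x * f x)) + - 1# * Σ₀ (λ x → f x * g (x ℕ.+ s))
              ≈⟨ solve 3 (λ a b c → (a :+ :- :1 :* b) :+ :- :1 :* c
                     := (a :+ :- :1 :* c) :+ :- :1 :* b) refl _ _ _ ⟩
            (Σ₀ (λ x → f x * g x + f x * g x) + - 1# * Σ₀ (λ x → f x * g (x ℕ.+ s))) + - 1# * Σ₀ (λ x → backward g s x * f x)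
              ≈⟨ trans (∑-distrib-+ {N} _ _) (+-cong (trans (∑-distrib-+ {N} _ _) (+-congˡ (sym (*-distribˡ-sum {N} _ _)))) (sym (*-distribˡ-sum {N} _ _))) ⟨
            Σ₀ (λ x → ((f x * g x + f x * g x) + - 1# * (f x * g (x ℕ.+ s))) + - 1# * (backward g s x * f x))
              ≈⟨ sum-cong-≋ {N} (λ i → solve 4 (λ g f p m → f :* ((g :+ g) :- (p :+ m)) :=
                   ((f :* g :+ f :* g) :+ (:- :1) :* (f :* p)) :+ (:- :1) :* (m :* f)) refl (g (toℕ i)) (f (toℕ i)) _ _) ⟨
            Σ₀ (λ x → f x * ((g x + g x) - step g s x)) ∎

        Schrödinger-selfAdjoint : ∀ {κ f g} → IsPeriodic f → IsPeriodic g →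
          Σ₀ (λ x → g x * Schrödinger κ f x) ≈ Σ₀ (λ x → f x * Schrödinger κ g x)
        Schrödinger-selfAdjoint {κ} {f} {g} pf pg = begin
          Σ₀ (λ x → g x * Schrödinger κ f x)  ≈⟨ split κ f g ⟩
          _                                   ≈⟨ +-cong
            (sum-cong-≋ {N} λ i → solve 3 (λ g κ f → g :* (κ :* f) := f :* (κ :* g)) refl (g (toℕ i)) (κ (toℕ i)) (f (toℕ i)))
            (sum-cong-≋ {k} λ i → step-selfAdjoint pf pg (s≤N i)) ⟩
          _                                   ≈⟨ split κ g f ⟨
          Σ₀ (λ x → f x * Schrödinger κ g x)  ∎

        private
          -- The expression splits into the one-sided halves f(f - f₊) and f(f - f₋). Translating
          -- the second by s turns it into f₊(f₊ - f), and the two halves complete each other to a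
          -- square.
          step-energy : ∀ {f} → IsPeriodic f → ∀ {s} → s ≤ N →
            Σ₀ (λ x → f x * ((f x + f x) - step f s x)) ≈
            Σ₀ (λ x → (f x - f (x ℕ.+ s)) * (f x - f (x ℕ.+ s)))
          step-energy {f} pf {s} s≤N = begin
            Σ₀ (λ x → f x * ((f x + f x) - step f s x))
              ≈⟨ sum-cong-≋ {N} (λ i → solve 3 (λ f p m → f :* ((f :+ f) :- (p :+ m)) := f :* (f :- p) :+ f :* (f :- m)) refl (f (toℕ i)) _ _) ⟩
            Σ₀ (λ x → f x * (f x - f (x ℕ.+ s)) + f x * (f x - backward f s x))
              ≈⟨ ∑-distrib-+ {N} _ _ ⟩
            Σ₀ (λ x → f x * (f x - f (x ℕ.+ s))) + Σ₀ (λ x → f x * (f x - backward f s x))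
              ≈⟨ +-congˡ (Σ₀-shift {λ x → f x * (f x - backward f s x)}
                   (λ x → *-cong (pf x) (+-cong (pf x) (-‿cong (shift-periodic pf (N ∸ s) x)))) s) ⟨
            Σ₀ (λ x → f x * (f x - f (x ℕ.+ s))) + Σ₀ (λ x → f (x ℕ.+ s) * (f (x ℕ.+ s) - backward f s (x ℕ.+ s)))
              ≈⟨ +-congˡ (sum-cong-≋ {N} λ i → *-congˡ (+-congˡ (-‿cong (shift-back pf s≤N (toℕ i))))) ⟩
            Σ₀ (λ x → f x * (f x - f (x ℕ.+ s))) + Σ₀ (λ x → f (x ℕ.+ s) * (f (x ℕ.+ s) - f x))
              ≈⟨ ∑-distrib-+ {N} _ _ ⟨
            Σ₀ (λ x → f x * (f x - f (x ℕ.+ s)) + f (x ℕ.+ s) * (f (x ℕ.+ s) - f x))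
              ≈⟨ sum-cong-≋ {N} (λ i → solve 2 (λ f p → f :* (f :- p) :+ p :* (p :- f) := (f :- p) :* (f :- p)) refl (f (toℕ i)) (f (toℕ i ℕ.+ s))) ⟩
            Σ₀ (λ x → (f x - f (x ℕ.+ s)) * (f x - f (x ℕ.+ s))) ∎

        Schrödinger-energy : ∀ {κ f} → IsPeriodic f →
          Σ₀ (λ x → f x * Schrödinger κ f x) ≈
          Σ₀ (λ x → κ x * (f x * f x)) +
          sum {k} λ i → Σ₀ λ x → (f x - f (x ℕ.+ suc (toℕ i))) * (f x - f (x ℕ.+ suc (toℕ i)))
        Schrödinger-energy {κ} {f} pf = trans (split κ f f) (+-cong
          (sum-cong-≋ {N} λ i → solve 2 (λ κ f → f :* (κ :* f) := κ :* (f :* f)) refl (κ (toℕ i)) (f (toℕ i)))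
          (sum-cong-≋ {k} λ i → step-energy pf (s≤N i)))

-- The ordered field ℚ behind opaque operations.

module Opaque where

  open IntegerSolver
  open import Algebra.Bundles using (CommutativeRing)
  open import Algebra.Structures using (IsCommutativeRing)
  import Algebra.Properties.Semiring.Sum
  open import Data.Fin.Base using (Fin; zero; suc)
  import Data.Integer.Base as ℤ
  import Data.Integer.Properties as ℤₚ
  open import Data.Nat.Base as ℕ using (ℕ; zero; suc)
  import Data.Nat.Properties as ℕₚ
  open import Data.Product.Base using (∃; _,_)
  import Data.Rational.Unnormalised.Base as ℚᵘ
  import Data.Rational.Unnormalised.Properties as ℚᵘₚ
  import Algebra.Properties.Ring
  open import Data.Rational.Base as ℚ using (ℚ; 0ℚ; 1ℚ; _≤_; _<_)
  import Data.Rational.Properties as ℚₚ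
  open import Data.Sum.Base using (_⊎_; inj₁; inj₂)
  open import Function.Base using (_∘_)
  open import Level using (0ℓ)
  open import Relation.Binary.PropositionalEquality
    using (_≡_; _≢_; refl; sym; trans; cong; cong₂; subst; module ≡-Reasoning)
  open import Relation.Nullary.Decidable using (yes; no)

  -- Opaque copies of the operations of ℚ: the originals match on records with
  -- eta, so they unfold at every conversion check.
  opaque
    infixl 6 _+_
    infixl 7 _*_
    infix  8 -_

    _+_ _*_ : ℚ → ℚ → ℚ
    _+_ = ℚ._+_
    _*_ = ℚ._*_

    -_ : ℚ → ℚ
    -_ = ℚ.-_

    +-def : ∀ p q → p + q ≡ p ℚ.+ q
    +-def p q = refl

    *-def : ∀ p q → p * q ≡ p ℚ.* q
    *-def p q = refl

    isCommutativeRing : IsCommutativeRing _≡_ _+_ _*_ -_ 0ℚ 1ℚ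
    isCommutativeRing = ℚₚ.+-*-isCommutativeRing

    +-mono-≤ : ∀ {p q r s} → p ≤ q → r ≤ s → p + r ≤ q + s
    +-mono-≤ = ℚₚ.+-mono-≤

    +-monoˡ-< : ∀ {p q} r → p < q → p + r < q + r
    +-monoˡ-< r p<q = ℚₚ.+-monoˡ-< r p<q

    0≤p*q : ∀ {p q} → 0ℚ ≤ p → 0ℚ ≤ q → 0ℚ ≤ p * q
    0≤p*q {p} {q} 0≤p 0≤q = ℚₚ.nonNegative⁻¹ (p * q)
      {{ℚₚ.nonNeg*nonNeg⇒nonNeg p {{ℚ.nonNegative 0≤p}} q {{ℚ.nonNegative 0≤q}}}}

    0≤p*p : ∀ p → 0ℚ ≤ p * p
    0≤p*p p with ℚₚ.≤-total 0ℚ p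
    ... | inj₁ 0≤p = 0≤p*q 0≤p 0≤p
    ... | inj₂ p≤0 = ℚₚ.nonNegative⁻¹ (p * p)
      {{ℚₚ.nonPos*nonPos⇒nonPos p {{ℚ.nonPositive p≤0}} p {{ℚ.nonPositive p≤0}}}}

    recipℚ : ∀ p → p ≢ 0ℚ → ℚ
    recipℚ p p≢0 = (ℚ.1/ p) {{ℚ.≢-nonZero p≢0}}

    *-inverseˡ : ∀ p (p≢0 : p ≢ 0ℚ) → recipℚ p p≢0 * p ≡ 1ℚ
    *-inverseˡ p p≢0 = ℚₚ.*-inverseˡ p {{ℚ.≢-nonZero p≢0}}

    *-cancelˡ-≤ : ∀ {r p q} → 0ℚ < r → r * p ≤ r * q → p ≤ q
    *-cancelˡ-≤ {r} 0<r = ℚₚ.*-cancelˡ-≤-pos r {{ℚ.positive 0<r}}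

    *-cancelˡ-< : ∀ {r p q} → 0ℚ ≤ r → r * p < r * q → p < q
    *-cancelˡ-< {r} 0≤r = ℚₚ.*-cancelˡ-<-nonNeg r {{ℚ.nonNegative 0≤r}}

    *-monoˡ-< : ∀ {r p q} → 0ℚ < r → p < q → r * p < r * q
    *-monoˡ-< {r} 0<r = ℚₚ.*-monoʳ-<-pos r {{ℚ.positive 0<r}}

    ι : ℕ → ℚ
    ι n = ℤ.+ n ℚ./ 1

    ι-def : ∀ n → ι n ≡ ℤ.+ n ℚ./ 1
    ι-def n = refl

    ι-0 : ι 0 ≡ 0ℚ
    ι-0 = refl

    ι-1 : ι 1 ≡ 1ℚ
    ι-1 = refl

    private
      toℚᵘ-ι : ∀ n → ℚ.toℚᵘ (ι n) ℚᵘ.≃ ℚᵘ.mkℚᵘ (ℤ.+ n) 0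
      toℚᵘ-ι n = ℚₚ.toℚᵘ-fromℚᵘ (ℚᵘ.mkℚᵘ (ℤ.+ n) 0)

    ι-+ : ∀ m n → ι (m ℕ.+ n) ≡ ι m + ι n
    ι-+ m n = ℚₚ.toℚᵘ-injective (begin
      ℚ.toℚᵘ (ι (m ℕ.+ n))                             ≈⟨ toℚᵘ-ι (m ℕ.+ n) ⟩
      ℚᵘ.mkℚᵘ (ℤ.+ (m ℕ.+ n)) 0                        ≈⟨ ℚᵘ.*≡* (cong (ℤ._* ℤ.1ℤ)
        (sym (cong₂ ℤ._+_ (ℤₚ.*-identityʳ (ℤ.+ m)) (ℤₚ.*-identityʳ (ℤ.+ n))))) ⟩
      ℚᵘ.mkℚᵘ (ℤ.+ m) 0 ℚᵘ.+ ℚᵘ.mkℚᵘ (ℤ.+ n) 0         ≈⟨ ℚᵘₚ.+-cong (toℚᵘ-ι m) (toℚᵘ-ι n) ⟨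
      ℚ.toℚᵘ (ι m) ℚᵘ.+ ℚ.toℚᵘ (ι n)                   ≈⟨ ℚₚ.toℚᵘ-homo-+ (ι m) (ι n) ⟨
      ℚ.toℚᵘ (ι m + ι n)                               ∎)
      where open import Relation.Binary.Reasoning.Setoid ℚᵘₚ.≃-setoid

    0≤ι : ∀ n → 0ℚ ≤ ι n
    0≤ι n = ℚₚ.nonNegative⁻¹ (ι n) {{ℚₚ.normalize-nonNeg n 1}}

    0<ι : ∀ n → 0ℚ < ι (suc n)
    0<ι n = ℚₚ.positive⁻¹ (ι (suc n)) {{ℚₚ.normalize-pos (suc n) 1}}

    1/n*n≡1 : ∀ n → (ℤ.+ 1 ℚ./ suc n) * ι (suc n) ≡ 1ℚ
    1/n*n≡1 n = ℚₚ.toℚᵘ-injective (begin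
      ℚ.toℚᵘ ((ℤ.+ 1 ℚ./ suc n) * ι (suc n))               ≈⟨ ℚₚ.toℚᵘ-homo-* (ℤ.+ 1 ℚ./ suc n) (ι (suc n)) ⟩
      ℚ.toℚᵘ (ℤ.+ 1 ℚ./ suc n) ℚᵘ.* ℚ.toℚᵘ (ι (suc n))     ≈⟨ ℚᵘₚ.*-cong (ℚₚ.toℚᵘ-fromℚᵘ (ℚᵘ.mkℚᵘ (ℤ.+ 1) n)) (toℚᵘ-ι (suc n)) ⟩
      ℚᵘ.mkℚᵘ (ℤ.+ 1) n ℚᵘ.* ℚᵘ.mkℚᵘ (ℤ.+ suc n) 0         ≈⟨ ℚᵘ.*≡* (cong ℤ.+_ (trans (ℕₚ.*-identityʳ (1 ℕ.* suc n)) (sym (cong (1 ℕ.*_) (ℕₚ.*-identityʳ (suc n)))))) ⟩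
      ℚᵘ.1ℚᵘ                                               ∎)
      where open import Relation.Binary.Reasoning.Setoid ℚᵘₚ.≃-setoid

    0≤1/n : ∀ n → 0ℚ ≤ ℤ.+ 1 ℚ./ suc n
    0≤1/n n = ℚₚ.nonNegative⁻¹ (ℤ.+ 1 ℚ./ suc n) {{ℚₚ.normalize-nonNeg 1 (suc n)}}

    -- The absolute value of the numerator is a bound because the denominator is at least 1.
    archimedean : ∀ p → ∃ λ n → p ≤ ι n
    archimedean p@(ℚ.mkℚ i d-1 _) = ℤ.∣ i ∣ , ℚₚ.toℚᵘ-cancel-≤ (ℚᵘₚ.≤-respʳ-≃ (ℚᵘₚ.≃-sym (toℚᵘ-ι ℤ.∣ i ∣)) (ℚᵘ.*≤*
      (subst (ℤ._≤ ℤ.+ ℤ.∣ i ∣ ℤ.* ℤ.+ suc d-1) (sym (ℤₚ.*-identityʳ i))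
        (ℤₚ.≤-trans (i≤∣i∣ i) (subst (ℤ.+ ℤ.∣ i ∣ ℤ.≤_) (ℤₚ.pos-* ℤ.∣ i ∣ (suc d-1)) (ℤ.+≤+ (ℕₚ.m≤m*n ℤ.∣ i ∣ (suc d-1))))))))
      where
      i≤∣i∣ : ∀ i → i ℤ.≤ ℤ.+ ℤ.∣ i ∣
      i≤∣i∣ (ℤ.+ n)    = ℤₚ.≤-refl
      i≤∣i∣ ℤ.-[1+ n ] = ℤ.-≤+

    ∣q-p∣≡p-q : ∀ p q → q ≤ p → ℚ.∣ q ℚ.- p ∣ ≡ p + - q
    ∣q-p∣≡p-q p q q≤p = trans (sym (ℚₚ.∣-p∣≡∣p∣ (q ℚ.- p))) (trans
      (cong ℚ.∣_∣ (trans (ℚₚ.neg-distrib-+ q (ℚ.- p)) (trans (cong (ℚ.- q ℚ.+_) (ℚ-neg-involutive p)) (ℚₚ.+-comm (ℚ.- q) p))))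
      (ℚₚ.0≤p⇒∣p∣≡p (subst (ℚ._≤ p ℚ.- q) (ℚₚ.+-inverseʳ q) (ℚₚ.+-monoˡ-≤ (ℚ.- q) q≤p))))
      where
      ℚ-neg-involutive : ∀ p → ℚ.- (ℚ.- p) ≡ p
      ℚ-neg-involutive = Algebra.Properties.Ring.-‿involutive ℚₚ.+-*-ring

  ℚ-ring : CommutativeRing 0ℓ 0ℓ
  ℚ-ring = record { isCommutativeRing = isCommutativeRing }

  open CommutativeRing ℚ-ring public
    using (_-_; +-comm; +-assoc; *-comm; *-assoc; +-identityˡ; +-identityʳ; *-identityˡ; *-identityʳ
          ; distribˡ; distribʳ; zeroˡ; zeroʳ)
  module ℚΣ = Algebra.Properties.Semiring.Sum (CommutativeRing.semiring ℚ-ring)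
  module ℚ-Integers = IntegerCoefficients ℚ-ring
  open ℚΣ public using (sum)

  p*q≡0⇒p≡0∨q≡0 : ∀ p q → p * q ≡ 0ℚ → p ≡ 0ℚ ⊎ q ≡ 0ℚ
  p*q≡0⇒p≡0∨q≡0 p q pq≡0 with p ℚₚ.≟ 0ℚ
  ... | yes p≡0 = inj₁ p≡0
  ... | no  p≢0 = inj₂ (begin
    q                 ≡⟨ *-identityˡ q ⟨
    1ℚ * q            ≡⟨ cong (_* q) (*-inverseˡ p p≢0) ⟨
    p⁻¹ * p * q       ≡⟨ *-assoc p⁻¹ p q ⟩
    p⁻¹ * (p * q)     ≡⟨ cong (p⁻¹ *_) pq≡0 ⟩
    p⁻¹ * 0ℚ          ≡⟨ zeroʳ p⁻¹ ⟩
    0ℚ                ∎)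
    where
    open ≡-Reasoning
    p⁻¹ = recipℚ p p≢0

  0≤p+q : ∀ {p q} → 0ℚ ≤ p → 0ℚ ≤ q → 0ℚ ≤ p + q
  0≤p+q {p} {q} 0≤p 0≤q = subst (_≤ p + q) (+-identityˡ 0ℚ) (+-mono-≤ 0≤p 0≤q)

  p≤p+q : ∀ {p q} → 0ℚ ≤ q → p ≤ p + q
  p≤p+q {p} {q} 0≤q = subst (_≤ p + q) (+-identityʳ p) (+-mono-≤ ℚₚ.≤-refl 0≤q)

  p+q≡0⇒p≡0 : ∀ {p q} → 0ℚ ≤ p → 0ℚ ≤ q → p + q ≡ 0ℚ → p ≡ 0ℚ
  p+q≡0⇒p≡0 {p} {q} 0≤p 0≤q p+q≡0 = ℚₚ.≤-antisym (subst (p ≤_) p+q≡0 (p≤p+q 0≤q)) 0≤p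

  p+q≡0⇒q≡0 : ∀ {p q} → 0ℚ ≤ p → 0ℚ ≤ q → p + q ≡ 0ℚ → q ≡ 0ℚ
  p+q≡0⇒q≡0 {p} {q} 0≤p 0≤q p+q≡0 = p+q≡0⇒p≡0 0≤q 0≤p (trans (+-comm q p) p+q≡0)

  0≤q-p : ∀ {p q} → p ≤ q → 0ℚ ≤ q - p
  0≤q-p {p} {q} p≤q = subst (_≤ q - p) (CommutativeRing.-‿inverseʳ ℚ-ring p) (+-mono-≤ p≤q ℚₚ.≤-refl)

  p≤q⇐0≤q-p : ∀ {p q} → 0ℚ ≤ q - p → p ≤ q
  p≤q⇐0≤q-p {p} {q} 0≤q-p = subst (p ≤_) (solve 2 (λ p q → p :+ (q :- p) := q) refl p q) (p≤p+q 0≤q-p)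
    where open ℚ-Integers.Solver

  p-q≤p : ∀ {p q} → 0ℚ ≤ q → p - q ≤ p
  p-q≤p {p} {q} 0≤q = p≤q⇐0≤q-p (subst (0ℚ ≤_) (solve 2 (λ p q → q := p :- (p :- q)) refl p q) 0≤q)
    where open ℚ-Integers.Solver

  0<1 : 0ℚ < 1ℚ
  0<1 = ℚₚ.positive⁻¹ 1ℚ

  *-monoˡ-≤ : ∀ {r p q} → 0ℚ ≤ r → p ≤ q → r * p ≤ r * q
  *-monoˡ-≤ {r} {p} {q} 0≤r p≤q = p≤q⇐0≤q-p (subst (0ℚ ≤_)
    (solve 3 (λ r p q → r :* (q :- p) := r :* q :- r :* p) refl r p q) (0≤p*q 0≤r (0≤q-p p≤q)))
    where open ℚ-Integers.Solver

  0≤sum : ∀ {n} (f : Fin n → ℚ) → (∀ i → 0ℚ ≤ f i) → 0ℚ ≤ sum f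
  0≤sum {zero}  f 0≤f = ℚₚ.≤-refl
  0≤sum {suc n} f 0≤f = 0≤p+q (0≤f zero) (0≤sum (f ∘ suc) (0≤f ∘ suc))

  sum≡0⇒≡0 : ∀ {n} (f : Fin n → ℚ) → (∀ i → 0ℚ ≤ f i) → sum f ≡ 0ℚ → ∀ i → f i ≡ 0ℚ
  sum≡0⇒≡0 f 0≤f eq zero    = p+q≡0⇒p≡0 (0≤f zero) (0≤sum (f ∘ suc) (0≤f ∘ suc)) eq
  sum≡0⇒≡0 f 0≤f eq (suc i) = sum≡0⇒≡0 (f ∘ suc) (0≤f ∘ suc)
    (p+q≡0⇒q≡0 (0≤f zero) (0≤sum (f ∘ suc) (0≤f ∘ suc)) eq) i

  sum-zero : ∀ {n} (f : Fin n → ℚ) → (∀ i → f i ≡ 0ℚ) → sum f ≡ 0ℚ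
  sum-zero {n} f f≡0 = trans (ℚΣ.sum-cong-≗ f≡0) (ℚΣ.sum-replicate-zero n)

-- Linear dependence and square linear systems over ℚ.

module LinearAlgebra where

  open IntegerSolver
  open PeriodicSequences
  open Opaque
  open import Data.Empty using (⊥)
  open import Data.Fin.Base using (Fin; zero; suc; punchIn)
  open import Data.Fin.Properties using (any?)
  open import Data.Nat.Base using (zero; suc)
  open import Data.Product.Base using (∃; _×_; _,_; proj₁; proj₂)
  open import Data.Rational.Base using (ℚ; 0ℚ; 1ℚ)
  import Data.Rational.Properties as ℚₚ
  open import Data.Sum.Base using (inj₁; inj₂)
  open import Data.Vec.Functional using (insertAt)
  open import Data.Vec.Functional.Properties using (insertAt-lookup; insertAt-punchIn)
  open import Function.Base using (_∘_)
  open import Relation.Binary.PropositionalEquality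
    using (_≡_; _≢_; refl; sym; trans; cong; cong₂; module ≡-Reasoning)
  open import Relation.Nullary.Decidable using (yes; no; ¬?; decidable-stable)

  open ℚ-Integers using (module Solver)
  open Solver using (solve; _:=_; _:+_; _:*_; _:-_; :-_; :0; :1)

  -- Fraction-free elimination: a pivot vᵢ with first entry a ≠ 0 turns the
  -- remaining vectors into a vⱼ - vⱼ₀ vᵢ, whose first entry vanishes.
  dependent : ∀ n (v : Fin (suc n) → Fin n → ℚ) → ∃ λ (c : Fin (suc n) → ℚ) →
              (∃ λ i → c i ≢ 0ℚ) × (∀ j → sum (λ i → c i * v i j) ≡ 0ℚ)
  dependent zero    v = (λ _ → 1ℚ) , (zero , ℚₚ.1≢0) , λ ()
  dependent (suc n) v with any? (λ i → ¬? (v i zero ℚₚ.≟ 0ℚ))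
  ... | no none =
    let c , (i , ci≢0) , eq = dependent n (λ i j → v (suc i) (suc j))
        v₀≡0 : ∀ i → v i zero ≡ 0ℚ
        v₀≡0 i = decidable-stable (v i zero ℚₚ.≟ 0ℚ) (λ ne → none (i , ne))
        c⁺ : Fin (suc (suc n)) → ℚ
        c⁺ = λ { zero → 0ℚ ; (suc i) → c i }
        eq⁺ : ∀ j → sum (λ i → c⁺ i * v i j) ≡ 0ℚ
        eq⁺ = λ { zero    → sum-zero (λ i → c⁺ i * v i zero)
                              (λ i → trans (cong (c⁺ i *_) (v₀≡0 i)) (zeroʳ (c⁺ i)))
                ; (suc j) → trans (cong₂ _+_ (zeroˡ (v zero (suc j))) (eq j)) (+-identityˡ 0ℚ) }
    in c⁺ , (suc i , ci≢0) , eq⁺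
  ... | yes (i , a≢0) = c⁺ , (punchIn i (proj₁ nz) , nz⁺) , eq⁺
    where
    open ≡-Reasoning
    a = v i zero
    u = λ j → v (punchIn i j)
    w = λ j col → a * u j (suc col) - u j zero * v i (suc col)
    ih = dependent n w
    c  = proj₁ ih
    nz = proj₁ (proj₂ ih)
    S  = sum λ j → c j * u j zero
    -- The relation Σ_j c_j (a u_j - u_j₀ v_i) = 0 is sorted by vectors: u_j receives a c_j, and the
    -- pivot receives - Σ_j c_j u_j₀. The first coordinate then cancels by construction.
    c⁺ = insertAt (λ j → a * c j) i (- S)

    nz⁺ : c⁺ (punchIn i (proj₁ nz)) ≢ 0ℚ
    nz⁺ eq with p*q≡0⇒p≡0∨q≡0 a (c (proj₁ nz)) (trans (sym (insertAt-punchIn _ i (- S) (proj₁ nz))) eq)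
    ... | inj₁ a≡0 = a≢0 a≡0
    ... | inj₂ c≡0 = proj₂ nz c≡0

    combination : ∀ j → sum (λ l → c⁺ l * v l j) ≡ - S * v i j + sum (λ l → a * c l * u l j)
    combination j = trans (ℚΣ.sum-remove {i = i} (λ l → c⁺ l * v l j)) (cong₂ _+_
      (cong (_* v i j) (insertAt-lookup _ i (- S)))
      (ℚΣ.sum-cong-≗ λ l → cong (_* u l j) (insertAt-punchIn (λ j → a * c j) i (- S) l)))

    eq⁺ : ∀ j → sum (λ l → c⁺ l * v l j) ≡ 0ℚ
    eq⁺ zero = begin
      sum (λ l → c⁺ l * v l zero)                   ≡⟨ combination zero ⟩
      - S * a + sum (λ l → a * c l * u l zero)      ≡⟨ cong (λ z → - S * a + z) (ℚΣ.sum-cong-≗ λ l → *-assoc a (c l) (u l zero)) ⟩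
      - S * a + sum (λ l → a * (c l * u l zero))    ≡⟨ cong (λ z → - S * a + z) (ℚΣ.*-distribˡ-sum a (λ l → c l * u l zero)) ⟨
      - S * a + a * S                               ≡⟨ solve 2 (λ S a → :- S :* a :+ a :* S := :0) refl S a ⟩
      0ℚ                                            ∎
    eq⁺ (suc j) = begin
      sum (λ l → c⁺ l * v l (suc j))                                               ≡⟨ combination (suc j) ⟩
      - S * y + sum (λ l → a * c l * u l (suc j))                                  ≡⟨ cong (λ z → z + sum (λ l → a * c l * u l (suc j))) (solve 2 (λ S y → :- S :* y := S :* (:- y)) refl S y) ⟩
      S * (- y) + sum (λ l → a * c l * u l (suc j))                                ≡⟨ cong (λ z → z + sum (λ l → a * c l * u l (suc j))) (ℚΣ.*-distribʳ-sum (- y) (λ l → c l * u l zero)) ⟩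
      sum (λ l → c l * u l zero * (- y)) + sum (λ l → a * c l * u l (suc j))       ≡⟨ ℚΣ.∑-distrib-+ {n = suc n} (λ l → c l * u l zero * (- y)) (λ l → a * c l * u l (suc j)) ⟨
      sum (λ l → c l * u l zero * (- y) + a * c l * u l (suc j))                   ≡⟨ ℚΣ.sum-cong-≗ (λ l →
        solve 5 (λ c z y a x → c :* z :* (:- y) :+ a :* c :* x := c :* (a :* x :- z :* y)) refl (c l) (u l zero) y a (u l (suc j))) ⟩
      sum (λ l → c l * w l j)                                                      ≡⟨ proj₂ (proj₂ ih) j ⟩
      0ℚ                                                                           ∎
      where y = v i (suc j)

  record IsLinear {n} (T : (Fin n → ℚ) → Fin n → ℚ) : Set where
    field
      T-cong : ∀ {f g} → (∀ i → f i ≡ g i) → ∀ i → T f i ≡ T g i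
      T-+    : ∀ f g i → T (λ j → f j + g j) i ≡ T f i + T g i
      T-*    : ∀ a f i → T (λ j → a * f j) i ≡ a * T f i

    T-zero : ∀ i → T (λ _ → 0ℚ) i ≡ 0ℚ
    T-zero i = trans (T-cong (λ _ → sym (zeroˡ 0ℚ)) i) (trans (T-* 0ℚ (λ _ → 0ℚ) i) (zeroˡ (T (λ _ → 0ℚ) i)))

    T-sum : ∀ {m} (g : Fin m → Fin n → ℚ) i → T (λ j → sum (λ l → g l j)) i ≡ sum (λ l → T (g l) i)
    T-sum {zero}  g i = T-zero i
    T-sum {suc m} g i = trans (T-+ (g zero) _ i) (cong (T (g zero) i +_) (T-sum (g ∘ suc) i))

  basis : ∀ {n} → Fin n → Fin n → ℚ
  basis zero    zero    = 1ℚ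
  basis zero    (suc j) = 0ℚ
  basis (suc i) zero    = 0ℚ
  basis (suc i) (suc j) = basis i j

  basis-expansion : ∀ {n} (f : Fin n → ℚ) j → sum (λ i → f i * basis i j) ≡ f j
  basis-expansion f zero = trans (cong₂ _+_ (*-identityʳ (f zero))
    (sum-zero (λ i → f (suc i) * 0ℚ) (λ i → zeroʳ (f (suc i))))) (+-identityʳ (f zero))
  basis-expansion f (suc j) = trans (cong₂ _+_ (zeroʳ (f zero)) (basis-expansion (f ∘ suc) j))
    (+-identityˡ (f (suc j)))

  -- The n + 1 vectors b, T e₁, ..., T eₙ of ℚⁿ are dependent. If b had coefficient 0, the other
  -- coefficients would form a kernel element of T and vanish too; so the relation can be solved for
  -- b.
  injective⇒surjective : ∀ {n} {T : (Fin n → ℚ) → Fin n → ℚ} → IsLinear T →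
    (∀ f → (∀ i → T f i ≡ 0ℚ) → ∀ i → f i ≡ 0ℚ) →
    ∀ b → ∃ λ f → ∀ i → T f i ≡ b i
  injective⇒surjective {n} {T} linear injective b = f , Tf≡b
    where
    open IsLinear linear
    open ≡-Reasoning
    v : Fin (suc n) → Fin n → ℚ
    v zero    = b
    v (suc i) = T (basis i)
    relation = dependent n v
    c  = proj₁ relation
    c₀ = c zero
    c′ = c ∘ suc

    Tc′ : ∀ j → c₀ * b j + T c′ j ≡ 0ℚ
    Tc′ j = begin
      c₀ * b j + T c′ j                                      ≡⟨ cong (λ z → c₀ * b j + z) (T-cong (λ i → sym (basis-expansion c′ i)) j) ⟩
      c₀ * b j + T (λ i → sum (λ l → c′ l * basis l i)) j    ≡⟨ cong (λ z → c₀ * b j + z) (T-sum (λ l i → c′ l * basis l i) j) ⟩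
      c₀ * b j + sum (λ l → T (λ i → c′ l * basis l i) j)    ≡⟨ cong (λ z → c₀ * b j + z) (ℚΣ.sum-cong-≗ λ l → T-* (c′ l) (basis l) j) ⟩
      sum (λ i → c i * v i j)                                ≡⟨ proj₂ (proj₂ relation) j ⟩
      0ℚ                                                     ∎

    c₀≢0 : c₀ ≢ 0ℚ
    c₀≢0 c₀≡0 = nonzero (proj₁ (proj₂ relation))
      where
      Tc′≡0 : ∀ j → T c′ j ≡ 0ℚ
      Tc′≡0 j = begin
        T c′ j               ≡⟨ +-identityˡ _ ⟨
        0ℚ + T c′ j          ≡⟨ cong (_+ T c′ j) (zeroˡ (b j)) ⟨
        0ℚ * b j + T c′ j    ≡⟨ cong (λ x → x * b j + T c′ j) c₀≡0 ⟨
        c₀ * b j + T c′ j    ≡⟨ Tc′ j ⟩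
        0ℚ                   ∎
      nonzero : (∃ λ i → c i ≢ 0ℚ) → ⊥
      nonzero (zero  , ne) = ne c₀≡0
      nonzero (suc i , ne) = ne (injective c′ Tc′≡0 i)

    c₀⁻¹ = recipℚ c₀ c₀≢0

    f = λ j → - (c₀⁻¹) * c′ j

    Tf≡b : ∀ i → T f i ≡ b i
    Tf≡b i = begin
      T f i                                          ≡⟨ T-* (- (c₀⁻¹)) c′ i ⟩
      - (c₀⁻¹) * T c′ i                             ≡⟨ solve 4 (λ d c b t → :- d :* t := d :* c :* b :- d :* (c :* b :+ t)) refl (c₀⁻¹) c₀ (b i) (T c′ i) ⟩
      c₀⁻¹ * c₀ * b i - c₀⁻¹ * (c₀ * b i + T c′ i) ≡⟨ cong₂ (λ x y → x * b i - c₀⁻¹ * y) (*-inverseˡ c₀ c₀≢0) (Tc′ i) ⟩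
      1ℚ * b i - c₀⁻¹ * 0ℚ                          ≡⟨ solve 2 (λ b d → :1 :* b :- d :* :0 := b) refl (b i) (c₀⁻¹) ⟩
      b i                                            ∎

-- Unique solvability of Schrödinger equations on the cycle over ℚ.

module RationalSchrödinger where

  open IntegerSolver
  open PeriodicSequences
  open Opaque
  open LinearAlgebra
  open import Data.Fin.Base using (Fin; zero; suc; toℕ; fromℕ<)
  open import Data.Fin.Properties using (toℕ-fromℕ<; toℕ-injective; toℕ<n)
  open import Data.Nat.Base as ℕ using (ℕ; zero; suc; NonZero)
  open import Data.Nat.DivMod using (m%n<n; m<n⇒m%n≡m; _mod_; [m+n]%n≡m%n)
  import Data.Nat.Properties as ℕₚ
  open import Data.Product.Base using (∃; _×_; _,_; proj₁; proj₂)
  open import Data.Rational.Base using (ℚ; 0ℚ; _≤_)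
  open import Data.Sum.Base using ([_,_]′)
  open import Function.Base using (_∘_; id)
  open import Relation.Binary.PropositionalEquality
    using (_≡_; _≢_; refl; sym; trans; cong; cong₂; subst; module ≡-Reasoning)
  open import Relation.Nullary.Negation using (contradiction)

  open ℚ-Integers using (module Solver)
  open Solver using (solve; _:=_; _:-_; :-_; :0)

  module ℚSchrödinger (N k : ℕ) .{{_ : NonZero N}} where
    open Periodic ℚ-ring N

    extend : (Fin N → ℚ) → ℕ → ℚ
    extend f x = f (x mod N)

    extend-periodic : ∀ f → IsPeriodic (extend f)
    extend-periodic f x = cong f (toℕ-injective (trans (toℕ-fromℕ< _)
      (trans ([m+n]%n≡m%n x N) (sym (toℕ-fromℕ< (m%n<n x N))))))

    extend-toℕ : ∀ f i → extend f (toℕ i) ≡ f i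
    extend-toℕ f i = cong f (toℕ-injective (trans (toℕ-fromℕ< _) (m<n⇒m%n≡m (toℕ<n i))))

    module _ (κ : ℕ → ℚ) where

      operator : (Fin N → ℚ) → Fin N → ℚ
      operator f i = Schrödinger k κ (extend f) (toℕ i)

      operator-linear : IsLinear operator
      operator-linear = record
        { T-cong = λ eq i → Schrödinger-cong k κ (λ x → eq (x mod N)) (toℕ i)
        ; T-+    = λ f g i → Schrödinger-+ k κ (extend f) (extend g) (toℕ i)
        ; T-*    = λ a f i → Schrödinger-* k κ a (extend f) (toℕ i)
        }

      module _ (κ-nonneg : ∀ x → 0ℚ ≤ κ x) (κ₀≢0 : κ 0 ≢ 0ℚ) (1≤k : 1 ℕ.≤ k) (k≤N : k ℕ.≤ N) where

        private
          square : ℚ → ℚ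
          square p = p * p

          square≡0 : ∀ p → square p ≡ 0ℚ → p ≡ 0ℚ
          square≡0 p eq = [ id , id ]′ (p*q≡0⇒p≡0∨q≡0 p p eq)

        -- By the energy identity a kernel element is invariant under x ↦ x + 1 and vanishes at 0.
        Schrödinger-injective : ∀ {F} → IsPeriodic F → (∀ (i : Fin N) → Schrödinger k κ F (toℕ i) ≡ 0ℚ) →
          ∀ x → F x ≡ 0ℚ
        Schrödinger-injective {F} pF SF≡0 x = trans (constant x) F0≡0
          where
          potential = λ (i : Fin N) → κ (toℕ i) * (F (toℕ i) * F (toℕ i))
          gradient = λ (j : Fin k) (i : Fin N) → square (F (toℕ i) - F (toℕ i ℕ.+ suc (toℕ j)))
          0≤potential : ∀ i → 0ℚ ≤ potential i
          0≤potential i = 0≤p*q (κ-nonneg (toℕ i)) (0≤p*p (F (toℕ i)))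
          0≤gradient : ∀ j i → 0ℚ ≤ gradient j i
          0≤gradient j i = 0≤p*p (F (toℕ i) - F (toℕ i ℕ.+ suc (toℕ j)))
          0≤gradients : ∀ j → 0ℚ ≤ sum (gradient j)
          0≤gradients j = 0≤sum (gradient j) (0≤gradient j)
          energy≡0 : sum potential + sum (λ j → sum (gradient j)) ≡ 0ℚ
          energy≡0 = trans (sym (Schrödinger-energy k k≤N {κ} {F} pF))
            (sum-zero (λ i → F (toℕ i) * Schrödinger k κ F (toℕ i))
              λ i → trans (cong (F (toℕ i) *_) (SF≡0 i)) (zeroʳ (F (toℕ i))))
          -- Index 0 stands for the offset s = 1, present because k ≥ 1; invariance under this one
          -- offset already connects all of ℤ/N.
          j₀ : Fin k
          j₀ = fromℕ< 1≤k
          increment : ∀ i → gradient j₀ i ≡ 0ℚ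
          increment = sum≡0⇒≡0 (gradient j₀) (0≤gradient j₀)
            (sum≡0⇒≡0 (λ j → sum (gradient j)) 0≤gradients
              (p+q≡0⇒q≡0 (0≤sum potential 0≤potential) (0≤sum (λ j → sum (gradient j)) 0≤gradients) energy≡0) j₀)
          D : ℕ → ℚ
          D x = F x - F (x ℕ.+ 1)
          D-periodic : IsPeriodic D
          D-periodic x = cong₂ _-_ (pF x) (shift-periodic {F} pF 1 x)
          D≡0 : ∀ x → D x ≡ 0ℚ
          D≡0 x = trans (sym (periodic-% {D} D-periodic x)) (subst (λ y → D y ≡ 0ℚ) (toℕ-fromℕ< (m%n<n x N))
            (square≡0 (D (toℕ (x mod N))) (subst (λ t → square (F (toℕ (x mod N)) - F (toℕ (x mod N) ℕ.+ suc t)) ≡ 0ℚ)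
              (toℕ-fromℕ< 1≤k) (increment (x mod N)))))
          constant : ∀ x → F x ≡ F 0
          constant zero    = refl
          constant (suc x) = begin
            F (suc x)                    ≡⟨ cong F (ℕₚ.+-comm x 1) ⟨
            F (x ℕ.+ 1)                  ≡⟨ solve 2 (λ p q → p := q :- (q :- p)) refl (F (x ℕ.+ 1)) (F x) ⟩
            F x - D x                    ≡⟨ cong (λ z → F x - z) (D≡0 x) ⟩
            F x - 0ℚ                     ≡⟨ solve 1 (λ p → p :- :0 := p) refl (F x) ⟩
            F x                          ≡⟨ constant x ⟩
            F 0                          ∎
            where open ≡-Reasoning
          0<N = ℕ.>-nonZero⁻¹ N
          -- A single point of positive potential suffices, which covers both the constant potential
          -- m and the point mass at 0.
          potential₀≡0 : κ 0 * (F 0 * F 0) ≡ 0ℚ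
          potential₀≡0 = subst (λ x → κ x * (F x * F x) ≡ 0ℚ) (toℕ-fromℕ< 0<N)
            (sum≡0⇒≡0 potential 0≤potential (p+q≡0⇒p≡0 (0≤sum potential 0≤potential)
              (0≤sum (λ j → sum (gradient j)) 0≤gradients) energy≡0) (fromℕ< 0<N))
          F0≡0 : F 0 ≡ 0ℚ
          F0≡0 = [ (λ κ₀≡0 → contradiction κ₀≡0 κ₀≢0) , square≡0 (F 0) ]′ (p*q≡0⇒p≡0∨q≡0 (κ 0) (F 0 * F 0) potential₀≡0)

        operator-injective : ∀ f → (∀ i → operator f i ≡ 0ℚ) → ∀ i → f i ≡ 0ℚ
        operator-injective f Tf≡0 i = trans (sym (extend-toℕ f i))
          (Schrödinger-injective {extend f} (extend-periodic f) Tf≡0 (toℕ i))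

        Schrödinger-solvable : IsPeriodic κ → ∀ b → IsPeriodic b →
          ∃ λ f → IsPeriodic f × (∀ x → Schrödinger k κ f x ≡ b x)
        Schrödinger-solvable pκ b pb = extend f , extend-periodic f , λ x →
          trans (sym (periodic-% {Schrödinger k κ (extend f)} (Schrödinger-periodic k {κ} {extend f} pκ (extend-periodic f)) x))
            (trans (subst (λ y → Schrödinger k κ (extend f) y ≡ b y) (toℕ-fromℕ< (m%n<n x N)) (proj₂ solution (x mod N)))
              (periodic-% {b} pb x))
          where
          solution = injective⇒surjective operator-linear operator-injective (b ∘ toℕ)
          f = proj₁ solution

-- Convergence of the hitting-time series from the first-step equation.

module FirstStepAnalysis where

  open Opaque
  open import Data.Fin.Base using (zero; suc)
  import Data.Integer.Base as ℤ
  open import Data.Nat.Base as ℕ using (ℕ; zero; suc; z≤n; s≤s)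
  import Data.Nat.Properties as ℕₚ
  open import Data.Product.Base using (∃; _,_; proj₁; proj₂)
  open import Data.Rational.Base as ℚ using (ℚ; 0ℚ; 1ℚ; _≤_; _<_)
  import Data.Rational.Properties as ℚₚ
  open import Relation.Binary.PropositionalEquality
    using (_≡_; _≢_; refl; sym; trans; cong; cong₂; subst; subst₂; module ≡-Reasoning)
  open import Relation.Nullary.Decidable using (yes; no; Dec)
  open import Relation.Nullary.Negation using (contradiction)

  open ℚ-Integers.Solver using (solve; _:=_; _:+_; _:*_; _:-_; :-_; :0; :1)

  ∑<-suc : ∀ n f → ∑< (suc n) f ≡ ∑< n f + f n
  ∑<-suc n f = sym (+-def (∑< n f) (f n))

  ι-suc : ∀ n → ι (suc n) ≡ 1ℚ + ι n
  ι-suc n = trans (ι-+ 1 n) (cong (_+ ι n) ι-1)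

  ι-mono-≤ : ∀ {m n} → m ℕ.≤ n → ι m ≤ ι n
  ι-mono-≤ {m} {n} m≤n = subst (ι m ≤_) (trans (sym (ι-+ m (n ℕ.∸ m))) (cong ι (ℕₚ.m+[n∸m]≡n m≤n))) (p≤p+q (0≤ι (n ℕ.∸ m)))

  -- A gap that is O(1/n) tends to 0.
  ⟶-from-below : ∀ {s L} B → (∀ n → 0ℚ ≤ L - s (suc n)) → (∀ n → ι (suc n) * (L - s (suc n)) ≤ B) → s ⟶ L
  ⟶-from-below {s} {L} B 0≤gap gap≤B ε 0<ε = suc n₀ , close
    where
    ε≢0 : ε ≢ 0ℚ
    ε≢0 ε≡0 = ℚₚ.<⇒≢ 0<ε (sym ε≡0)
    -- n₀ ≥ B / ε, so from n₀ + 1 on the bound B / n is strictly below ε.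
    n₀ = proj₁ (archimedean (recipℚ ε ε≢0 * B))
    B≤n₀ε : B ≤ ε * ι n₀
    B≤n₀ε = subst (_≤ ε * ι n₀) eq (*-monoˡ-≤ (ℚₚ.<⇒≤ 0<ε) (proj₂ (archimedean (recipℚ ε ε≢0 * B))))
      where
      eq : ε * (recipℚ ε ε≢0 * B) ≡ B
      eq = trans (solve 3 (λ e r b → e :* (r :* b) := (r :* e) :* b) refl ε (recipℚ ε ε≢0) B)
        (trans (cong (_* B) (*-inverseˡ ε ε≢0)) (*-identityˡ B))
    close : ∀ n → suc n₀ ℕ.≤ n → ℚ.∣ s n ℚ.- L ∣ < ε
    close (suc n) (s≤s n₀≤n) = subst (_< ε) (sym (∣q-p∣≡p-q L (s (suc n)) (p≤q⇐0≤q-p (0≤gap n))))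
      (*-cancelˡ-< {ι (suc n)} (0≤ι (suc n)) (ℚₚ.≤-<-trans (ℚₚ.≤-trans (gap≤B n) B≤n₀ε)
        (subst (ε * ι n₀ <_) (*-comm ε (ι (suc n))) (*-monoˡ-< 0<ε (ℚₚ.≤-<-trans (ι-mono-≤ n₀≤n)
          (subst (_< ι (suc n)) (+-identityˡ (ι n)) (subst (0ℚ + ι n <_) (sym (ι-suc n)) (+-monoˡ-< (ι n) 0<1))))))))

  -- P f u is the expectation of f after one step from u, and p t u the
  -- probability of hitting v from u at time t.
  module HittingTime {V : Set} (v : V) (_≟_ : ∀ (u w : V) → Dec (u ≡ w))
    (P : (V → ℚ) → V → ℚ)
    (P-cong : ∀ {f g} → (∀ u → f u ≡ g u) → ∀ u → P f u ≡ P g u)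
    (P-+ : ∀ f g u → P (λ w → f w + g w) u ≡ P f u + P g u)
    (P-* : ∀ c f u → P (λ w → c * f w) u ≡ c * P f u)
    (P-mono : ∀ {f g} → (∀ u → f u ≤ g u) → ∀ u → P f u ≤ P g u)
    (P-1 : ∀ u → P (λ _ → 1ℚ) u ≡ 1ℚ)
    (p : ℕ → V → ℚ)
    (p₀-v : p 0 v ≡ 1ℚ)
    (p₀-u : ∀ u → u ≢ v → p 0 u ≡ 0ℚ)
    (p₊-v : ∀ t → p (suc t) v ≡ 0ℚ)
    (p₊-u : ∀ t u → u ≢ v → p (suc t) u ≡ P (p t) u)
    (h : V → ℚ)
    (h-v : h v ≡ 0ℚ)
    (h-u : ∀ u → u ≢ v → h u ≡ 1ℚ + P h u)
    (minimal : ∃ λ u → ∀ w → h u ≤ h w)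
    (H : ℕ) (h≤H : ∀ u → h u ≤ ι H)
    where

    P-const : ∀ c u → P (λ _ → c) u ≡ c
    P-const c u = trans (P-cong (λ _ → sym (*-identityʳ c)) u)
      (trans (P-* c (λ _ → 1ℚ) u) (trans (cong (c *_) (P-1 u)) (*-identityʳ c)))

    P-zero : ∀ u → P (λ _ → 0ℚ) u ≡ 0ℚ
    P-zero = P-const 0ℚ

    P-neg : ∀ f u → P (λ w → - f w) u ≡ - P f u
    P-neg f u = trans (P-cong (λ w → solve 1 (λ x → :- x := :- :1 :* x) refl (f w)) u)
      (trans (P-* (- 1ℚ) f u) (solve 1 (λ x → :- :1 :* x := :- x) refl (P f u)))

    P-nonneg : ∀ {f} → (∀ u → 0ℚ ≤ f u) → ∀ u → 0ℚ ≤ P f u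
    P-nonneg {f} 0≤f u = subst (_≤ P f u) (P-zero u) (P-mono 0≤f u)

    -- Away from v a minimum would exceed itself by 1.
    0≤h : ∀ u → 0ℚ ≤ h u
    0≤h w with proj₁ minimal ≟ v
    ... | yes u≡v = subst (_≤ h w) (trans (cong h u≡v) h-v) (proj₂ minimal w)
    ... | no  u≢v = contradiction (subst (1ℚ + h u ≤_) (trans (sym (h-u u u≢v)) (sym (+-identityˡ (h u))))
        (+-mono-≤ ℚₚ.≤-refl (subst (_≤ P h u) (P-const (h u) u) (P-mono (proj₂ minimal) u))))
        (λ le → ℚₚ.<-irrefl refl (ℚₚ.<-≤-trans (+-monoˡ-< (h u) 0<1) le))
      where u = proj₁ minimal

    -- With T the hitting time of v, `r n` is P(T ≥ n), and `a n` is what E[(T - n)⁺] must be once h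
    -- is known to be E[T]. Both evolve under the walk killed at v, `a` from the initial value h.
    S E r a : ℕ → V → ℚ
    S n u = ∑< n (λ t → p t u)
    E n u = ∑< n (λ t → (ℤ.+ t ℚ./ 1) ℚ.* p t u)
    r n u = 1ℚ - S n u
    a n u = h u - E n u - ι n * r n u

    S-suc : ∀ n u → S (suc n) u ≡ S n u + p n u
    S-suc n u = ∑<-suc n (λ t → p t u)

    E-suc : ∀ n u → E (suc n) u ≡ E n u + ι n * p n u
    E-suc n u = trans (∑<-suc n (λ t → (ℤ.+ t ℚ./ 1) ℚ.* p t u))
      (cong (E n u +_) (sym (trans (*-def (ι n) (p n u)) (cong (ℚ._* p n u) (ι-def n)))))

    S-v : ∀ n → S (suc n) v ≡ 1ℚ
    S-v zero    = trans (S-suc 0 v) (trans (+-identityˡ (p 0 v)) p₀-v)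
    S-v (suc n) = trans (S-suc (suc n) v) (trans (cong₂ _+_ (S-v n) (p₊-v n)) (+-identityʳ 1ℚ))

    E-v : ∀ n → E (suc n) v ≡ 0ℚ
    E-v zero    = trans (E-suc 0 v) (trans (+-identityˡ (ι 0 * p 0 v)) (trans (cong (_* p 0 v) ι-0) (zeroˡ (p 0 v))))
    E-v (suc n) = trans (E-suc (suc n) v) (trans (cong₂ _+_ (E-v n) (trans (cong (ι (suc n) *_) (p₊-v n)) (zeroʳ (ι (suc n))))) (+-identityʳ 0ℚ))

    S-u : ∀ n u → u ≢ v → S (suc n) u ≡ P (S n) u
    S-u zero u u≢v = trans (S-suc 0 u) (trans (cong (0ℚ +_) (p₀-u u u≢v)) (trans (+-identityʳ 0ℚ) (sym (P-zero u))))
    S-u (suc n) u u≢v = begin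
      S (suc (suc n)) u                     ≡⟨ S-suc (suc n) u ⟩
      S (suc n) u + p (suc n) u             ≡⟨ cong₂ _+_ (S-u n u u≢v) (p₊-u n u u≢v) ⟩
      P (S n) u + P (p n) u                 ≡⟨ P-+ (S n) (p n) u ⟨
      P (λ w → S n w + p n w) u             ≡⟨ P-cong (S-suc n) u ⟨
      P (S (suc n)) u                       ∎
      where open ≡-Reasoning

    -- After the first step the remaining time is one less, so the weight t turns into t + 1; the
    -- extra copy of each probability is the summand `S n`.
    E-u : ∀ n u → u ≢ v → E (suc n) u ≡ P (λ w → E n w + S n w) u
    E-u zero u u≢v = trans (E-suc 0 u) (trans
      (trans (cong (λ z → 0ℚ + z * p 0 u) ι-0) (trans (cong (0ℚ +_) (zeroˡ (p 0 u))) (+-identityʳ 0ℚ)))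
      (sym (trans (P-cong (λ w → +-identityʳ 0ℚ) u) (P-zero u))))
    E-u (suc n) u u≢v = begin
      E (suc (suc n)) u                                           ≡⟨ E-suc (suc n) u ⟩
      E (suc n) u + ι (suc n) * p (suc n) u                       ≡⟨ cong₂ (λ x y → x + ι (suc n) * y) (E-u n u u≢v) (p₊-u n u u≢v) ⟩
      P (λ w → E n w + S n w) u + ι (suc n) * P (p n) u           ≡⟨ cong (P (λ w → E n w + S n w) u +_) (P-* (ι (suc n)) (p n) u) ⟨
      P (λ w → E n w + S n w) u + P (λ w → ι (suc n) * p n w) u   ≡⟨ P-+ _ _ u ⟨
      P (λ w → E n w + S n w + ι (suc n) * p n w) u               ≡⟨ P-cong (λ w → trans
        (trans (cong (λ z → E n w + S n w + z * p n w) (ι-suc n))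
          (solve 4 (λ e s i p → e :+ s :+ (:1 :+ i) :* p := (e :+ i :* p) :+ (s :+ p)) refl (E n w) (S n w) (ι n) (p n w)))
        (sym (cong₂ _+_ (E-suc n w) (S-suc n w)))) u ⟩
      P (λ w → E (suc n) w + S (suc n) w) u                       ∎
      where open ≡-Reasoning

    r-v : ∀ n → r (suc n) v ≡ 0ℚ
    r-v n = trans (cong (λ z → 1ℚ - z) (S-v n)) (solve 1 (λ x → x :- x := :0) refl 1ℚ)

    a-v : ∀ n → a (suc n) v ≡ 0ℚ
    a-v n = trans (cong₂ (λ x y → x - ι (suc n) * y) (cong₂ _-_ h-v (E-v n)) (r-v n))
      (solve 1 (λ i → :0 :- :0 :- i :* :0 := :0) refl (ι (suc n)))

    r-u : ∀ n u → u ≢ v → r (suc n) u ≡ P (r n) u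
    r-u n u u≢v = begin
      1ℚ - S (suc n) u                          ≡⟨ cong (λ z → 1ℚ - z) (S-u n u u≢v) ⟩
      1ℚ - P (S n) u                            ≡⟨ cong₂ _+_ (P-1 u) (P-neg (S n) u) ⟨
      P (λ _ → 1ℚ) u + P (λ w → - S n w) u      ≡⟨ P-+ (λ _ → 1ℚ) (λ w → - S n w) u ⟨
      P (r n) u                                 ∎
      where open ≡-Reasoning

    -- The 1 in the first-step equation of h is used up exactly: the part that has already hit v
    -- goes into the extra `S n` of `E-u`, the rest into the growth of the factor from n to n + 1.
    a-u : ∀ n u → u ≢ v → a (suc n) u ≡ P (a n) u
    a-u n u u≢v = begin
      h u - E (suc n) u - ι (suc n) * r (suc n) u
        ≡⟨ cong₂ (λ x y → x - y) (cong₂ _-_ (h-u u u≢v) (trans (E-u n u u≢v) (P-+ (E n) (S n) u))) (cong₂ _*_ (ι-suc n) (r-u n u u≢v)) ⟩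
      1ℚ + P h u - (P (E n) u + P (S n) u) - (1ℚ + ι n) * P (r n) u
        ≡⟨ cong (λ z → 1ℚ + P h u - (P (E n) u + P (S n) u) - (1ℚ + ι n) * z) r≡ ⟩
      1ℚ + P h u - (P (E n) u + P (S n) u) - (1ℚ + ι n) * (1ℚ - P (S n) u)
        ≡⟨ solve 4 (λ h e s i → :1 :+ h :- (e :+ s) :- (:1 :+ i) :* (:1 :- s) := h :- e :- i :* (:1 :- s))
             refl (P h u) (P (E n) u) (P (S n) u) (ι n) ⟩
      P h u - P (E n) u - ι n * (1ℚ - P (S n) u)
        ≡⟨ cong (λ z → P h u - P (E n) u - ι n * z) r≡ ⟨
      P h u - P (E n) u - ι n * P (r n) u
        ≡⟨ cong₂ _-_ (cong (P h u +_) (P-neg (E n) u)) (P-* (ι n) (r n) u) ⟨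
      P h u + P (λ w → - E n w) u - P (λ w → ι n * r n w) u
        ≡⟨ cong₂ _+_ (P-+ h (λ w → - E n w) u) (P-neg (λ w → ι n * r n w) u) ⟨
      P (λ w → h w - E n w) u + P (λ w → - (ι n * r n w)) u
        ≡⟨ P-+ (λ w → h w - E n w) (λ w → - (ι n * r n w)) u ⟨
      P (a n) u ∎
      where
      open ≡-Reasoning
      r≡ : P (r n) u ≡ 1ℚ - P (S n) u
      r≡ = trans (P-+ (λ _ → 1ℚ) (λ w → - S n w) u) (cong₂ _+_ (P-1 u) (P-neg (S n) u))

    -- The offset 2H + 1 makes every `s n` positive and at least 2h.
    A : ℕ
    A = suc (H ℕ.+ H)

    s : ℕ → ℚ
    s n = ι (n ℕ.+ A)

    s-suc : ∀ n → s (suc n) ≡ 1ℚ + s n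
    s-suc n = ι-suc (n ℕ.+ A)

    -- Normalises `Dominated 0 g` to g ≤ h.
    K : ℚ
    K = s 0 * s 1

    0≤s : ∀ n → 0ℚ ≤ s n
    0≤s n = 0≤ι (n ℕ.+ A)

    0<s : ∀ n → 0ℚ < s n
    0<s n = subst (λ k → 0ℚ < ι k) (sym (ℕₚ.+-suc n (H ℕ.+ H))) (0<ι (n ℕ.+ (H ℕ.+ H)))

    2h≤s : ∀ n u → h u + h u ≤ s n
    2h≤s n u = ℚₚ.≤-trans (+-mono-≤ (h≤H u) (h≤H u)) (subst (_≤ s n) (ι-+ H H)
      (ι-mono-≤ (ℕₚ.≤-trans (ℕₚ.n≤1+n (H ℕ.+ H)) (ℕₚ.m≤n+m A n))))

    0≤K : 0ℚ ≤ K
    0≤K = 0≤p*q (0≤s 0) (0≤s 1)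

    -- h contracts by 1 - 1/h ≤ s n / s (n + 2) under each step, whence decay of order 1/n².
    Dominated : ℕ → (V → ℚ) → Set
    Dominated n g = ∀ u → s n * s (suc n) * g u ≤ K * h u

    dominated-step : ∀ n g u → u ≢ v → Dominated n g → s (suc n) * s (suc (suc n)) * P g u ≤ K * h u
    dominated-step n g u u≢v dom = *-cancelˡ-≤ (0<s n) (begin
      s n * (s (suc n) * s (suc (suc n)) * P g u)
        ≡⟨ solve 4 (λ a b c g → a :* (b :* c :* g) := c :* (a :* b :* g)) refl (s n) (s (suc n)) (s (suc (suc n))) (P g u) ⟩
      s (suc (suc n)) * (s n * s (suc n) * P g u)
        ≤⟨ *-monoˡ-≤ (0≤s (suc (suc n))) (subst₂ _≤_ (P-* (s n * s (suc n)) g u) (P-* K h u) (P-mono dom u)) ⟩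
      s (suc (suc n)) * (K * P h u)
        ≡⟨ cong (_* (K * P h u)) (trans (s-suc (suc n)) (cong (1ℚ +_) (s-suc n))) ⟩
      (1ℚ + (1ℚ + s n)) * (K * P h u)
        -- Since h = 1 + Ph, this is (s + 2)(h - 1) = s h - (s - 2h) - 2, and s ≥ 2h bounds it by s
        -- h.
        ≡⟨ solve 3 (λ s K x → (:1 :+ (:1 :+ s)) :* (K :* x) :=
             K :* (s :* (:1 :+ x) :- (s :- ((:1 :+ x) :+ (:1 :+ x))) :- (:1 :+ :1))) refl (s n) K (P h u) ⟩
      K * (s n * (1ℚ + P h u) - (s n - ((1ℚ + P h u) + (1ℚ + P h u))) - (1ℚ + 1ℚ))
        ≡⟨ cong (λ z → K * (s n * z - (s n - (z + z)) - (1ℚ + 1ℚ))) (h-u u u≢v) ⟨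
      K * (s n * h u - (s n - (h u + h u)) - (1ℚ + 1ℚ))
        ≤⟨ *-monoˡ-≤ 0≤K (ℚₚ.≤-trans (p-q≤p (0≤p+q (ℚₚ.<⇒≤ 0<1) (ℚₚ.<⇒≤ 0<1))) (p-q≤p (0≤q-p (2h≤s n u)))) ⟩
      K * (s n * h u)
        ≡⟨ solve 3 (λ K s h → K :* (s :* h) := s :* (K :* h)) refl K (s n) (h u) ⟩
      s n * (K * h u) ∎)
      where open ℚₚ.≤-Reasoning

    1≤h : ∀ u → u ≢ v → 1ℚ ≤ h u
    1≤h u u≢v = subst (1ℚ ≤_) (sym (h-u u u≢v)) (p≤p+q (P-nonneg 0≤h u))

    private
      vanish : ∀ n (g : V → ℚ) → g v ≡ 0ℚ → s n * s (suc n) * g v ≤ K * h v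
      vanish n g gv≡0 = subst₂ _≤_ (sym (trans (cong (s n * s (suc n) *_) gv≡0) (zeroʳ (s n * s (suc n)))))
        (sym (trans (cong (K *_) h-v) (zeroʳ K))) ℚₚ.≤-refl

      at-v : ∀ (Q : V → Set) → Q v → (∀ u → u ≢ v → Q u) → ∀ u → Q u
      at-v Q Qv Qu u with u ≟ v
      ... | yes u≡v = subst Q (sym u≡v) Qv
      ... | no  u≢v = Qu u u≢v

    r-first : ∀ u → u ≢ v → r 1 u ≡ 1ℚ
    r-first u u≢v = trans (r-u 0 u u≢v) (trans
      (P-cong (λ w → solve 1 (λ x → x :- :0 := x) refl 1ℚ) u) (P-1 u))

    -- The index is shifted because `r 0` equals 1 at v, where h vanishes; domination by h can only
    -- start from `r 1`, which is 0 at v and 1 ≤ h elsewhere.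
    r-dominated : ∀ n → Dominated n (r (suc n))
    r-dominated zero = at-v (λ u → K * r 1 u ≤ K * h u) (vanish 0 (r 1) (r-v 0))
      λ u u≢v → *-monoˡ-≤ 0≤K (subst (_≤ h u) (sym (r-first u u≢v)) (1≤h u u≢v))
    r-dominated (suc n) = at-v _ (vanish (suc n) (r (suc (suc n))) (r-v (suc n)))
      λ u u≢v → subst (λ z → s (suc n) * s (suc (suc n)) * z ≤ K * h u) (sym (r-u (suc n) u u≢v))
        (dominated-step n (r (suc n)) u u≢v (r-dominated n))

    a-zero : ∀ u → a 0 u ≡ h u
    a-zero u = trans (cong (λ z → h u - 0ℚ - z * r 0 u) ι-0)
      (solve 2 (λ h r → h :- :0 :- :0 :* r := h) refl (h u) (r 0 u))

    a-dominated : ∀ n → Dominated n (a n)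
    a-dominated zero u = ℚₚ.≤-reflexive (cong (K *_) (a-zero u))
    a-dominated (suc n) = at-v _ (vanish (suc n) (a (suc n)) (a-v n))
      λ u u≢v → subst (λ z → s (suc n) * s (suc (suc n)) * z ≤ K * h u) (sym (a-u n u u≢v))
        (dominated-step n (a n) u u≢v (a-dominated n))

    0≤r : ∀ n u → 0ℚ ≤ r (suc n) u
    0≤r n = at-v _ (ℚₚ.≤-reflexive (sym (r-v n))) (0≤r′ n)
      where
      0≤r′ : ∀ n u → u ≢ v → 0ℚ ≤ r (suc n) u
      0≤r′ zero    u u≢v = subst (0ℚ ≤_) (sym (r-first u u≢v)) (ℚₚ.<⇒≤ 0<1)
      0≤r′ (suc n) u u≢v = subst (0ℚ ≤_) (sym (r-u (suc n) u u≢v)) (P-nonneg (0≤r n) u)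

    0≤a : ∀ n u → 0ℚ ≤ a n u
    0≤a zero    u = subst (0ℚ ≤_) (sym (a-zero u)) (0≤h u)
    0≤a (suc n) = at-v _ (ℚₚ.≤-reflexive (sym (a-v n)))
      λ u u≢v → subst (0ℚ ≤_) (sym (a-u n u u≢v)) (P-nonneg (0≤a n) u)

    private
      n≤s : ∀ m n → m ℕ.≤ n → ι m ≤ s n
      n≤s m n m≤n = ι-mono-≤ (ℕₚ.≤-trans m≤n (ℕₚ.m≤m+n n A))

      1≤s : ∀ n → 1ℚ ≤ s n
      1≤s n = subst (_≤ s n) ι-1 (ι-mono-≤ (ℕₚ.≤-trans (s≤s z≤n) (ℕₚ.m≤n+m A n)))

      *-mono : ∀ {p q r s} → 0ℚ ≤ p → 0ℚ ≤ s → p ≤ q → r ≤ s → p * r ≤ q * s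
      *-mono {p} {q} {r} {s} 0≤p 0≤s p≤q r≤s = ℚₚ.≤-trans (*-monoˡ-≤ 0≤p r≤s)
        (subst₂ _≤_ (*-comm s p) (*-comm s q) (*-monoˡ-≤ 0≤s p≤q))

      weaken : ∀ {x y} (g : ℚ) → 0ℚ ≤ g → x ≤ y → x * g ≤ y * g
      weaken {x} {y} g 0≤g x≤y = subst₂ _≤_ (*-comm g x) (*-comm g y) (*-monoˡ-≤ 0≤g x≤y)

    survival-gap : ∀ u n → ι (suc n) * r (suc n) u ≤ K * h u
    survival-gap u n = ℚₚ.≤-trans (weaken (r (suc n) u) (0≤r n u)
      (subst (_≤ s n * s (suc n)) (*-identityˡ (ι (suc n)))
        (*-mono (ℚₚ.<⇒≤ 0<1) (0≤s (suc n)) (1≤s n) (n≤s (suc n) (suc n) ℕₚ.≤-refl))))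
      (r-dominated n u)

    -- The gap h - E is a + i r with i = n + 1. After multiplication by i the second term becomes i²
    -- r, and it is here that the quadratic decay of r is spent.
    expectation-gap : ∀ u n → ι (suc n) * (h u - E (suc n) u) ≤ K * h u + K * h u
    expectation-gap u n = subst (_≤ K * h u + K * h u)
      (solve 4 (λ i h e r → i :* (h :- e :- i :* r) :+ i :* i :* r := i :* (h :- e)) refl (ι (suc n)) (h u) (E (suc n) u) (r (suc n) u))
      (+-mono-≤
        (ℚₚ.≤-trans (weaken (a (suc n) u) (0≤a (suc n) u)
          (subst (_≤ s (suc n) * s (suc (suc n))) (*-identityˡ (ι (suc n)))
            (*-mono (ℚₚ.<⇒≤ 0<1) (0≤s (suc (suc n))) (1≤s (suc n)) (n≤s (suc n) (suc (suc n)) (ℕₚ.n≤1+n (suc n))))))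
          (a-dominated (suc n) u))
        (ℚₚ.≤-trans (weaken (r (suc n) u) (0≤r n u)
          (*-mono (0≤ι (suc n)) (0≤s (suc n)) n+1≤s (n≤s (suc n) (suc n) ℕₚ.≤-refl)))
          (r-dominated n u)))
      where
      n+1≤s : ι (suc n) ≤ s n
      n+1≤s = ι-mono-≤ (subst (ℕ._≤ n ℕ.+ A) (ℕₚ.+-comm n 1) (ℕₚ.+-monoʳ-≤ n (s≤s z≤n)))

    0≤h-E : ∀ u n → 0ℚ ≤ h u - E (suc n) u
    0≤h-E u n = subst (0ℚ ≤_)
      (solve 4 (λ i h e r → (h :- e :- i :* r) :+ i :* r := h :- e) refl (ι (suc n)) (h u) (E (suc n) u) (r (suc n) u))
      (0≤p+q (0≤a (suc n) u) (0≤p*q (0≤ι (suc n)) (0≤r n u)))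

    almostSurelyFinite : ∀ u → (λ n → ∑< n (λ t → p t u)) ⟶ 1ℚ
    almostSurelyFinite u = ⟶-from-below {λ n → S n u} {1ℚ} (K * h u) (λ n → 0≤r n u) (survival-gap u)

    expectation : ∀ u → (λ n → ∑< n (λ t → (ℤ.+ t ℚ./ 1) ℚ.* p t u)) ⟶ h u
    expectation u = ⟶-from-below {λ n → E n u} {h u} (K * h u + K * h u) (0≤h-E u) (expectation-gap u)

-- Trajectory sums and the first-step equations of the simple random walk.

module Walks where

  open Opaque
  open FirstStepAnalysis
  open import Data.Bool.Base using (Bool; true; false; if_then_else_; _∧_; not)
  open import Data.Bool.Properties using (∧-zeroʳ)
  open import Data.Fin.Base using (Fin; zero; suc)
  open import Data.List.Base as List using (List; []; _∷_; _++_; foldr; filter; cartesianProductWith; length)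
  import Data.List.Properties as Listₚ
  open import Data.Nat.Base as ℕ using (ℕ; zero; suc)
  import Data.Nat.Properties as ℕₚ
  open import Data.Product.Base using (∃; _,_; proj₁; proj₂)
  open import Data.Rational.Base as ℚ using (ℚ; 0ℚ; 1ℚ; _≤_)
  import Data.Rational.Properties as ℚₚ
  open import Data.Sum.Base using (inj₁; inj₂)
  open import Data.Vec.Base using (Vec; []; _∷_; init; last)
  open import Data.Vec.Relation.Unary.All using (all?)
  open import Function.Base using (_∘_; id)
  open import Function.Bundles using (Inverse)
  open import Relation.Binary.PropositionalEquality
    using (_≡_; _≢_; refl; sym; trans; cong; cong₂; subst; module ≡-Reasoning)
  open import Relation.Nullary.Decidable using (does; Dec; ¬?; dec-true; dec-false)
  open import Relation.Nullary.Negation using (contradiction)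

  open ℚ-Integers.Solver using (solve; _:=_; _:*_)

  private
    variable
      A B E : Set

  sumL : (A → ℚ) → List A → ℚ
  sumL f []       = 0ℚ
  sumL f (x ∷ xs) = f x + sumL f xs

  sumL-foldr : ∀ (f : A → ℚ) xs → foldr ℚ._+_ 0ℚ (List.map f xs) ≡ sumL f xs
  sumL-foldr f []       = refl
  sumL-foldr f (x ∷ xs) = trans (cong (f x ℚ.+_) (sumL-foldr f xs)) (sym (+-def (f x) (sumL f xs)))

  sumL-cong : ∀ {f g : A → ℚ} → (∀ x → f x ≡ g x) → ∀ xs → sumL f xs ≡ sumL g xs
  sumL-cong f≡g []       = refl
  sumL-cong f≡g (x ∷ xs) = cong₂ _+_ (f≡g x) (sumL-cong f≡g xs)

  sumL-* : ∀ c (f : A → ℚ) xs → sumL (λ x → c * f x) xs ≡ c * sumL f xs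
  sumL-* c f []       = sym (zeroʳ c)
  sumL-* c f (x ∷ xs) = trans (cong (c * f x +_) (sumL-* c f xs)) (sym (distribˡ c (f x) (sumL f xs)))

  sumL-zero : ∀ (xs : List A) → sumL (λ _ → 0ℚ) xs ≡ 0ℚ
  sumL-zero []       = refl
  sumL-zero (x ∷ xs) = trans (cong (0ℚ +_) (sumL-zero xs)) (+-identityˡ 0ℚ)

  sumL-++ : ∀ (f : A → ℚ) xs ys → sumL f (xs ++ ys) ≡ sumL f xs + sumL f ys
  sumL-++ f []       ys = sym (+-identityˡ (sumL f ys))
  sumL-++ f (x ∷ xs) ys = trans (cong (f x +_) (sumL-++ f xs ys)) (sym (+-assoc (f x) (sumL f xs) (sumL f ys)))

  sumL-map : ∀ (f : B → ℚ) (g : A → B) xs → sumL f (List.map g xs) ≡ sumL (f ∘ g) xs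
  sumL-map f g []       = refl
  sumL-map f g (x ∷ xs) = cong (f (g x) +_) (sumL-map f g xs)

  sumL-cartesian : ∀ (f : E → ℚ) (g : A → B → E) xs ys →
    sumL f (cartesianProductWith g xs ys) ≡ sumL (λ x → sumL (λ y → f (g x y)) ys) xs
  sumL-cartesian f g []       ys = refl
  sumL-cartesian f g (x ∷ xs) ys = trans (sumL-++ f (List.map (g x) ys) (cartesianProductWith g xs ys))
    (cong₂ _+_ (sumL-map f (g x) ys) (sumL-cartesian f g xs ys))

  sumL-filter : ∀ {P : A → Set} (P? : ∀ x → Dec (P x)) (f : A → ℚ) xs →
    sumL f (filter P? xs) ≡ sumL (λ x → if does (P? x) then f x else 0ℚ) xs
  sumL-filter P? f [] = refl
  sumL-filter P? f (x ∷ xs) with does (P? x)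
  ... | true  = cong (f x +_) (sumL-filter P? f xs)
  ... | false = trans (sumL-filter P? f xs) (sym (+-identityˡ _))

  sumL-tabulate : ∀ {n} (f : A → ℚ) (g : Fin n → A) → sumL f (List.tabulate g) ≡ sum (f ∘ g)
  sumL-tabulate {n = zero}  f g = refl
  sumL-tabulate {n = suc n} f g = cong (f (g zero) +_) (sumL-tabulate f (g ∘ suc))

  length≡sumL : ∀ (xs : List A) → ι (length xs) ≡ sumL (λ _ → 1ℚ) xs
  length≡sumL []       = ι-0
  length≡sumL (x ∷ xs) = trans (ι-suc (length xs)) (cong (1ℚ +_) (length≡sumL xs))

  minimum : ∀ {n} (f : Fin (suc n) → ℚ) → ∃ λ i → ∀ j → f i ≤ f j
  minimum {zero}  f = zero , λ { zero → ℚₚ.≤-refl }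
  minimum {suc n} f with minimum (f ∘ suc)
  ... | i , fi≤ with ℚₚ.≤-total (f zero) (f (suc i))
  ... | inj₁ f0≤fi = zero  , λ { zero → ℚₚ.≤-refl ; (suc j) → ℚₚ.≤-trans f0≤fi (fi≤ j) }
  ... | inj₂ fi≤f0 = suc i , λ { zero → fi≤f0     ; (suc j) → fi≤ j }

  bounded : ∀ {n} (f : Fin n → ℚ) → ∃ λ H → ∀ i → f i ≤ ι H
  bounded {zero}  f = 0 , λ ()
  bounded {suc n} f =
    let H₀ , f0≤H₀ = archimedean (f zero)
        H , f≤H    = bounded (f ∘ suc)
    in H₀ ℕ.+ H , λ { zero    → ℚₚ.≤-trans f0≤H₀ (ι-mono-≤ (ℕₚ.m≤m+n H₀ H))
                    ; (suc i) → ℚₚ.≤-trans (f≤H i) (ι-mono-≤ (ℕₚ.m≤n+m H H₀)) }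

  if-cong : ∀ b {x y : ℚ} → x ≡ y → (if b then x else 0ℚ) ≡ (if b then y else 0ℚ)
  if-cong b = cong (if b then_else 0ℚ)

  if-+ : ∀ b x y → (if b then x + y else 0ℚ) ≡ (if b then x else 0ℚ) + (if b then y else 0ℚ)
  if-+ true  x y = refl
  if-+ false x y = sym (+-identityˡ 0ℚ)

  if-* : ∀ b c x → (if b then c * x else 0ℚ) ≡ c * (if b then x else 0ℚ)
  if-* true  c x = refl
  if-* false c x = sym (zeroʳ c)

  sum-mono : ∀ {n} {f g : Fin n → ℚ} → (∀ i → f i ≤ g i) → sum f ≤ sum g
  sum-mono {zero}  f≤g = ℚₚ.≤-refl
  sum-mono {suc n} f≤g = +-mono-≤ (f≤g zero) (sum-mono (f≤g ∘ suc))

  module _ (Y : Graph) where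
    open Graph Y
    open RandomWalk Y

    private
      at : Fin order → V
      at = Inverse.to enum

      index : V → Fin order
      index = Inverse.from enum

      at-index : ∀ u → at (index u) ≡ u
      at-index = Inverse.strictlyInverseˡ enum

    -- An indicator inside a sum over all vertices, instead of a filtered list: linearity and
    -- exchange of summations then apply directly.
    neighbourhood : (V → ℚ) → V → ℚ
    neighbourhood f u = sum λ i → if does (adj? u (at i)) then f (at i) else 0ℚ

    sumL-vertices : ∀ f → sumL f vertices ≡ sum (f ∘ at)
    sumL-vertices f = trans (cong (sumL f) (Listₚ.map-tabulate id at)) (sumL-tabulate f at)

    degree≡ : ∀ u → ι (degree u) ≡ neighbourhood (λ _ → 1ℚ) u
    degree≡ u = trans (length≡sumL (filter (adj? u) vertices))
      (trans (sumL-filter (adj? u) (λ _ → 1ℚ) vertices) (sumL-vertices (λ z → if does (adj? u z) then 1ℚ else 0ℚ)))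

    neighbourhood-cong : ∀ {f g} → (∀ u → f u ≡ g u) → ∀ u → neighbourhood f u ≡ neighbourhood g u
    neighbourhood-cong f≡g u = ℚΣ.sum-cong-≗ λ i → if-cong (does (adj? u (at i))) (f≡g (at i))

    neighbourhood-+ : ∀ f g u → neighbourhood (λ w → f w + g w) u ≡ neighbourhood f u + neighbourhood g u
    neighbourhood-+ f g u = trans (ℚΣ.sum-cong-≗ λ i → if-+ (does (adj? u (at i))) (f (at i)) (g (at i)))
      (ℚΣ.∑-distrib-+ {order} (λ i → if does (adj? u (at i)) then f (at i) else 0ℚ) (λ i → if does (adj? u (at i)) then g (at i) else 0ℚ))

    neighbourhood-* : ∀ c f u → neighbourhood (λ w → c * f w) u ≡ c * neighbourhood f u
    neighbourhood-* c f u = trans (ℚΣ.sum-cong-≗ λ i → if-* (does (adj? u (at i))) c (f (at i)))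
      (sym (ℚΣ.*-distribˡ-sum {order} c (λ i → if does (adj? u (at i)) then f (at i) else 0ℚ)))

    neighbourhood-mono : ∀ {f g} → (∀ u → f u ≤ g u) → ∀ u → neighbourhood f u ≤ neighbourhood g u
    neighbourhood-mono {f} {g} f≤g u = sum-mono λ i → if-mono (does (adj? u (at i))) (f≤g (at i))
      where
      if-mono : ∀ b {x y : ℚ} → x ≤ y → (if b then x else 0ℚ) ≤ (if b then y else 0ℚ)
      if-mono true  x≤y = x≤y
      if-mono false x≤y = ℚₚ.≤-refl

    module _ (v : V) where

      hit? : ∀ {t} → V → Vec V t → Bool
      hit? u zs = does (firstHit? v u zs)

      lastHit missedBefore : ∀ {t} → V → Vec V t → Bool
      lastHit z zs      = does (last (z ∷ zs) ≟ v)
      missedBefore z zs = does (all? (λ w → ¬? (w ≟ v)) (init (z ∷ zs)))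

      hitProbability≡ : ∀ u t → hitProbability u v t ≡
        sumL (λ zs → if hit? u zs then probability u zs else 0ℚ) (trajectories t)
      hitProbability≡ u t = trans (sumL-foldr (probability u) (filter (firstHit? v u) (trajectories t)))
        (sumL-filter (firstHit? v u) (probability u) (trajectories t))

      hitProbability-start : hitProbability v v 0 ≡ 1ℚ
      hitProbability-start = trans (hitProbability≡ v 0)
        (trans (cong (λ b → (if b ∧ true then 1ℚ else 0ℚ) + 0ℚ) (dec-true (v ≟ v) refl)) (+-identityʳ 1ℚ))

      hitProbability-elsewhere : ∀ u → u ≢ v → hitProbability u v 0 ≡ 0ℚ
      hitProbability-elsewhere u u≢v = trans (hitProbability≡ u 0)
        (trans (cong (λ b → (if b ∧ true then 1ℚ else 0ℚ) + 0ℚ) (dec-false (u ≟ v) u≢v)) (+-identityʳ 0ℚ))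

      -- A first hit at positive time requires Z₀ ≠ v, which fails for a walk started at v.
      hitProbability-return : ∀ t → hitProbability v v (suc t) ≡ 0ℚ
      hitProbability-return t = trans (hitProbability≡ v (suc t))
        (trans (sumL-cartesian (λ zs → if hit? v zs then probability v zs else 0ℚ) _∷_ vertices (trajectories t))
          (trans (sumL-cong (λ z → trans (sumL-cong (λ zs → missed z zs) (trajectories t)) (sumL-zero (trajectories t))) vertices)
            (sumL-zero vertices)))
        where
        missed : ∀ z zs → (if hit? v (z ∷ zs) then probability v (z ∷ zs) else 0ℚ) ≡ 0ℚ
        missed z zs = trans
          -- On a nonempty trajectory `hit?` computes to this conjunction, so only the Boolean
          -- deciding whether the start is v needs rewriting.
          (cong (λ b → if lastHit z zs ∧ (not b ∧ missedBefore z zs) then probability v (z ∷ zs) else 0ℚ) (dec-true (v ≟ v) refl))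
          (cong (if_then probability v (z ∷ zs) else 0ℚ) (∧-zeroʳ (lastHit z zs)))

      -- Off v the condition at time 0 holds, so the event for z ∷ zs started at u is the event for
      -- zs started at z, and the first transition factors out of the sum.
      hitProbability-step : ∀ t u → u ≢ v →
        hitProbability u v (suc t) ≡ recip (degree u) * neighbourhood (λ z → hitProbability z v t) u
      hitProbability-step t u u≢v = begin
        hitProbability u v (suc t)
          ≡⟨ hitProbability≡ u (suc t) ⟩
        _ ≡⟨ sumL-cartesian (λ zs → if hit? u zs then probability u zs else 0ℚ) _∷_ vertices (trajectories t) ⟩
        sumL (λ z → sumL (λ zs → if hit? u (z ∷ zs) then probability u (z ∷ zs) else 0ℚ) (trajectories t)) vertices
          ≡⟨ sumL-cong (λ z → trans (sumL-cong (step z) (trajectories t))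
               (trans (sumL-* (transition u z) (λ zs → if hit? z zs then probability z zs else 0ℚ) (trajectories t))
                 (cong (transition u z *_) (sym (hitProbability≡ z t))))) vertices ⟩
        sumL (λ z → transition u z * hitProbability z v t) vertices
          ≡⟨ sumL-cong (λ z → push (does (adj? u z)) (recip (degree u)) (hitProbability z v t)) vertices ⟩
        sumL (λ z → recip (degree u) * (if does (adj? u z) then hitProbability z v t else 0ℚ)) vertices
          ≡⟨ sumL-* (recip (degree u)) (λ z → if does (adj? u z) then hitProbability z v t else 0ℚ) vertices ⟩
        recip (degree u) * sumL (λ z → if does (adj? u z) then hitProbability z v t else 0ℚ) vertices
          ≡⟨ cong (recip (degree u) *_) (sumL-vertices (λ z → if does (adj? u z) then hitProbability z v t else 0ℚ)) ⟩
        recip (degree u) * neighbourhood (λ z → hitProbability z v t) u ∎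
        where
        open ≡-Reasoning
        push : ∀ b r x → (if b then r else 0ℚ) * x ≡ r * (if b then x else 0ℚ)
        push true  r x = refl
        push false r x = trans (zeroˡ x) (sym (zeroʳ r))
        step : ∀ z zs → (if hit? u (z ∷ zs) then probability u (z ∷ zs) else 0ℚ) ≡
               transition u z * (if hit? z zs then probability z zs else 0ℚ)
        step z zs = trans
          (cong (λ b → if lastHit z zs ∧ (not b ∧ missedBefore z zs) then probability u (z ∷ zs) else 0ℚ) (dec-false (u ≟ v) u≢v))
          (trans (if-cong (hit? z zs) (sym (*-def (transition u z) (probability z zs))))
            (if-* (hit? z zs) (transition u z) (probability z zs)))

      -- The first-step equation is taken multiplied by the degree, which keeps the computations on
      -- concrete graphs free of division.
      harmonic⇒hittingTime : (∀ u → degree u ≢ 0) → (h : V → ℚ) → h v ≡ 0ℚ →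
        (∀ u → u ≢ v → ι (degree u) * h u ≡ ι (degree u) + neighbourhood h u) →
        ∀ u → ExpectedHittingTime Y u v (h u)
      harmonic⇒hittingTime degree≢0 h hv≡0 harmonic u = record
        { almostSurelyFinite = HT.almostSurelyFinite u
        ; expectation        = HT.expectation u
        }
        where
        P : (V → ℚ) → V → ℚ
        P f u = recip (degree u) * neighbourhood f u

        recip-degree : ∀ n → n ≢ 0 → recip n * ι n ≡ 1ℚ
        recip-degree zero    n≢0 = contradiction refl n≢0
        recip-degree (suc n) n≢0 = 1/n*n≡1 n

        0≤recip : ∀ n → 0ℚ ≤ recip n
        0≤recip zero    = ℚₚ.≤-refl
        0≤recip (suc n) = 0≤1/n n

        average : ∀ u → u ≢ v → h u ≡ 1ℚ + P h u
        average u u≢v = begin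
          h u                                          ≡⟨ *-identityˡ (h u) ⟨
          1ℚ * h u                                     ≡⟨ cong (_* h u) r*d ⟨
          r * d * h u                                  ≡⟨ *-assoc r d (h u) ⟩
          r * (d * h u)                                ≡⟨ cong (r *_) (harmonic u u≢v) ⟩
          r * (d + neighbourhood h u)                  ≡⟨ distribˡ r d (neighbourhood h u) ⟩
          r * d + r * neighbourhood h u                ≡⟨ cong (_+ r * neighbourhood h u) r*d ⟩
          1ℚ + P h u                                   ∎
          where
          open ≡-Reasoning
          r = recip (degree u)
          d = ι (degree u)
          r*d = recip-degree (degree u) (degree≢0 u)

        minimal : ∃ λ u → ∀ w → h u ≤ h w
        -- The index of v shows that the order is a successor, as `minimum` requires.
        minimal = transport order refl (index v)
          where
          transport : ∀ n → n ≡ order → Fin n → ∃ λ u → ∀ w → h u ≤ h w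
          transport (suc n) refl _ =
            let i , hi≤ = minimum (h ∘ at) in at i , λ w → subst (λ x → h (at i) ≤ h x) (at-index w) (hi≤ (index w))

        bound = bounded (h ∘ at)

        module HT = HittingTime v _≟_ P
          (λ f≡g u → cong (recip (degree u) *_) (neighbourhood-cong f≡g u))
          (λ f g u → trans (cong (recip (degree u) *_) (neighbourhood-+ f g u)) (distribˡ (recip (degree u)) _ _))
          (λ c f u → trans (cong (recip (degree u) *_) (neighbourhood-* c f u))
            (solve 3 (λ r c n → r :* (c :* n) := c :* (r :* n)) refl (recip (degree u)) c (neighbourhood f u)))
          (λ f≤g u → *-monoˡ-≤ (0≤recip (degree u)) (neighbourhood-mono f≤g u))
          (λ u → trans (cong (recip (degree u) *_) (sym (degree≡ u))) (recip-degree (degree u) (degree≢0 u)))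
          (λ t u → hitProbability u v t)
          hitProbability-start hitProbability-elsewhere hitProbability-return hitProbability-step
          h hv≡0 average minimal (proj₁ bound)
          (λ u → subst (λ x → h x ≤ ι (proj₁ bound)) (at-index u) (proj₂ bound (index u)))

-- Neighbour sums in complete graphs, Cartesian products and circulant graphs.

module Neighbourhoods where

  open PeriodicSequences
  open Opaque
  open RationalSchrödinger
  open FirstStepAnalysis using (ι-suc)
  open Walks
  open import Data.Bool.Base using (true; false; if_then_else_; _∧_; _∨_; not)
  open import Data.Fin.Base using (Fin; zero; suc; toℕ; _↑ˡ_; _↑ʳ_; combine; opposite)
  open import Data.Fin.Permutation using (permutation)
  open import Data.Fin.Properties
    using (toℕ<n; toℕ-fromℕ<; toℕ-injective; toℕ-↑ˡ; toℕ-↑ʳ; opposite-prop; opposite-involutive;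
      remQuot-combine) renaming (_≟_ to _≟ᶠ_)
  open import Data.Integer.Base as ℤ using (ℤ)
  import Data.Integer.Divisibility.Signed as Signed
  import Data.Integer.Properties as ℤₚ
  open import Data.Integer.Tactic.RingSolver using (solve-∀)
  open import Data.Nat.Base as ℕ using (ℕ; zero; suc; NonZero; z≤n; s≤s)
  import Data.Nat.Divisibility as ℕ∣
  open import Data.Nat.DivMod using (_%_; _/_; m%n<n; m<n⇒m%n≡m; _mod_; m≡m%n+[m/n]*n)
  import Data.Nat.Properties as ℕₚ
  open import Data.Product.Base using (∃; _×_; _,_; proj₁; proj₂)
  open import Data.Rational.Base using (ℚ; 0ℚ)
  open import Data.Sum.Base using (inj₁; inj₂)
  open import Function.Base using (_∘_)
  open import Function.Bundles using (Inverse)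
  open import Relation.Binary.PropositionalEquality
    using (_≡_; refl; sym; trans; cong; cong₂; subst; module ≡-Reasoning)
  open import Relation.Nullary.Decidable using (yes; no; does; Dec; dec-true; dec-false)
  open import Relation.Nullary.Negation using (¬_)

  sum-split : ∀ m {n} (f : Fin (m ℕ.+ n) → ℚ) → sum f ≡ sum (λ i → f (i ↑ˡ n)) + sum (λ j → f (m ↑ʳ j))
  sum-split zero    f = sym (+-identityˡ (sum f))
  sum-split (suc m) {n} f = trans (cong (f zero +_) (sum-split m (f ∘ suc)))
    (sym (+-assoc (f zero) (sum (λ i → f (suc (i ↑ˡ n)))) (sum (λ j → f (suc (m ↑ʳ j))))))

  sum-combine : ∀ m {n} (f : Fin (m ℕ.* n) → ℚ) → sum f ≡ sum (λ i → sum (λ j → f (combine {m} {n} i j)))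
  sum-combine zero    f = refl
  sum-combine (suc m) {n} f = trans (sum-split n f)
    (cong (sum (λ j → f (j ↑ˡ (m ℕ.* n))) +_) (sum-combine m (λ i → f (n ↑ʳ i))))

  sum-indicator : ∀ {n} (i : Fin n) (f : Fin n → ℚ) → sum (λ j → if does (i ≟ᶠ j) then f j else 0ℚ) ≡ f i
  sum-indicator {suc n} zero f = trans (cong (f zero +_) (ℚΣ.sum-replicate-zero n)) (+-identityʳ (f zero))
  sum-indicator {suc n} (suc i) f = trans (+-identityˡ (sum (λ j → if does (i ≟ᶠ j) then f (suc j) else 0ℚ)))
    (sum-indicator i (f ∘ suc))

  if-not : ∀ b (x : ℚ) → (if not b then x else 0ℚ) + (if b then x else 0ℚ) ≡ x
  if-not true  x = +-identityˡ x
  if-not false x = +-identityʳ x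

  neighbourhood-complete : ∀ m f a → neighbourhood (complete m) f a + f a ≡ sum f
  neighbourhood-complete m f a = begin
    neighbourhood (complete m) f a + f a
      ≡⟨ cong (neighbourhood (complete m) f a +_) (sum-indicator a f) ⟨
    neighbourhood (complete m) f a + sum (λ b → if does (a ≟ᶠ b) then f b else 0ℚ)
      ≡⟨ ℚΣ.∑-distrib-+ {m} (λ b → if not (does (a ≟ᶠ b)) then f b else 0ℚ) (λ b → if does (a ≟ᶠ b) then f b else 0ℚ) ⟨
    sum (λ b → (if not (does (a ≟ᶠ b)) then f b else 0ℚ) + (if does (a ≟ᶠ b) then f b else 0ℚ))
      ≡⟨ ℚΣ.sum-cong-≗ (λ b → if-not (does (a ≟ᶠ b)) (f b)) ⟩
    sum f ∎
    where open ≡-Reasoning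

  module _ (Y : Graph) where
    open Graph Y

    -- `_≟_` compares indices, so only the index of the enumerated vertex has to be simplified.
    indicator≡ : ∀ a i → does (a ≟ Inverse.to enum i) ≡ does (Inverse.from enum a ≟ᶠ i)
    indicator≡ a i = cong (λ j → does (Inverse.from enum a ≟ᶠ j)) (Inverse.strictlyInverseʳ enum i)

    sum-indicator-vertex : ∀ a (f : V → ℚ) →
      sum (λ i → if does (a ≟ Inverse.to enum i) then f (Inverse.to enum i) else 0ℚ) ≡ f a
    sum-indicator-vertex a f = trans
      (ℚΣ.sum-cong-≗ λ i → cong (λ b → if b then f (Inverse.to enum i) else 0ℚ) (indicator≡ a i))
      (trans (sum-indicator (Inverse.from enum a) (f ∘ Inverse.to enum)) (cong f (Inverse.strictlyInverseˡ enum a)))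

  module _ (X Y : Graph) where
    private
      module X = Graph X
      module Y = Graph Y
      atX = Inverse.to X.enum
      atY = Inverse.to Y.enum

    neighbourhood-□ : ∀ f x a → neighbourhood (X □ Y) f (x , a) ≡
      neighbourhood X (λ y → f (y , a)) x + neighbourhood Y (λ b → f (x , b)) a
    neighbourhood-□ f x a = begin
      neighbourhood (X □ Y) f (x , a)
        ≡⟨ sum-combine X.order (λ l → term (at² l)) ⟩
      sum {X.order} (λ i → sum {Y.order} (λ j → term (at² (combine i j))))
        ≡⟨ ℚΣ.sum-cong-≗ (λ i → ℚΣ.sum-cong-≗ λ j → trans
             (cong (λ q → term (atX (proj₁ q) , atY (proj₂ q))) (remQuot-combine {X.order} i j))
             (split-term (atX i) (atY j))) ⟩
      sum (λ i → sum (λ j → horizontal (atX i) (atY j) + vertical (atX i) (atY j)))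
        ≡⟨ ℚΣ.sum-cong-≗ (λ i → ℚΣ.∑-distrib-+ {Y.order} (horizontal (atX i) ∘ atY) (vertical (atX i) ∘ atY)) ⟩
      sum (λ i → sum (horizontal (atX i) ∘ atY) + sum (vertical (atX i) ∘ atY))
        ≡⟨ ℚΣ.∑-distrib-+ {X.order} (λ i → sum (horizontal (atX i) ∘ atY)) (λ i → sum (vertical (atX i) ∘ atY)) ⟩
      sum (λ i → sum (horizontal (atX i) ∘ atY)) + sum (λ i → sum (vertical (atX i) ∘ atY))
        ≡⟨ cong₂ _+_
             (ℚΣ.sum-cong-≗ λ i → sum-indicator-vertex Y a (λ b → if does (X.adj? x (atX i)) then f (atX i , b) else 0ℚ))
             (trans (ℚΣ.∑-comm {X.order} {Y.order} (λ i j → vertical (atX i) (atY j)))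
               (ℚΣ.sum-cong-≗ λ j → sum-indicator-vertex X x (λ y → if does (Y.adj? a (atY j)) then f (y , atY j) else 0ℚ))) ⟩
      neighbourhood X (λ y → f (y , a)) x + neighbourhood Y (λ b → f (x , b)) a ∎
      where
      open ≡-Reasoning
      module □ = Graph (X □ Y)
      at² = Inverse.to □.enum
      term : X.V × Y.V → ℚ
      term u = if does (□.adj? (x , a) u) then f u else 0ℚ
      horizontal vertical : X.V → Y.V → ℚ
      horizontal y b = if does (a Y.≟ b) then (if does (X.adj? x y) then f (y , b) else 0ℚ) else 0ℚ
      vertical   y b = if does (x X.≟ y) then (if does (Y.adj? a b) then f (y , b) else 0ℚ) else 0ℚ

      -- The two kinds of edges of the product exclude each other because X has no loops, so the
      -- indicator of their disjunction is the sum of the indicators. This is the case x = y;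
      -- `if-∨′` is the case x ≠ y.
      if-∨ : ∀ p q r s z → r ≡ true → q ≡ false →
        (if (p ∧ q) ∨ (r ∧ s) then z else 0ℚ) ≡
        (if p then (if q then z else 0ℚ) else 0ℚ) + (if r then (if s then z else 0ℚ) else 0ℚ)
      if-∨ true  false true s z refl refl = sym (+-identityˡ _)
      if-∨ false false true s z refl refl = sym (+-identityˡ _)

      if-∨′ : ∀ p q r s z → r ≡ false →
        (if (p ∧ q) ∨ (r ∧ s) then z else 0ℚ) ≡
        (if p then (if q then z else 0ℚ) else 0ℚ) + (if r then (if s then z else 0ℚ) else 0ℚ)
      if-∨′ true  true  false s z refl = sym (+-identityʳ z)
      if-∨′ true  false false s z refl = sym (+-identityʳ 0ℚ)
      if-∨′ false q     false s z refl = sym (+-identityʳ 0ℚ)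

      by-cases : ∀ y b → Dec (x ≡ y) → term (y , b) ≡ horizontal y b + vertical y b
      by-cases y b (yes x≡y) = if-∨ (does (a Y.≟ b)) (does (X.adj? x y)) (does (x X.≟ y)) (does (Y.adj? a b)) (f (y , b))
        (dec-true (x X.≟ y) x≡y) (dec-false (X.adj? x y) (X.adj-irrefl x≡y))
      by-cases y b (no x≢y) = if-∨′ (does (a Y.≟ b)) (does (X.adj? x y)) (does (x X.≟ y)) (does (Y.adj? a b)) (f (y , b))
        (dec-false (x X.≟ y) x≢y)

      split-term : ∀ y b → term (y , b) ≡ horizontal y b + vertical y b
      split-term y b = by-cases y b (x X.≟ y)


  module _ (N k : ℕ) .{{_ : NonZero N}} (2k+1≤N : 2 ℕ.* k ℕ.+ 1 ℕ.≤ N) (x : Fin N) where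
    private
      X = C N k 2k+1≤N
      target : ℕ → Fin N
      target y = y mod N

      quotient : ∀ d → ∃ λ q → ℤ.+ toℕ x ℤ.- ℤ.+ toℕ (target (toℕ x ℕ.+ d)) ≡ q ℤ.* ℤ.+ N ℤ.- ℤ.+ d
      quotient d = ℤ.+ ((toℕ x ℕ.+ d) / N) , trans
        (lemma (ℤ.+ toℕ x) (ℤ.+ y) (ℤ.+ d)) (cong (ℤ._- ℤ.+ d) (trans (cong (ℤ._- ℤ.+ y) eq) (lemma′ (ℤ.+ y) (ℤ.+ ((toℕ x ℕ.+ d) / N) ℤ.* ℤ.+ N))))
        where
        y = toℕ (target (toℕ x ℕ.+ d))
        lemma : ∀ x y d → x ℤ.- y ≡ x ℤ.+ d ℤ.- y ℤ.- d
        lemma = solve-∀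
        lemma′ : ∀ y q → y ℤ.+ q ℤ.- y ≡ q
        lemma′ = solve-∀
        eq : ℤ.+ toℕ x ℤ.+ ℤ.+ d ≡ ℤ.+ y ℤ.+ ℤ.+ ((toℕ x ℕ.+ d) / N) ℤ.* ℤ.+ N
        eq = trans (cong ℤ.+_ (trans (m≡m%n+[m/n]*n (toℕ x ℕ.+ d) N)
            (cong (ℕ._+ (toℕ x ℕ.+ d) / N ℕ.* N) (sym (toℕ-fromℕ< (m%n<n (toℕ x ℕ.+ d) N))))))
          (cong (λ z → ℤ.+ y ℤ.+ z) (ℤₚ.pos-* ((toℕ x ℕ.+ d) / N) N))

      -- x - y ≡ t (mod N) with y = x + d amounts to N ∣ d + t.
      N∣⇒mod : ∀ d t → ℤ.+ N Signed.∣ ℤ.+ d ℤ.+ t → (ℤ.+ toℕ x ℤ.- ℤ.+ toℕ (target (toℕ x ℕ.+ d))) ≡ t [mod N ]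
      N∣⇒mod d t N∣d+t with quotient d
      ... | q , eq = Signed.∣⇒∣ᵤ (subst (ℤ.+ N Signed.∣_) (trans (lemma (q ℤ.* ℤ.+ N) (ℤ.+ d) t) (cong (ℤ._- t) (sym eq)))
        (Signed.∣m∣n⇒∣m-n (Signed.divides q refl) N∣d+t))
        where
        lemma : ∀ Q d t → Q ℤ.- (d ℤ.+ t) ≡ (Q ℤ.- d) ℤ.- t
        lemma = solve-∀

      mod⇒N∣ : ∀ d t → (ℤ.+ toℕ x ℤ.- ℤ.+ toℕ (target (toℕ x ℕ.+ d))) ≡ t [mod N ] → ℤ.+ N Signed.∣ ℤ.+ d ℤ.+ t
      mod⇒N∣ d t N∣ with quotient d
      ... | q , eq = subst (ℤ.+ N Signed.∣_) (trans (cong (λ z → q ℤ.* ℤ.+ N ℤ.- (z ℤ.- t)) eq) (lemma (q ℤ.* ℤ.+ N) (ℤ.+ d) t))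
        (Signed.∣m∣n⇒∣m-n (Signed.divides q refl) (Signed.∣ᵤ⇒∣ N∣))
        where
        lemma : ∀ Q d t → Q ℤ.- ((Q ℤ.- d) ℤ.- t) ≡ d ℤ.+ t
        lemma = solve-∀

      adjacent-forward : ∀ (i : Fin k) → CirculantAdj N k x (target (toℕ x ℕ.+ suc (toℕ i)))
      adjacent-forward i = i , inj₂ (N∣⇒mod (suc (toℕ i)) (ℤ.- ℤ.+ suc (toℕ i))
        (subst (ℤ.+ N Signed.∣_) (sym (ℤₚ.+-inverseʳ (ℤ.+ suc (toℕ i)))) (Signed.∣ᵤ⇒∣ {ℤ.+ N} {ℤ.+ 0} (N ℕ∣.∣0))))

      adjacent-backward : ∀ (i : Fin k) d → d ℕ.+ suc (toℕ i) ≡ N → CirculantAdj N k x (target (toℕ x ℕ.+ d))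
      adjacent-backward i d eq = i , inj₁ (N∣⇒mod d (ℤ.+ suc (toℕ i))
        (subst (ℤ.+ N Signed.∣_) (cong ℤ.+_ (sym eq)) Signed.∣-refl))

      -- For 1 ≤ s ≤ k both d + s and d - s lie strictly between 0 and N, so neither is a multiple
      -- of N.
      nonadjacent : ∀ d → k ℕ.< d → d ℕ.+ k ℕ.< N → ¬ CirculantAdj N k x (target (toℕ x ℕ.+ d))
      nonadjacent d k<d d+k<N (i , inj₁ p) = ℕ∣.>⇒∤ {{nz}}
        (ℕₚ.≤-<-trans (ℕₚ.+-monoʳ-≤ d (toℕ<n i)) d+k<N)
        (Signed.∣⇒∣ᵤ (mod⇒N∣ d (ℤ.+ suc (toℕ i)) p))
        where nz = ℕ.>-nonZero (ℕₚ.≤-trans (s≤s z≤n) (ℕₚ.≤-trans k<d (ℕₚ.m≤m+n d _)))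
      nonadjacent d k<d d+k<N (i , inj₂ p) = ℕ∣.>⇒∤ {{nz}}
        (ℕₚ.≤-<-trans (ℕₚ.m∸n≤m d (suc (toℕ i))) (ℕₚ.≤-<-trans (ℕₚ.m≤m+n d k) d+k<N))
        (Signed.∣⇒∣ᵤ (subst (ℤ.+ N Signed.∣_) (trans (ℤₚ.m-n≡m⊖n d (suc (toℕ i))) (ℤₚ.⊖-≥ (ℕₚ.<⇒≤ s<d)))
          (mod⇒N∣ d (ℤ.- ℤ.+ suc (toℕ i)) p)))
        where
        s<d = ℕₚ.≤-<-trans (toℕ<n i) k<d
        nz = ℕ.>-nonZero (ℕₚ.m<n⇒0<n∸m s<d)

    open Periodic ℚ-ring N
    open ℚSchrödinger N k using (extend; extend-periodic; extend-toℕ)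

    private
      -- Seen from x, the offsets 0, ..., N - 1 fall into 0 itself, k neighbours ahead, r
      -- non-neighbours, and k neighbours behind.
      r : ℕ
      r = N ℕ.∸ (2 ℕ.* k ℕ.+ 1)

      N≡ : N ≡ suc (k ℕ.+ (r ℕ.+ k))
      N≡ = trans (sym (ℕₚ.m∸n+n≡m 2k+1≤N)) (ℕ-lemma r k)
        where
        open import Data.Nat.Tactic.RingSolver using () renaming (solve-∀ to solveℕ-∀)
        ℕ-lemma : ∀ r k → r ℕ.+ (2 ℕ.* k ℕ.+ 1) ≡ suc (k ℕ.+ (r ℕ.+ k))
        ℕ-lemma = solveℕ-∀

      sum-toℕ : ∀ {n p} (f : ℕ → ℚ) → n ≡ p → sum {n} (f ∘ toℕ) ≡ sum {p} (f ∘ toℕ)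
      sum-toℕ f refl = refl

      sum-reverse : ∀ {n} (f : Fin n → ℚ) → sum f ≡ sum (f ∘ opposite)
      sum-reverse f = ℚΣ.sum-permute f (permutation opposite opposite opposite-involutive opposite-involutive)

    neighbourhood-circulant : ∀ f → neighbourhood X f x ≡ neighbourSum k (extend f) (toℕ x)
    neighbourhood-circulant f = begin
      neighbourhood X f x
        ≡⟨ ℚΣ.sum-cong-≗ (λ i → sym (extend-toℕ term i)) ⟩
      Σ₀ (extend term)
        -- Rotating the sum to start at x turns vertices into offsets from x, which `N≡` then cuts
        -- into ranges.
        ≡⟨ Σ₀-shift {extend term} (extend-periodic term) (toℕ x) ⟨
      Σ₀ (λ d → extend term (d ℕ.+ toℕ x))
        ≡⟨ sum-toℕ (λ d → extend term (d ℕ.+ toℕ x)) N≡ ⟩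
      G 0 + sum {k ℕ.+ (r ℕ.+ k)} (λ i → G (suc (toℕ i)))
        ≡⟨ cong₂ _+_ (G-false 0 irreflexive) (trans (sum-split k (λ i → G (suc (toℕ i))))
             (cong (sum {k} (λ i → G (suc (toℕ (i ↑ˡ (r ℕ.+ k))))) +_) (sum-split r (λ i → G (suc (toℕ (k ↑ʳ i))))))) ⟩
      0ℚ + (sum {k} (λ i → G (suc (toℕ (i ↑ˡ (r ℕ.+ k))))) +
        (sum {r} (λ j → G (suc (toℕ (k ↑ʳ (j ↑ˡ k))))) + sum {k} (λ i → G (suc (toℕ (k ↑ʳ (r ↑ʳ i)))))))
        ≡⟨ cong (0ℚ +_) (cong₂ _+_ first-k (cong₂ _+_ (sum-zero (λ j → G (suc (toℕ (k ↑ʳ (j ↑ˡ k))))) middle)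
             last-k)) ⟩
      0ℚ + (ahead + (0ℚ + behind))
        ≡⟨ trans (+-identityˡ (ahead + (0ℚ + behind))) (cong (ahead +_) (+-identityˡ behind)) ⟩
      ahead + behind
        ≡⟨ ℚΣ.∑-distrib-+ {k} (λ i → F (toℕ x ℕ.+ suc (toℕ i))) (λ i → F (toℕ x ℕ.+ (N ℕ.∸ suc (toℕ i)))) ⟨
      neighbourSum k F (toℕ x) ∎
      where
      open ≡-Reasoning
      F = extend f
      ahead behind : ℚ
      ahead  = sum (λ (i : Fin k) → F (toℕ x ℕ.+ suc (toℕ i)))
      behind = sum (λ (i : Fin k) → F (toℕ x ℕ.+ (N ℕ.∸ suc (toℕ i))))
      term : Fin N → ℚ
      term y = if does (Graph.adj? X x y) then f y else 0ℚ
      G : ℕ → ℚ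
      G d = extend term (d ℕ.+ toℕ x)

      G-true : ∀ d → CirculantAdj N k x (target (toℕ x ℕ.+ d)) → G d ≡ F (toℕ x ℕ.+ d)
      G-true d adj = trans (cong (extend term) (ℕₚ.+-comm d (toℕ x)))
        (cong (λ b → if b then F (toℕ x ℕ.+ d) else 0ℚ) (dec-true (Graph.adj? X x (target (toℕ x ℕ.+ d))) adj))

      G-false : ∀ d → ¬ CirculantAdj N k x (target (toℕ x ℕ.+ d)) → G d ≡ 0ℚ
      G-false d nadj = trans (cong (extend term) (ℕₚ.+-comm d (toℕ x)))
        (cong (λ b → if b then F (toℕ x ℕ.+ d) else 0ℚ) (dec-false (Graph.adj? X x (target (toℕ x ℕ.+ d))) nadj))

      irreflexive : ¬ CirculantAdj N k x (target (toℕ x ℕ.+ 0))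
      irreflexive = Graph.adj-irrefl X (sym (toℕ-injective (trans (toℕ-fromℕ< (m%n<n (toℕ x ℕ.+ 0) N))
        (trans (cong (_% N) (ℕₚ.+-identityʳ (toℕ x))) (m<n⇒m%n≡m (toℕ<n x))))))

      forward : ∀ (i : Fin k) → G (suc (toℕ (i ↑ˡ (r ℕ.+ k)))) ≡ F (toℕ x ℕ.+ suc (toℕ i))
      forward i = trans (cong (G ∘ suc) (toℕ-↑ˡ i (r ℕ.+ k))) (G-true (suc (toℕ i)) (adjacent-forward i))

      middle : ∀ (j : Fin r) → G (suc (toℕ (k ↑ʳ (j ↑ˡ k)))) ≡ 0ℚ
      middle j = trans (cong (G ∘ suc) (trans (toℕ-↑ʳ k (j ↑ˡ k)) (cong (k ℕ.+_) (toℕ-↑ˡ j k))))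
        (G-false (suc (k ℕ.+ toℕ j)) (nonadjacent (suc (k ℕ.+ toℕ j)) (s≤s (ℕₚ.m≤m+n k (toℕ j)))
          (subst (suc (k ℕ.+ toℕ j) ℕ.+ k ℕ.<_) (sym N≡)
            (s≤s (subst (ℕ._< k ℕ.+ (r ℕ.+ k)) (sym (ℕₚ.+-assoc k (toℕ j) k))
              (ℕₚ.+-monoʳ-< k (ℕₚ.+-monoˡ-< k (toℕ<n j))))))))

      -- The last k offsets N - k, ..., N - 1 list the N - s with s decreasing, whence the reversal
      -- by `opposite`.
      backward′ : ∀ (i : Fin k) → G (suc (toℕ (k ↑ʳ (r ↑ʳ opposite i)))) ≡ F (toℕ x ℕ.+ (N ℕ.∸ suc (toℕ i)))
      backward′ i = trans (cong (G ∘ suc) (trans (toℕ-↑ʳ k (r ↑ʳ opposite i)) (cong (k ℕ.+_) (toℕ-↑ʳ r (opposite i)))))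
        (trans (cong G d≡) (G-true (N ℕ.∸ suc (toℕ i)) (adjacent-backward i (N ℕ.∸ suc (toℕ i)) (ℕₚ.m∸n+n≡m s≤N))))
        where
        s≤N : suc (toℕ i) ℕ.≤ N
        s≤N = ℕₚ.≤-trans (toℕ<n i) (subst (k ℕ.≤_) (sym N≡) (ℕₚ.≤-trans (ℕₚ.m≤m+n k (r ℕ.+ k)) (ℕₚ.n≤1+n (k ℕ.+ (r ℕ.+ k)))))
        d≡ : suc (k ℕ.+ (r ℕ.+ toℕ (opposite i))) ≡ N ℕ.∸ suc (toℕ i)
        d≡ = begin
          suc (k ℕ.+ (r ℕ.+ toℕ (opposite i)))          ≡⟨ cong (λ z → suc (k ℕ.+ (r ℕ.+ z))) (opposite-prop i) ⟩
          suc (k ℕ.+ (r ℕ.+ (k ℕ.∸ suc (toℕ i))))       ≡⟨ cong (λ z → suc (k ℕ.+ z)) (ℕₚ.+-∸-assoc r (toℕ<n i)) ⟨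
          suc (k ℕ.+ ((r ℕ.+ k) ℕ.∸ suc (toℕ i)))       ≡⟨ ℕₚ.+-∸-assoc (suc k) (ℕₚ.≤-trans (toℕ<n i) (ℕₚ.m≤n+m k r)) ⟨
          suc (k ℕ.+ (r ℕ.+ k)) ℕ.∸ suc (toℕ i)         ≡⟨ cong (ℕ._∸ suc (toℕ i)) N≡ ⟨
          N ℕ.∸ suc (toℕ i)                             ∎

      first-k : sum {k} (λ i → G (suc (toℕ (i ↑ˡ (r ℕ.+ k))))) ≡ ahead
      first-k = ℚΣ.sum-cong-≗ {k} forward

      last-k : sum {k} (λ i → G (suc (toℕ (k ↑ʳ (r ↑ʳ i))))) ≡ behind
      last-k = trans {j = reversed} (sum-reverse {k} (λ i → G (suc (toℕ (k ↑ʳ (r ↑ʳ i))))))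
        (ℚΣ.sum-cong-≗ {k} {λ i → G (suc (toℕ (k ↑ʳ (r ↑ʳ opposite i))))} {λ i → F (toℕ x ℕ.+ (N ℕ.∸ suc (toℕ i)))} backward′)
        where reversed = sum {k} (λ i → G (suc (toℕ (k ↑ʳ (r ↑ʳ opposite i)))))

-- Apartness and inverses in a Heyting field.

module Fields where

  open IntegerSolver
  open import Algebra.Apartness.Bundles using (HeytingField; HeytingCommutativeRing)
  import Algebra.Apartness.Properties.HeytingCommutativeRing
  open import Algebra.Bundles using (CommutativeRing)
  open import Data.Product.Base using (proj₁; proj₂; _,_)
  import Relation.Binary.Reasoning.Setoid

  module FieldProperties {c ℓ₁ ℓ₂} (K : HeytingField c ℓ₁ ℓ₂) where
    private module K = HeytingField K
    open HeytingCommutativeRing K.heytingCommutativeRing public using (commutativeRing)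
    open CommutativeRing commutativeRing
    open K using (_#_; #⇒invertible)
    open Algebra.Apartness.Properties.HeytingCommutativeRing K.heytingCommutativeRing using (x-0≈x; invertibleˡ⇒#)
    open IntegerCoefficients commutativeRing using (module Solver)
    open Solver using (solve; _:=_; _:*_)
    open Relation.Binary.Reasoning.Setoid setoid

    -- Unfolds to the same term as `inv`, so the two are interchangeable without proof.
    inverse : ∀ y → y # 0# → Carrier
    inverse y y#0 = proj₁ (#⇒invertible y#0)

    inverseˡ : ∀ y (y#0 : y # 0#) → inverse y y#0 * y ≈ 1#
    inverseˡ y y#0 = trans (*-congˡ (sym (x-0≈x y))) (proj₁ (proj₂ (#⇒invertible y#0)))

    unit⇒#0 : ∀ {y} z → z * y ≈ 1# → y # 0#
    unit⇒#0 {y} z zy≈1 = invertibleˡ⇒# (z , trans (*-congˡ (x-0≈x y)) zy≈1)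

    *-cancelʳ-#0 : ∀ {x y z} → z # 0# → x * z ≈ y * z → x ≈ y
    *-cancelʳ-#0 {x} {y} {z} z#0 xz≈yz = begin
      x                  ≈⟨ *-identityʳ x ⟨
      x * 1#             ≈⟨ *-congˡ (inverseˡ z z#0) ⟨
      x * (i * z)        ≈⟨ solve 3 (λ x i z → x :* (i :* z) := x :* z :* i) refl x i z ⟩
      x * z * i          ≈⟨ *-congʳ xz≈yz ⟩
      y * z * i          ≈⟨ solve 3 (λ x i z → x :* (i :* z) := x :* z :* i) refl y i z ⟨
      y * (i * z)        ≈⟨ *-congˡ (inverseˡ z z#0) ⟩
      y * 1#             ≈⟨ *-identityʳ y ⟩
      y                  ∎
      where i = inverse z z#0

    #0-* : ∀ {x y} → x # 0# → y # 0# → (x * y) # 0#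
    #0-* {x} {y} x#0 y#0 = unit⇒#0 (inverse x x#0 * inverse y y#0) (begin
      i * j * (x * y)      ≈⟨ solve 4 (λ i j x y → i :* j :* (x :* y) := (i :* x) :* (j :* y)) refl i j x y ⟩
      (i * x) * (j * y)    ≈⟨ *-cong (inverseˡ x x#0) (inverseˡ y y#0) ⟩
      1# * 1#              ≈⟨ *-identityˡ 1# ⟩
      1#                   ∎)
      where
      i = inverse x x#0
      j = inverse y y#0

    -- Being apart from 0 amounts to being invertible, and a factor of a unit is a unit.
    #0-factorʳ : ∀ {x y z} → z # 0# → z ≈ x * y → y # 0#
    #0-factorʳ {x} {y} {z} z#0 z≈xy = unit⇒#0 (inverse z z#0 * x)
      (trans (*-assoc _ x y) (trans (*-congˡ (sym z≈xy)) (inverseˡ z z#0)))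

    inverse-unique : ∀ {y z} (y#0 : y # 0#) → z * y ≈ 1# → z ≈ inverse y y#0
    inverse-unique {y} y#0 zy≈1 = *-cancelʳ-#0 y#0 (trans zy≈1 (sym (inverseˡ y y#0)))

-- The embedding of ℚ into a field of characteristic zero.

module RationalEmbedding where

  open IntegerSolver
  open Fields
  open Opaque hiding (*-assoc; *-comm; *-identityʳ)
  open FirstStepAnalysis using (ι-suc)
  open import Algebra.Apartness.Bundles using (HeytingField)
  open import Algebra.Bundles using (CommutativeRing)
  open import Data.Fin.Base using (zero; suc)
  open import Data.Integer.Base as ℤ using (ℤ)
  open import Data.Nat.Base using (zero; suc)
  open import Data.Rational.Base as ℚ using (ℚ; 0ℚ; 1ℚ)
  import Data.Rational.Properties as ℚₚ
  import Data.Rational.Unnormalised.Base as ℚᵘ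
  import Data.Rational.Unnormalised.Properties as ℚᵘₚ
  import Relation.Binary.PropositionalEquality as ≡

  open ≡ using (_≡_)
  import Relation.Binary.Reasoning.Setoid

  module FromRational {c ℓ₁ ℓ₂} (K : HeytingField c ℓ₁ ℓ₂) (char0 : CharacteristicZero K) where
    open FieldProperties K
    open CommutativeRing commutativeRing using (_≈_; setoid; 0#; 1#; refl; sym; trans; reflexive; +-cong; +-congʳ; *-cong; *-congˡ; *-congʳ; *-assoc; *-comm; *-identityʳ)
      renaming (_+_ to _⊹_; _*_ to _⋆_; -_ to ⊟_; _-_ to _⊝_)
    open HeytingField K using (_#_)
    open OverField K char0
    open IntegerCoefficients commutativeRing
    open Solver using (solve; _:=_; _:+_; _:*_; _:-_; :-_)
    open Relation.Binary.Reasoning.Setoid setoid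

    private
      fromℤ≡embed : ∀ i → fromℤ i ≡ embed i
      fromℤ≡embed (ℤ.+ n)    = ≡.refl
      fromℤ≡embed ℤ.-[1+ n ] = ≡.refl

      fromℚ-def : ∀ q → fromℚ q ⋆ embed (ℚ.↧ q) ≈ embed (ℚ.↥ q)
      fromℚ-def q@(ℚ.mkℚ i d-1 _) = begin
        fromℤ i ⋆ j ⋆ d     ≈⟨ *-assoc (fromℤ i) j d ⟩
        fromℤ i ⋆ (j ⋆ d)   ≈⟨ *-congˡ (inverseˡ d (char0 (suc d-1))) ⟩
        fromℤ i ⋆ 1#        ≈⟨ *-identityʳ (fromℤ i) ⟩
        fromℤ i             ≡⟨ fromℤ≡embed i ⟩
        embed i             ∎
        where
        d = ⟦ suc d-1 ⟧
        j = inverse d (char0 (suc d-1))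

      ↧#0 : ∀ q → embed (ℚ.↧ q) # 0#
      ↧#0 q@(ℚ.mkℚ i d-1 _) = char0 (suc d-1)

      cross : ∀ r x → ℚ.toℚᵘ r ℚᵘ.≃ x → ℚ.↥ r ℤ.* ℚᵘ.↧ x ≡ ℚᵘ.↥ x ℤ.* ℚ.↧ r
      cross (ℚ.mkℚ _ _ _) x r≃x = ℚᵘₚ.drop-*≡* r≃x

    -- The sum in ℚ is reduced to lowest terms, so its denominator is not the product of the two
    -- given ones. Multiplying by all three denominators leaves an identity in ℤ, which is the
    -- cross-multiplied equality with the unnormalised sum.
    fromℚ-+ : ∀ p q → fromℚ (p + q) ≈ fromℚ p ⊹ fromℚ q
    fromℚ-+ p@(ℚ.mkℚ _ _ _) q@(ℚ.mkℚ _ _ _) = trans (reflexive (≡.cong fromℚ (+-def p q))) (*-cancelʳ-#0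
      (#0-* (#0-* (↧#0 p) (↧#0 q)) (↧#0 (p ℚ.+ q))) (begin
      s ⋆ (P ⋆ Q ⋆ S)
        ≈⟨ solve 4 (λ s P Q S → s :* (P :* Q :* S) := s :* S :* (P :* Q)) refl s P Q S ⟩
      s ⋆ S ⋆ (P ⋆ Q)
        ≈⟨ *-cong (fromℚ-def (p ℚ.+ q)) (sym (embed-* (ℚ.↧ p) (ℚ.↧ q))) ⟩
      embed (ℚ.↥ (p ℚ.+ q)) ⋆ embed (ℚ.↧ p ℤ.* ℚ.↧ q)
        ≈⟨ embed-* (ℚ.↥ (p ℚ.+ q)) (ℚ.↧ p ℤ.* ℚ.↧ q) ⟨
      embed (ℚ.↥ (p ℚ.+ q) ℤ.* (ℚ.↧ p ℤ.* ℚ.↧ q))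
        ≡⟨ ≡.cong embed (cross (p ℚ.+ q) (ℚ.toℚᵘ p ℚᵘ.+ ℚ.toℚᵘ q) (ℚₚ.toℚᵘ-homo-+ p q)) ⟩
      embed ((ℚ.↥ p ℤ.* ℚ.↧ q ℤ.+ ℚ.↥ q ℤ.* ℚ.↧ p) ℤ.* ℚ.↧ (p ℚ.+ q))
        ≈⟨ trans (embed-* (ℚ.↥ p ℤ.* ℚ.↧ q ℤ.+ ℚ.↥ q ℤ.* ℚ.↧ p) (ℚ.↧ (p ℚ.+ q))) (*-congʳ (trans (embed-+ (ℚ.↥ p ℤ.* ℚ.↧ q) (ℚ.↥ q ℤ.* ℚ.↧ p)) (+-cong (embed-* (ℚ.↥ p) (ℚ.↧ q)) (embed-* (ℚ.↥ q) (ℚ.↧ p))))) ⟩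
      (embed (ℚ.↥ p) ⋆ Q ⊹ embed (ℚ.↥ q) ⋆ P) ⋆ S
        ≈⟨ *-congʳ (+-cong (*-congʳ (fromℚ-def p)) (*-congʳ (fromℚ-def q))) ⟨
      (fromℚ p ⋆ P ⋆ Q ⊹ fromℚ q ⋆ Q ⋆ P) ⋆ S
        ≈⟨ solve 5 (λ p q P Q S → (p :* P :* Q :+ q :* Q :* P) :* S := (p :+ q) :* (P :* Q :* S)) refl (fromℚ p) (fromℚ q) P Q S ⟩
      (fromℚ p ⊹ fromℚ q) ⋆ (P ⋆ Q ⋆ S) ∎))
      where
      s = fromℚ (p ℚ.+ q)
      P = embed (ℚ.↧ p)
      Q = embed (ℚ.↧ q)
      S = embed (ℚ.↧ (p ℚ.+ q))

    fromℚ-* : ∀ p q → fromℚ (p * q) ≈ fromℚ p ⋆ fromℚ q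
    fromℚ-* p@(ℚ.mkℚ _ _ _) q@(ℚ.mkℚ _ _ _) = trans (reflexive (≡.cong fromℚ (*-def p q))) (*-cancelʳ-#0
      (#0-* (#0-* (↧#0 p) (↧#0 q)) (↧#0 (p ℚ.* q))) (begin
      s ⋆ (P ⋆ Q ⋆ S)
        ≈⟨ solve 4 (λ s P Q S → s :* (P :* Q :* S) := s :* S :* (P :* Q)) refl s P Q S ⟩
      s ⋆ S ⋆ (P ⋆ Q)
        ≈⟨ *-cong (fromℚ-def (p ℚ.* q)) (sym (embed-* (ℚ.↧ p) (ℚ.↧ q))) ⟩
      embed (ℚ.↥ (p ℚ.* q)) ⋆ embed (ℚ.↧ p ℤ.* ℚ.↧ q)
        ≈⟨ embed-* (ℚ.↥ (p ℚ.* q)) (ℚ.↧ p ℤ.* ℚ.↧ q) ⟨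
      embed (ℚ.↥ (p ℚ.* q) ℤ.* (ℚ.↧ p ℤ.* ℚ.↧ q))
        ≡⟨ ≡.cong embed (cross (p ℚ.* q) (ℚ.toℚᵘ p ℚᵘ.* ℚ.toℚᵘ q) (ℚₚ.toℚᵘ-homo-* p q)) ⟩
      embed (ℚ.↥ p ℤ.* ℚ.↥ q ℤ.* ℚ.↧ (p ℚ.* q))
        ≈⟨ trans (embed-* (ℚ.↥ p ℤ.* ℚ.↥ q) (ℚ.↧ (p ℚ.* q))) (*-congʳ (embed-* (ℚ.↥ p) (ℚ.↥ q))) ⟩
      embed (ℚ.↥ p) ⋆ embed (ℚ.↥ q) ⋆ S
        ≈⟨ *-congʳ (*-cong (fromℚ-def p) (fromℚ-def q)) ⟨
      (fromℚ p ⋆ P) ⋆ (fromℚ q ⋆ Q) ⋆ S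
        ≈⟨ solve 5 (λ p q P Q S → (p :* P) :* (q :* Q) :* S := (p :* q) :* (P :* Q :* S)) refl (fromℚ p) (fromℚ q) P Q S ⟩
      (fromℚ p ⋆ fromℚ q) ⋆ (P ⋆ Q ⋆ S) ∎))
      where
      s = fromℚ (p ℚ.* q)
      P = embed (ℚ.↧ p)
      Q = embed (ℚ.↧ q)
      S = embed (ℚ.↧ (p ℚ.* q))

    fromℚ-0 : fromℚ 0ℚ ≈ 0#
    fromℚ-0 = CommutativeRing.zeroˡ commutativeRing _

    fromℚ-1 : fromℚ 1ℚ ≈ 1#
    fromℚ-1 = trans (*-comm _ _) (inverseˡ ⟦ 1 ⟧ (char0 1))

    fromℚ-neg : ∀ p → fromℚ (- p) ≈ ⊟ fromℚ p
    fromℚ-neg p = begin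
      fromℚ (- p)                              ≈⟨ solve 2 (λ x y → x := (x :+ y) :- y) refl (fromℚ (- p)) (fromℚ p) ⟩
      (fromℚ (- p) ⊹ fromℚ p) ⊝ fromℚ p        ≈⟨ +-congʳ (fromℚ-+ (- p) p) ⟨
      fromℚ (- p + p) ⊝ fromℚ p                ≡⟨ ≡.cong (λ z → fromℚ z ⊝ fromℚ p) (CommutativeRing.-‿inverseˡ ℚ-ring p) ⟩
      fromℚ 0ℚ ⊝ fromℚ p                       ≈⟨ +-congʳ fromℚ-0 ⟩
      0# ⊝ fromℚ p                             ≈⟨ CommutativeRing.+-identityˡ commutativeRing _ ⟩
      ⊟ fromℚ p                                ∎

    fromℚ-ι : ∀ n → fromℚ (ι n) ≈ ⟦ n ⟧
    fromℚ-ι zero    = trans (reflexive (≡.cong fromℚ ι-0)) fromℚ-0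
    fromℚ-ι (suc n) = trans (reflexive (≡.cong fromℚ (ι-suc n)))
      (trans (fromℚ-+ 1ℚ (ι n)) (+-cong fromℚ-1 (fromℚ-ι n)))

-- The rational Green function and its use over arbitrary commutative rings.

module GreenFunctions where

  open IntegerSolver
  open PeriodicSequences
  open RationalSchrödinger
  open import Algebra.Bundles using (CommutativeRing)
  import Algebra.Properties.Semiring.Exp
  import Algebra.Properties.Semiring.Sum
  open import Data.Bool.Base using (if_then_else_)
  open import Data.Fin.Base using (Fin; zero; suc; toℕ)
  open import Data.Fin.Properties using (toℕ<n)
  open import Data.Nat.Base as ℕ using (ℕ; zero; suc; NonZero; _≤_; _<_; _∸_; s≤s)
  open import Data.Nat.DivMod using (_%_; m<n⇒m%n≡m; [m+n]%n≡m%n)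
  import Data.Nat.Properties as ℕₚ
  open import Data.Product.Base using (∃; _×_; _,_; proj₁; proj₂)
  open import Data.Rational.Base as ℚ using (ℚ; 0ℚ; 1ℚ)
  open import Function.Base using (_∘_)
  open import Level using (_⊔_)
  import Relation.Binary.PropositionalEquality as ≡

  open ≡ using (_≡_; _≢_)
  import Relation.Binary.Reasoning.Setoid
  open import Relation.Nullary.Decidable using (does; yes; no)

  -- The target is only a commutative ring because it is taken to be ℚ itself, `K`, and a quotient
  -- of `K` that will turn out to be trivial.
  record ℚ-Homomorphism {c ℓ} (R : CommutativeRing c ℓ) : Set (c ⊔ ℓ) where
    open CommutativeRing R hiding (zero)
    field
      ψ   : ℚ → Carrier
      ψ-0 : ψ 0ℚ ≈ 0#
      ψ-1 : ψ 1ℚ ≈ 1#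
      ψ-+ : ∀ p q → ψ (p Opaque.+ q) ≈ ψ p + ψ q
      ψ-* : ∀ p q → ψ (p Opaque.* q) ≈ ψ p * ψ q
      ψ-neg : ∀ p → ψ (Opaque.- p) ≈ - ψ p

    open Algebra.Properties.Semiring.Sum semiring

    ψ-sum : ∀ {n} (f : Fin n → ℚ) → ψ (Opaque.sum f) ≈ sum (ψ ∘ f)
    ψ-sum {zero}  f = ψ-0
    ψ-sum {suc n} f = trans (ψ-+ (f zero) (Opaque.sum (f ∘ suc))) (+-congˡ (ψ-sum (f ∘ suc)))

  δ : ∀ N .{{_ : NonZero N}} → ℕ → ℚ
  δ N x = if does (x % N ℕₚ.≟ 0) then 1ℚ else 0ℚ

  δ-periodic : ∀ N .{{_ : NonZero N}} x → δ N (x ℕ.+ N) ≡ δ N x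
  δ-periodic N x = ≡.cong (λ y → if does (y ℕₚ.≟ 0) then 1ℚ else 0ℚ) ([m+n]%n≡m%n x N)

  δ-zero : ∀ N .{{_ : NonZero N}} → δ N 0 ≡ 1ℚ
  δ-zero N@(suc _) = ≡.refl

  δ-suc : ∀ N .{{_ : NonZero N}} x → suc x < N → δ N (suc x) ≡ 0ℚ
  δ-suc N x x<N = ≡.cong (λ y → if does (y ℕₚ.≟ 0) then 1ℚ else 0ℚ) (m<n⇒m%n≡m x<N)

  module Green (N k : ℕ) .{{_ : NonZero N}} (1≤k : 1 ≤ k) (k≤N : k ≤ N) (μ : ℚ) (0≤μ : 0ℚ ℚ.≤ μ) (μ≢0 : μ ≢ 0ℚ) where
    private module ℚP = Periodic Opaque.ℚ-ring N

    solution : ∃ λ f → ℚP.IsPeriodic f × (∀ x → ℚP.Schrödinger k (λ _ → μ) f x ≡ δ N x)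
    solution = ℚSchrödinger.Schrödinger-solvable N k (λ _ → μ) (λ _ → 0≤μ) μ≢0 1≤k k≤N (λ _ → ≡.refl) (δ N) (δ-periodic N)

    G : ℕ → ℚ
    G = proj₁ solution

    G-periodic : ℚP.IsPeriodic G
    G-periodic = proj₁ (proj₂ solution)

    G-equation : ∀ x → ℚP.Schrödinger k (λ _ → μ) G x ≡ δ N x
    G-equation = proj₂ (proj₂ solution)

    module Over {c ℓ} (R : CommutativeRing c ℓ) (hom : ℚ-Homomorphism R) where
      open CommutativeRing R hiding (zero)
      open ℚ-Homomorphism hom
      open Periodic R N
      open Algebra.Properties.Semiring.Sum semiring
      open Algebra.Properties.Semiring.Exp semiring
      open Powers R using (^-inverse)
      open IntegerCoefficients R using (module Solver)
      open Solver using (solve; _:=_; _:+_; _:*_; _:-_; :-_; :0; :1)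
      open Relation.Binary.Reasoning.Setoid setoid

      ψ-Schrödinger : ∀ κ f x → ψ (ℚP.Schrödinger k κ f x) ≈ Schrödinger k (ψ ∘ κ) (ψ ∘ f) x
      ψ-Schrödinger κ f x = trans (ψ-+ (κ x Opaque.* f x) _) (+-cong (ψ-* (κ x) (f x)) (trans (ψ-sum {k} _)
        (sum-cong-≋ {k} λ i → trans (ψ-+ (f x Opaque.+ f x) _) (+-cong (ψ-+ (f x) (f x))
          (trans (ψ-neg _) (-‿cong (ψ-+ (f (x ℕ.+ suc (toℕ i))) (f (x ℕ.+ (N ∸ suc (toℕ i)))))))))))

      Σ₀-δ : ∀ n .{{_ : NonZero n}} (f : ℕ → Carrier) → sum {n} (λ i → f (toℕ i) * ψ (δ n (toℕ i))) ≈ f 0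
      Σ₀-δ n@(suc n-1) f = begin
        f 0 * ψ (δ n 0) + sum {n-1} (λ i → f (suc (toℕ i)) * ψ (δ n (suc (toℕ i))))
          ≈⟨ +-cong (trans (*-congˡ (trans (reflexive (≡.cong ψ (δ-zero n))) ψ-1)) (*-identityʳ (f 0)))
               (sum-cong-≋ {n-1} {λ i → f (suc (toℕ i)) * ψ (δ n (suc (toℕ i)))} {λ _ → 0#} λ i →
                 trans (*-congˡ (trans (reflexive (≡.cong ψ (δ-suc n (toℕ i) (s≤s (toℕ<n i))))) ψ-0)) (zeroʳ _)) ⟩
        f 0 + sum {n-1} (λ _ → 0#)
          ≈⟨ +-congˡ (sum-replicate-zero n-1) ⟩
        f 0 + 0#
          ≈⟨ +-identityʳ (f 0) ⟩
        f 0 ∎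

      κ : ℕ → Carrier
      κ _ = ψ μ

      -- Pair f with δ₀, which is the operator applied to G, and move the operator onto f by
      -- self-adjointness. This carries uniqueness from ℚ to rings without an order.
      representation : ∀ {f} → IsPeriodic f → f 0 ≈ Σ₀ (λ x → ψ (G x) * Schrödinger k κ f x)
      representation {f} pf = begin
        f 0                                                 ≈⟨ Σ₀-δ N f ⟨
        Σ₀ (λ x → f x * ψ (δ N x))                          ≈⟨ sum-cong-≋ {N} (λ i → *-congˡ (trans
          (reflexive (≡.cong ψ (≡.sym (G-equation (toℕ i))))) (ψ-Schrödinger (λ _ → μ) G (toℕ i)))) ⟩
        Σ₀ (λ x → f x * Schrödinger k κ (ψ ∘ G) x)          ≈⟨ Schrödinger-selfAdjoint k k≤N {κ} {ψ ∘ G} {f}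
          (λ x → reflexive (≡.cong ψ (G-periodic x))) pf ⟩
        Σ₀ (λ x → ψ (G x) * Schrödinger k κ f x)            ∎

      kernel-0 : ∀ {f} → IsPeriodic f → (∀ x → Schrödinger k κ f x ≈ 0#) → f 0 ≈ 0#
      kernel-0 {f} pf Sf≈0 = trans (representation pf)
        (trans (sum-cong-≋ {N} {λ i → ψ (G (toℕ i)) * Schrödinger k κ f (toℕ i)} {λ _ → 0#}
          (λ i → trans (*-congˡ (Sf≈0 (toℕ i))) (zeroʳ _))) (sum-replicate-zero N))

      -- The potential is constant, so y can be translated to 0 without changing the equation.
      kernel-trivial : ∀ {f} → IsPeriodic f → (∀ x → Schrödinger k κ f x ≈ 0#) → ∀ y → f y ≈ 0#
      kernel-trivial {f} pf Sf≈0 y = kernel-0 {λ x → f (x ℕ.+ y)} (shift-periodic {f} pf y)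
        (λ x → trans (sym (Schrödinger-shift k κ f y x)) (Sf≈0 (x ℕ.+ y)))

      unique : ∀ {f} → IsPeriodic f → (∀ x → Schrödinger k κ f x ≈ ψ (δ N x)) → ∀ y → f y ≈ ψ (G y)
      unique {f} pf Sf≈δ y = begin
        f y                             ≈⟨ solve 2 (λ f g → f := (f :+ :- :1 :* g) :+ g) refl (f y) (ψ (G y)) ⟩
        (f y + - 1# * ψ (G y)) + ψ (G y) ≈⟨ +-congʳ (kernel-trivial {λ x → f x + - 1# * ψ (G x)}
          (λ x → +-cong (pf x) (*-congˡ (reflexive (≡.cong ψ (G-periodic x))))) difference y) ⟩
        0# + ψ (G y)                    ≈⟨ +-identityˡ _ ⟩
        ψ (G y)                         ∎
        where
        difference : ∀ x → Schrödinger k κ (λ y → f y + - 1# * ψ (G y)) x ≈ 0#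
        difference x = begin
          Schrödinger k κ (λ y → f y + - 1# * ψ (G y)) x
            ≈⟨ Schrödinger-+ k κ f (λ y → - 1# * ψ (G y)) x ⟩
          Schrödinger k κ f x + Schrödinger k κ (λ y → - 1# * ψ (G y)) x
            ≈⟨ +-cong (Sf≈δ x) (Schrödinger-* k κ (- 1#) (ψ ∘ G) x) ⟩
          ψ (δ N x) + - 1# * Schrödinger k κ (ψ ∘ G) x
            ≈⟨ +-congˡ (*-congˡ (trans (sym (ψ-Schrödinger (λ _ → μ) G x)) (reflexive (≡.cong ψ (G-equation x))))) ⟩
          ψ (δ N x) + - 1# * ψ (δ N x)
            ≈⟨ solve 1 (λ d → d :+ :- :1 :* d := :0) refl (ψ (δ N x)) ⟩
          0# ∎

      module _ (ρ σ : Carrier) (ρσ≈1 : ρ * σ ≈ 1#)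
        (root : ψ μ + sum {k} (λ i → (1# + 1#) - (ρ ^ suc (toℕ i) + σ ^ suc (toℕ i))) ≈ 0#) where

        -- x ↦ ρ ^ x would be a kernel element that is 1 at 0.
        root-of-unity⇒trivial : ρ ^ N ≈ 1# → 1# ≈ 0#
        root-of-unity⇒trivial ρ^N≈1 = kernel-0 {ρ ^_} periodic annihilated
          where
          periodic : IsPeriodic (ρ ^_)
          periodic x = trans (^-homo-* ρ x N) (trans (*-congˡ ρ^N≈1) (*-identityʳ _))

          -- As ρ^N = 1, the wrapped backward step is a genuine negative power, and ρ^x becomes an
          -- eigenfunction of the operator with the eigenvalue that `root` makes zero.
          back : ∀ s → s ≤ N → ρ ^ (N ∸ s) ≈ σ ^ s
          back s s≤N = begin
            ρ ^ (N ∸ s)                       ≈⟨ *-identityʳ _ ⟨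
            ρ ^ (N ∸ s) * 1#                  ≈⟨ *-congˡ (^-inverse ρσ≈1 s) ⟨
            ρ ^ (N ∸ s) * (ρ ^ s * σ ^ s)     ≈⟨ *-assoc _ _ _ ⟨
            ρ ^ (N ∸ s) * ρ ^ s * σ ^ s       ≈⟨ *-congʳ (^-homo-* ρ (N ∸ s) s) ⟨
            ρ ^ (N ∸ s ℕ.+ s) * σ ^ s         ≡⟨ ≡.cong (λ n → ρ ^ n * σ ^ s) (ℕₚ.m∸n+n≡m s≤N) ⟩
            ρ ^ N * σ ^ s                     ≈⟨ *-congʳ ρ^N≈1 ⟩
            1# * σ ^ s                        ≈⟨ *-identityˡ _ ⟩
            σ ^ s                             ∎

          annihilated : ∀ x → Schrödinger k κ (ρ ^_) x ≈ 0#
          annihilated x = begin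
            ψ μ * ρ ^ x + sum {k} (λ i → (ρ ^ x + ρ ^ x) - step (ρ ^_) (suc (toℕ i)) x)
              ≈⟨ +-congˡ (sum-cong-≋ {k} λ i → trans
                   (+-congˡ (-‿cong (+-cong (^-homo-* ρ x (suc (toℕ i)))
                     (trans (^-homo-* ρ x (N ∸ suc (toℕ i))) (*-congˡ (back (suc (toℕ i)) (ℕₚ.≤-trans (toℕ<n i) k≤N)))))))
                   (solve 3 (λ r p q → (r :+ r) :- (r :* p :+ r :* q) := ((:1 :+ :1) :- (p :+ q)) :* r)
                     refl (ρ ^ x) (ρ ^ suc (toℕ i)) (σ ^ suc (toℕ i)))) ⟩
            ψ μ * ρ ^ x + sum {k} (λ i → ((1# + 1#) - (ρ ^ suc (toℕ i) + σ ^ suc (toℕ i))) * ρ ^ x)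
              ≈⟨ +-congˡ (*-distribʳ-sum {k} (ρ ^ x) _) ⟨
            ψ μ * ρ ^ x + sum {k} (λ i → (1# + 1#) - (ρ ^ suc (toℕ i) + σ ^ suc (toℕ i))) * ρ ^ x
              ≈⟨ distribʳ (ρ ^ x) _ _ ⟨
            _ ≈⟨ *-congʳ root ⟩
            0# * ρ ^ x
              ≈⟨ zeroˡ _ ⟩
            0# ∎

  module Quotient {c ℓ} (R : CommutativeRing c ℓ) (e : CommutativeRing.Carrier R) where
    open CommutativeRing R hiding (zero)
    open IntegerCoefficients R using (module Solver)
    open Solver using (solve; _:=_; _:+_; _:*_; _:-_; :-_; :0; :1)

    infix 4 _~_
    -- Equality modulo the ideal (e). The multiplier is kept as data: a proof of 1 ~ 0 contains an
    -- inverse of e.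
    _~_ : Carrier → Carrier → Set (c ⊔ ℓ)
    x ~ y = ∃ λ z → x ≈ y + e * z

    ≈⇒~ : ∀ {x y} → x ≈ y → x ~ y
    ≈⇒~ {x} {y} x≈y = 0# , trans x≈y (solve 2 (λ y e → y := y :+ e :* :0) refl y e)

    quotient : CommutativeRing c (c ⊔ ℓ)
    quotient = record
      { _≈_ = _~_ ; _+_ = _+_ ; _*_ = _*_ ; -_ = -_ ; 0# = 0# ; 1# = 1#
      ; isCommutativeRing = record
        { isRing = record
          { +-isAbelianGroup = record
            { isGroup = record
              { isMonoid = record
                { isSemigroup = record
                  { isMagma = record
                    { isEquivalence = record
                      { refl  = ≈⇒~ refl
                      ; sym   = λ { {x} {y} (z , p) → - z , trans
                          (solve 3 (λ y e z → y := (y :+ e :* z) :+ e :* (:- z)) refl y e z) (+-congʳ (sym p)) }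
                      ; trans = λ { {i} {j} {l} (z , p) (w , q) → z + w , trans p (trans (+-congʳ q)
                          (solve 4 (λ l e z w → (l :+ e :* w) :+ e :* z := l :+ e :* (z :+ w)) refl l e z w)) }
                      }
                    ; ∙-cong = λ { {x} {y} {u} {v} (z , p) (w , q) → z + w , trans (+-cong p q)
                        (solve 5 (λ y v e z w → (y :+ e :* z) :+ (v :+ e :* w) := (y :+ v) :+ e :* (z :+ w)) refl y v e z w) }
                    }
                  ; assoc = λ x y z → ≈⇒~ (+-assoc x y z)
                  }
                ; identity = (λ x → ≈⇒~ (+-identityˡ x)) , (λ x → ≈⇒~ (+-identityʳ x))
                }
              ; inverse = (λ x → ≈⇒~ (-‿inverseˡ x)) , (λ x → ≈⇒~ (-‿inverseʳ x))
              ; ⁻¹-cong = λ { {x} {y} (z , p) → - z , trans (-‿cong p)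
                  (solve 3 (λ y e z → :- (y :+ e :* z) := :- y :+ e :* (:- z)) refl y e z) }
              }
            ; comm = λ x y → ≈⇒~ (+-comm x y)
            }
          ; *-cong = λ { {x} {y} {u} {v} (z , p) (w , q) → y * w + z * v + e * z * w , trans (*-cong p q)
              (solve 5 (λ y v e z w → (y :+ e :* z) :* (v :+ e :* w) := y :* v :+ e :* (y :* w :+ z :* v :+ e :* z :* w)) refl y v e z w) }
          ; *-assoc = λ x y z → ≈⇒~ (*-assoc x y z)
          ; *-identity = (λ x → ≈⇒~ (*-identityˡ x)) , (λ x → ≈⇒~ (*-identityʳ x))
          ; distrib = (λ x y z → ≈⇒~ (distribˡ x y z)) , (λ x y z → ≈⇒~ (distribʳ x y z))
          }
        ; *-comm = λ x y → ≈⇒~ (*-comm x y)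
        }
      }

    private
      module R = Algebra.Properties.Semiring.Exp semiring
      module Q = Algebra.Properties.Semiring.Exp (CommutativeRing.semiring quotient)
      module RΣ = Algebra.Properties.Semiring.Sum semiring
      module QΣ = Algebra.Properties.Semiring.Sum (CommutativeRing.semiring quotient)

    -- The quotient multiplies by the same operation, but the powers of the two bundles recurse
    -- separately and are identified only by induction.
    ^-quotient : ∀ x n → x Q.^ n ≡ x R.^ n
    ^-quotient x zero    = ≡.refl
    ^-quotient x (suc n) = ≡.cong (x *_) (^-quotient x n)

    sum-quotient : ∀ {n} (f g : Fin n → Carrier) → (∀ i → f i ≡ g i) → QΣ.sum f ≡ RΣ.sum g
    sum-quotient {zero}  f g f≡g = ≡.refl
    sum-quotient {suc n} f g f≡g = ≡.cong₂ _+_ (f≡g zero) (sum-quotient (f ∘ suc) (g ∘ suc) (f≡g ∘ suc))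

    quotient-homomorphism : ℚ-Homomorphism R → ℚ-Homomorphism quotient
    quotient-homomorphism hom = record
      { ψ     = ψ
      ; ψ-0   = ≈⇒~ ψ-0
      ; ψ-1   = ≈⇒~ ψ-1
      ; ψ-+   = λ p q → ≈⇒~ (ψ-+ p q)
      ; ψ-*   = λ p q → ≈⇒~ (ψ-* p q)
      ; ψ-neg = λ p → ≈⇒~ (ψ-neg p)
      }
      where open ℚ-Homomorphism hom

-- Coefficient lists, divided differences and Euler's identity.

module PolynomialIdentities where

  open IntegerSolver
  open Fields
  open import Algebra.Apartness.Bundles using (HeytingField)
  open import Algebra.Bundles using (CommutativeRing)
  import Algebra.Properties.Ring
  import Algebra.Properties.Semiring.Exp
  import Algebra.Properties.Semiring.Mult
  import Algebra.Properties.Semiring.Sum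
  open import Data.Fin.Base using (Fin; zero; suc)
  open import Data.Fin.Properties using (suc-injective)
  open import Data.List.Base using ([]; _∷_; drop)
  open import Data.Nat.Base using (ℕ; zero; suc; _≤_; _<_; z≤n; s≤s)
  import Data.Nat.Properties as ℕₚ
  open import Data.Product.Base using (proj₁; proj₂)
  open import Function.Base using (_∘_)
  import Relation.Binary.PropositionalEquality as ≡

  open ≡ using (_≡_; _≢_)
  import Relation.Binary.Reasoning.Setoid
  open import Relation.Nullary.Decidable using (yes; no)

  module Polynomials {c ℓ₁ ℓ₂} (K : HeytingField c ℓ₁ ℓ₂) (char0 : CharacteristicZero K) where
    open FieldProperties K
    open CommutativeRing commutativeRing hiding (zero)
    open HeytingField K using (_#_; #⇒invertible)
    open OverField K char0
    open Algebra.Properties.Ring ring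
    open Algebra.Properties.Semiring.Sum semiring
    open Algebra.Properties.Semiring.Exp semiring
    open Algebra.Properties.Semiring.Mult semiring using (×-assoc-*) renaming (_×_ to _·_)
    open IntegerCoefficients commutativeRing using (module Solver)
    open Solver using (solve; _:=_; _:+_; _:*_; _:-_; :-_; :0; :1)
    open Relation.Binary.Reasoning.Setoid setoid

    private F = Carrier

    coefficient : Poly → ℕ → F
    coefficient []      n       = 0#
    coefficient (a ∷ p) zero    = a
    coefficient (a ∷ p) (suc n) = coefficient p n

    infix 4 degree_<_
    -- A bound instead of a degree: equality in `K` need not be decidable, so vanishing leading
    -- coefficients cannot be stripped from a list.
    degree_<_ : Poly → ℕ → Set ℓ₁
    degree p < n = ∀ j → n ≤ j → coefficient p j ≈ 0#

    coefficient-⊕ : ∀ p q j → coefficient (p ⊕ q) j ≈ coefficient p j + coefficient q j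
    coefficient-⊕ []      q       j       = sym (+-identityˡ _)
    coefficient-⊕ (a ∷ p) []      j       = sym (+-identityʳ _)
    coefficient-⊕ (a ∷ p) (b ∷ q) zero    = refl
    coefficient-⊕ (a ∷ p) (b ∷ q) (suc j) = coefficient-⊕ p q j

    coefficient-scale : ∀ a p j → coefficient (scale a p) j ≈ a * coefficient p j
    coefficient-scale a []      j       = sym (zeroʳ a)
    coefficient-scale a (b ∷ p) zero    = refl
    coefficient-scale a (b ∷ p) (suc j) = coefficient-scale a p j

    coefficient-⊖ : ∀ p j → coefficient (⊖ p) j ≈ - coefficient p j
    coefficient-⊖ []      j       = sym -0#≈0#
    coefficient-⊖ (b ∷ p) zero    = refl
    coefficient-⊖ (b ∷ p) (suc j) = coefficient-⊖ p j

    coefficient-dilate : ∀ a p j → coefficient (dilate a p) j ≈ a ^ j * coefficient p j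
    coefficient-dilate a []      j       = sym (zeroʳ _)
    coefficient-dilate a (b ∷ p) zero    = sym (*-identityˡ b)
    coefficient-dilate a (b ∷ p) (suc j) = trans (coefficient-scale a (dilate a p) j)
      (trans (*-congˡ (coefficient-dilate a p j)) (sym (*-assoc a (a ^ j) _)))

    eval-⊕ : ∀ p q x → eval (p ⊕ q) x ≈ eval p x + eval q x
    eval-⊕ []      q       x = sym (+-identityˡ _)
    eval-⊕ (a ∷ p) []      x = sym (+-identityʳ _)
    eval-⊕ (a ∷ p) (b ∷ q) x = trans (+-congˡ (*-congˡ (eval-⊕ p q x)))
      (solve 5 (λ a b x p q → a :+ b :+ x :* (p :+ q) := (a :+ x :* p) :+ (b :+ x :* q)) refl a b x (eval p x) (eval q x))

    eval-scale : ∀ a p x → eval (scale a p) x ≈ a * eval p x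
    eval-scale a []      x = sym (zeroʳ a)
    eval-scale a (b ∷ p) x = trans (+-congˡ (*-congˡ (eval-scale a p x)))
      (solve 4 (λ a b x p → a :* b :+ x :* (a :* p) := a :* (b :+ x :* p)) refl a b x (eval p x))

    eval-⊖ : ∀ p x → eval (⊖ p) x ≈ - eval p x
    eval-⊖ []      x = sym -0#≈0#
    eval-⊖ (b ∷ p) x = trans (+-congˡ (*-congˡ (eval-⊖ p x)))
      (solve 3 (λ b x p → :- b :+ x :* (:- p) := :- (b :+ x :* p)) refl b x (eval p x))

    eval-dilate : ∀ a p x → eval (dilate a p) x ≈ eval p (a * x)
    eval-dilate a []      x = refl
    eval-dilate a (b ∷ p) x = +-congˡ (trans (*-congˡ (trans (eval-scale a (dilate a p) x) (*-congˡ (eval-dilate a p x))))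
      (solve 3 (λ a x p → x :* (a :* p) := a :* x :* p) refl a x (eval p (a * x))))

    eval-zero : ∀ p → (∀ j → coefficient p j ≈ 0#) → ∀ x → eval p x ≈ 0#
    eval-zero []      p≈0 x = refl
    eval-zero (a ∷ p) p≈0 x = trans (+-cong (p≈0 0) (*-congˡ (eval-zero p (p≈0 ∘ suc) x)))
      (solve 1 (λ x → :0 :+ x :* :0 := :0) refl x)

    -- The local function of derivative has no name outside Defs; it is recovered
    -- by unification once its arguments have been abstracted to variables.
    private
      mutual
        derivativeFrom : F → Poly → ℕ → Poly → Poly
        derivativeFrom = _

        derivativeFrom-spec : ∀ a b p → drop 1 (derivative (a ∷ b ∷ p)) ≡ derivativeFrom a (b ∷ p) 2 p
        derivativeFrom-spec a b p with b ∷ p | 2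
        ... | q | n = ≡.refl

      eval-derivativeFrom : ∀ a b n p x →
        eval (derivativeFrom a b n p) x ≈ n · 1# * eval p x + x * eval (derivative p) x
      eval-derivativeFrom a b n []      x = solve 2 (λ n x → :0 := n :* :0 :+ x :* :0) refl (n · 1#) x
      eval-derivativeFrom a b n (d ∷ p) x = begin
        n · d + x * eval (derivativeFrom a b (suc n) p) x
          ≈⟨ +-cong (trans (×-congʳ′ n (sym (*-identityˡ d))) (sym (×-assoc-* n 1# d))) (*-congˡ (eval-derivativeFrom a b (suc n) p x)) ⟩
        n · 1# * d + x * ((1# + n · 1#) * P + x * P′)
          ≈⟨ solve 5 (λ m d x P P′ → m :* d :+ x :* ((:1 :+ m) :* P :+ x :* P′) :=
               m :* (d :+ x :* P) :+ x :* ((:1 :+ :0) :* P :+ x :* P′)) refl (n · 1#) d x P P′ ⟩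
        n · 1# * (d + x * P) + x * ((1# + 0#) * P + x * P′)
          ≈⟨ +-congˡ (*-congˡ (eval-derivativeFrom d p 1 p x)) ⟨
        n · 1# * (d + x * P) + x * eval (derivative (d ∷ p)) x ∎
        where
        P  = eval p x
        P′ = eval (derivative p) x
        ×-congʳ′ : ∀ n {x y} → x ≈ y → n · x ≈ n · y
        ×-congʳ′ zero    x≈y = refl
        ×-congʳ′ (suc n) x≈y = +-cong x≈y (×-congʳ′ n x≈y)

    eval-derivative : ∀ a p x → eval (derivative (a ∷ p)) x ≈ eval p x + x * eval (derivative p) x
    eval-derivative a p x = trans (eval-derivativeFrom a p 1 p x)
      (+-congʳ (trans (*-congʳ (+-identityʳ 1#)) (*-identityˡ _)))

    -- (p(x) - p(r)) / (x - r)
    slope : Poly → F → Poly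
    slope []      r = []
    slope (a ∷ p) r = p ⊕ scale r (slope p r)

    eval-slope-cons : ∀ a p r x → eval (slope (a ∷ p) r) x ≈ eval p x + r * eval (slope p r) x
    eval-slope-cons a p r x = trans (eval-⊕ p (scale r (slope p r)) x) (+-congˡ (eval-scale r (slope p r) x))

    coefficient-slope-cons : ∀ a p r j → coefficient (slope (a ∷ p) r) j ≈ coefficient p j + r * coefficient (slope p r) j
    coefficient-slope-cons a p r j = trans (coefficient-⊕ p (scale r (slope p r)) j) (+-congˡ (coefficient-scale r (slope p r) j))

    eval-slope : ∀ p r x → eval p x - eval p r ≈ (x - r) * eval (slope p r) x
    eval-slope []      r x = solve 2 (λ x r → :0 :- :0 := (x :- r) :* :0) refl x r
    eval-slope (a ∷ p) r x = begin
      (a + x * P) - (a + r * Q)              ≈⟨ solve 5 (λ a x P r Q → (a :+ x :* P) :- (a :+ r :* Q) := (x :- r) :* P :+ r :* (P :- Q)) refl a x P r Q ⟩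
      (x - r) * P + r * (P - Q)              ≈⟨ +-congˡ (*-congˡ (eval-slope p r x)) ⟩
      (x - r) * P + r * ((x - r) * S)        ≈⟨ solve 4 (λ x r P S → (x :- r) :* P :+ r :* ((x :- r) :* S) := (x :- r) :* (P :+ r :* S)) refl x r P S ⟩
      (x - r) * (P + r * S)                  ≈⟨ *-congˡ (eval-slope-cons a p r x) ⟨
      (x - r) * eval (slope (a ∷ p) r) x     ∎
      where
      P = eval p x
      Q = eval p r
      S = eval (slope p r) x

    -- On the diagonal the recursion of `slope` is the product rule for a + x p(x).
    slope-derivative : ∀ p r → eval (slope p r) r ≈ eval (derivative p) r
    slope-derivative []      r = refl
    slope-derivative (a ∷ p) r = trans (eval-slope-cons a p r r)
      (trans (+-congˡ (*-congˡ (slope-derivative p r))) (sym (eval-derivative a p r)))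

    -- Comparison of coefficients in p(x) - p(r) = (x - r) · slope.
    coefficient-slope : ∀ p r j → coefficient p (suc j) ≈ coefficient (slope p r) j - r * coefficient (slope p r) (suc j)
    coefficient-slope []      r j = solve 1 (λ r → :0 := :0 :- r :* :0) refl r
    coefficient-slope (a ∷ p) r j = sym (begin
      coefficient (slope (a ∷ p) r) j - r * coefficient (slope (a ∷ p) r) (suc j)
        ≈⟨ +-cong (coefficient-slope-cons a p r j) (-‿cong (*-congˡ (trans (coefficient-slope-cons a p r (suc j))
             (+-congʳ (coefficient-slope p r j))))) ⟩
      (coefficient p j + r * S) - r * ((S - r * S′) + r * S′)
        ≈⟨ solve 4 (λ c r S S′ → (c :+ r :* S) :- r :* ((S :- r :* S′) :+ r :* S′) := c) refl (coefficient p j) r S S′ ⟩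
      coefficient p j ∎)
      where
      S  = coefficient (slope p r) j
      S′ = coefficient (slope p r) (suc j)

    degree-slope : ∀ p r {n} → degree p < suc n → degree slope p r < n
    degree-slope []      r deg j n≤j = refl
    degree-slope (a ∷ p) r {n} deg j n≤j = begin
      coefficient (slope (a ∷ p) r) j              ≈⟨ coefficient-slope-cons a p r j ⟩
      coefficient p j + r * coefficient (slope p r) j
        ≈⟨ +-cong (deg (suc j) (s≤s n≤j)) (*-congˡ (degree-slope p r (λ i n<i → deg (suc i) (ℕₚ.m≤n⇒m≤1+n n<i)) j n≤j)) ⟩
      0# + r * 0#                                  ≈⟨ solve 1 (λ r → :0 :+ r :* :0 := :0) refl r ⟩
      0#                                           ∎

    Distinct : ∀ {n} → (Fin n → F) → Set ℓ₂
    Distinct r = ∀ i j → i ≢ j → r i # r j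

    #⇒cancel : ∀ {x y z} → x # y → (x - y) * z ≈ 0# → z ≈ 0#
    #⇒cancel {x} {y} {z} x#y eq = begin
      z                      ≈⟨ *-identityˡ z ⟨
      1# * z                 ≈⟨ *-congʳ (proj₁ (proj₂ (#⇒invertible x#y))) ⟨
      i * (x - y) * z        ≈⟨ *-assoc i (x - y) z ⟩
      i * ((x - y) * z)      ≈⟨ *-congˡ eq ⟩
      i * 0#                 ≈⟨ zeroʳ i ⟩
      0#                     ∎
      where i = proj₁ (#⇒invertible x#y)

    -- Dividing by x - r₀ lowers the degree bound, and apartness lets this factor be cancelled at
    -- the remaining roots. Once the quotient vanishes, so do the higher coefficients of p, and
    -- evaluation at r₀ leaves the constant one.
    too-many-roots : ∀ n p (r : Fin n → F) → Distinct r → degree p < n → (∀ i → eval p (r i) ≈ 0#) →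
      ∀ j → coefficient p j ≈ 0#
    too-many-roots zero    p r dis deg root j = deg j z≤n
    too-many-roots (suc n) p r dis deg root = λ { zero → constant ; (suc j) → higher j }
      where
      r₀ = r zero
      q = slope p r₀
      q≈0 : ∀ j → coefficient q j ≈ 0#
      q≈0 = too-many-roots n q (r ∘ suc) (λ i j i≢j → dis (suc i) (suc j) (i≢j ∘ suc-injective)) (degree-slope p r₀ deg)
        λ i → #⇒cancel (dis (suc i) zero (λ ())) (trans (sym (eval-slope p r₀ (r (suc i))))
          (trans (+-cong (root (suc i)) (-‿cong (root zero))) (-‿inverseʳ 0#)))
      higher : ∀ j → coefficient p (suc j) ≈ 0#
      higher j = trans (coefficient-slope p r₀ j) (trans (+-cong (q≈0 j) (-‿cong (*-congˡ (q≈0 (suc j)))))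
        (solve 1 (λ r → :0 :- r :* :0 := :0) refl r₀))
      constant-term : ∀ p → (∀ j → coefficient p (suc j) ≈ 0#) → ∀ x → eval p x ≈ coefficient p 0
      constant-term []      _  x = refl
      constant-term (a ∷ p) hi x = trans (+-congˡ (*-congˡ (eval-zero p hi x)))
        (solve 2 (λ a x → a :+ x :* :0 := a) refl a x)
      constant : coefficient p 0 ≈ 0#
      constant = trans (sym (constant-term p higher r₀)) (root zero)

    polySum : ∀ {n} → (Fin n → Poly) → Poly
    polySum {zero}  p = []
    polySum {suc n} p = p zero ⊕ polySum (p ∘ suc)

    eval-polySum : ∀ {n} (p : Fin n → Poly) x → eval (polySum p) x ≈ sum (λ i → eval (p i) x)
    eval-polySum {zero}  p x = refl
    eval-polySum {suc n} p x = trans (eval-⊕ (p zero) (polySum (p ∘ suc)) x) (+-congˡ (eval-polySum (p ∘ suc) x))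

    coefficient-polySum : ∀ {n} (p : Fin n → Poly) j → coefficient (polySum p) j ≈ sum (λ i → coefficient (p i) j)
    coefficient-polySum {zero}  p j = refl
    coefficient-polySum {suc n} p j = trans (coefficient-⊕ (p zero) (polySum (p ∘ suc)) j) (+-congˡ (coefficient-polySum (p ∘ suc) j))

    sum≈0 : ∀ {n} (f : Fin n → F) → (∀ i → f i ≈ 0#) → sum f ≈ 0#
    sum≈0 {n} f f≈0 = trans (sum-cong-≋ {n} {f} {λ _ → 0#} f≈0) (sum-replicate-zero n)

    sum-single : ∀ {n} (f : Fin n → F) i → (∀ j → j ≢ i → f j ≈ 0#) → sum f ≈ f i
    sum-single f zero    f≈0 = trans (+-congˡ (sum≈0 (f ∘ suc) (λ j → f≈0 (suc j) (λ ())))) (+-identityʳ (f zero))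
    sum-single f (suc i) f≈0 = trans (+-cong (f≈0 zero (λ ()))
      (sum-single (f ∘ suc) i (λ j j≢i → f≈0 (suc j) (j≢i ∘ suc-injective)))) (+-identityˡ (f (suc i)))

    -- Euler's identity: p - Σ_c p(φ_c) / D′(φ_c) · D(x) / (x - φ_c) vanishes at
    -- all φ_c, so its coefficient of degree n vanishes.
    euler-identity : ∀ n D (φ : Fin (suc n) → F) → Distinct φ → degree D < suc (suc n) →
      (∀ i → eval D (φ i) ≈ 0#) → (w : Fin (suc n) → F) → (∀ i → w i * eval (derivative D) (φ i) ≈ 1#) →
      ∀ p → degree p < suc n → sum (λ i → eval p (φ i) * w i) * coefficient D (suc n) ≈ coefficient p n
    euler-identity n D φ dis degD root w inv p degp = sym (begin
      coefficient p n
        ≈⟨ solve 2 (λ p s → p := (p :+ :- s) :+ s) refl (coefficient p n) (coefficient S n) ⟩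
      (coefficient p n + - coefficient S n) + coefficient S n
        ≈⟨ +-congʳ (trans (+-congˡ (sym (coefficient-⊖ S n))) (sym (coefficient-⊕ p (⊖ S) n))) ⟩
      coefficient P n + coefficient S n
        ≈⟨ +-cong (too-many-roots (suc n) P φ dis degP rootP n) (coefficient-polySum term n) ⟩
      0# + sum (λ i → coefficient (term i) n)
        ≈⟨ +-identityˡ _ ⟩
      sum (λ i → coefficient (term i) n)
        ≈⟨ sum-cong-≋ {suc n} (λ i → trans (coefficient-scale (t i) (slope D (φ i)) n) (*-congˡ (top i))) ⟩
      sum (λ i → t i * coefficient D (suc n))
        ≈⟨ *-distribʳ-sum {suc n} (coefficient D (suc n)) t ⟨
      sum t * coefficient D (suc n) ∎)
      where
      t : Fin (suc n) → F
      t i = eval p (φ i) * w i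
      term : Fin (suc n) → Poly
      term i = scale (t i) (slope D (φ i))
      S = polySum term
      P = p ⊕ ⊖ S
      top : ∀ i → coefficient (slope D (φ i)) n ≈ coefficient D (suc n)
      top i = sym (trans (coefficient-slope D (φ i) n) (trans
        (+-congˡ (-‿cong (*-congˡ (degree-slope D (φ i) degD (suc n) ℕₚ.≤-refl))))
        (solve 2 (λ s r → s :- r :* :0 := s) refl (coefficient (slope D (φ i)) n) (φ i))))
      degP : degree P < suc n
      degP j n<j = trans (coefficient-⊕ p (⊖ S) j) (trans (+-cong (degp j n<j) (trans (coefficient-⊖ S j)
        (-‿cong (trans (coefficient-polySum term j) (sum≈0 _ λ i → trans (coefficient-scale (t i) (slope D (φ i)) j)
          (trans (*-congˡ (degree-slope D (φ i) degD j n<j)) (zeroʳ (t i))))))))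
        (-‿inverseʳ 0#))
      rootP : ∀ i → eval P (φ i) ≈ 0#
      rootP i = begin
        eval P (φ i)
          ≈⟨ trans (eval-⊕ p (⊖ S) (φ i)) (+-congˡ (trans (eval-⊖ S (φ i)) (-‿cong (eval-polySum term (φ i))))) ⟩
        eval p (φ i) - sum (λ j → eval (term j) (φ i))
          -- D(x) / (x - φ_j) vanishes at all roots other than φ_j, so at φ_i only the term i
          -- survives; there the quotient takes the value D′(φ_i).
          ≈⟨ +-congˡ (-‿cong (sum-single (λ j → eval (term j) (φ i)) i off-diagonal)) ⟩
        eval p (φ i) - eval (term i) (φ i)
          ≈⟨ +-congˡ (-‿cong (trans (eval-scale (t i) (slope D (φ i)) (φ i)) (*-congˡ (slope-derivative D (φ i))))) ⟩
        eval p (φ i) - eval p (φ i) * w i * eval (derivative D) (φ i)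
          ≈⟨ +-congˡ (-‿cong (trans (*-assoc _ _ _) (trans (*-congˡ (inv i)) (*-identityʳ _)))) ⟩
        eval p (φ i) - eval p (φ i)
          ≈⟨ -‿inverseʳ _ ⟩
        0# ∎
        where
        off-diagonal : ∀ j → j ≢ i → eval (term j) (φ i) ≈ 0#
        off-diagonal j j≢i = trans (eval-scale (t j) (slope D (φ j)) (φ i)) (trans (*-congˡ
          (#⇒cancel (dis i j (j≢i ∘ ≡.sym)) (trans (sym (eval-slope D (φ j) (φ i)))
            (trans (+-cong (root i) (-‿cong (root j))) (-‿inverseʳ 0#))))) (zeroʳ (t j)))

-- Chebyshev polynomials, the characteristic equation and residue sums.

module ChebyshevIdentities where

  open IntegerSolver
  open PeriodicSequences
  open Fields
  open PolynomialIdentities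
  open import Algebra.Apartness.Bundles using (HeytingField)
  open import Algebra.Bundles using (CommutativeRing)
  import Algebra.Properties.Ring
  import Algebra.Properties.Semiring.Exp
  import Algebra.Properties.CommutativeSemiring.Exp
  import Algebra.Properties.Semiring.Sum
  open import Data.Fin.Base using (Fin; zero; suc; toℕ)
  open import Data.Fin.Properties using (toℕ-inject₁; toℕ-fromℕ)
  import Data.Integer.Base as ℤ
  open import Data.List.Base using ([]; _∷_)
  open import Data.Nat.Base as ℕ using (ℕ; zero; suc; _≤_; _<_; z≤n; s≤s)
  import Data.Nat.Properties as ℕₚ
  import Relation.Binary.PropositionalEquality as ≡

  import Relation.Binary.Reasoning.Setoid

  module Chebyshev {c ℓ₁ ℓ₂} (K : HeytingField c ℓ₁ ℓ₂) (char0 : CharacteristicZero K) where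
    open FieldProperties K
    open CommutativeRing commutativeRing hiding (zero)
    open HeytingField K using (_#_)
    open OverField K char0
    open Polynomials K char0
    open Algebra.Properties.Ring ring
    open Algebra.Properties.Semiring.Sum semiring
    open Algebra.Properties.Semiring.Exp semiring
    open Powers commutativeRing using (1^n≈1)
    open Algebra.Properties.CommutativeSemiring.Exp commutativeSemiring using (^-distrib-*)
    open IntegerCoefficients commutativeRing using (module Solver)
    open Solver using (solve; _:=_; _:+_; _:*_; _:-_; :-_; con; :0; :1)
    open Relation.Binary.Reasoning.Setoid setoid

    private F = Carrier

    half*2 : half * ⟦ 2 ⟧ ≈ 1#
    half*2 = inverseˡ ⟦ 2 ⟧ (char0 2)

    half+half : half + half ≈ 1#
    half+half = trans (solve 1 (λ h → h :+ h := h :* con (ℤ.+ 2)) refl half) half*2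

    half#0 : half # 0#
    half#0 = unit⇒#0 ⟦ 2 ⟧ (trans (*-comm ⟦ 2 ⟧ half) half*2)

    ^-∸ : ∀ {ρ σ} → ρ * σ ≈ 1# → ∀ {n t} → t ≤ n → ρ ^ (n ℕ.∸ t) ≈ ρ ^ n * σ ^ t
    ^-∸ {ρ} {σ} ρσ≈1 {n} {zero}      z≤n       = sym (*-identityʳ _)
    ^-∸ {ρ} {σ} ρσ≈1 {suc n} {suc t} (s≤s t≤n) = begin
      ρ ^ (n ℕ.∸ t)                    ≈⟨ ^-∸ ρσ≈1 t≤n ⟩
      ρ ^ n * σ ^ t                    ≈⟨ *-identityˡ _ ⟨
      1# * (ρ ^ n * σ ^ t)             ≈⟨ *-congʳ ρσ≈1 ⟨
      ρ * σ * (ρ ^ n * σ ^ t)          ≈⟨ solve 4 (λ r s p q → r :* s :* (p :* q) := r :* p :* (s :* q)) refl ρ σ (ρ ^ n) (σ ^ t) ⟩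
      ρ * ρ ^ n * (σ * σ ^ t)          ∎

    module _ {φ ρ σ : F} (ρσ≈1 : ρ * σ ≈ 1#) (ρ+σ≈φ : ρ + σ ≈ φ) where

      private
        product-to-sum : ∀ p q → (ρ + σ) * (ρ * p + σ * q) ≈ (ρ * (ρ * p) + σ * (σ * q)) + (p + q)
        product-to-sum p q = begin
          (ρ + σ) * (ρ * p + σ * q)
            ≈⟨ solve 4 (λ r s p q → (r :+ s) :* (r :* p :+ s :* q) := (r :* (r :* p) :+ s :* (s :* q)) :+ (r :* s) :* (p :+ q)) refl ρ σ p q ⟩
          (ρ * (ρ * p) + σ * (σ * q)) + (ρ * σ) * (p + q)
            ≈⟨ +-congˡ (trans (*-congʳ ρσ≈1) (*-identityˡ _)) ⟩
          (ρ * (ρ * p) + σ * (σ * q)) + (p + q) ∎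

      -- T_s(cos θ) = cos sθ with ρ in the place of e^(iθ); the recursion is the product-to-sum
      -- rule.
      eval-chebyshevT : ∀ s → eval (chebyshevT s) (half * φ) ≈ half * (ρ ^ s + σ ^ s)
      eval-chebyshevT zero = begin
        1# + half * φ * 0#       ≈⟨ solve 1 (λ x → :1 :+ x :* :0 := :1) refl (half * φ) ⟩
        1#                       ≈⟨ half*2 ⟨
        half * ⟦ 2 ⟧             ≈⟨ solve 1 (λ h → h :* con (ℤ.+ 2) := h :* (:1 :+ :1)) refl half ⟩
        half * (1# + 1#)         ∎
      eval-chebyshevT (suc zero) = begin
        0# + half * φ * (1# + half * φ * 0#)  ≈⟨ solve 1 (λ x → :0 :+ x :* (:1 :+ x :* :0) := x) refl (half * φ) ⟩
        half * φ                              ≈⟨ *-congˡ ρ+σ≈φ ⟨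
        half * (ρ + σ)                        ≈⟨ *-congˡ (+-cong (*-identityʳ ρ) (*-identityʳ σ)) ⟨
        half * (ρ * 1# + σ * 1#)              ∎
      eval-chebyshevT (suc (suc s)) = begin
        eval (scale ⟦ 2 ⟧ (0# ∷ chebyshevT (suc s)) ⊕ ⊖ chebyshevT s) y
          ≈⟨ trans (eval-⊕ (scale ⟦ 2 ⟧ (0# ∷ chebyshevT (suc s))) (⊖ chebyshevT s) y)
               (+-cong (eval-scale ⟦ 2 ⟧ (0# ∷ chebyshevT (suc s)) y) (eval-⊖ (chebyshevT s) y)) ⟩
        ⟦ 2 ⟧ * (0# + y * eval (chebyshevT (suc s)) y) - eval (chebyshevT s) y
          ≈⟨ +-cong (*-congˡ (+-congˡ (*-cong (*-congˡ (sym ρ+σ≈φ)) (eval-chebyshevT (suc s))))) (-‿cong (eval-chebyshevT s)) ⟩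
        ⟦ 2 ⟧ * (0# + half * (ρ + σ) * (half * (ρ * p + σ * q))) - half * (p + q)
          ≈⟨ solve 6 (λ t h r s p q → t :* (:0 :+ h :* (r :+ s) :* (h :* (r :* p :+ s :* q))) :- h :* (p :+ q) :=
               (h :* t) :* (h :* ((r :+ s) :* (r :* p :+ s :* q))) :- h :* (p :+ q)) refl ⟦ 2 ⟧ half ρ σ p q ⟩
        (half * ⟦ 2 ⟧) * (half * ((ρ + σ) * (ρ * p + σ * q))) - half * (p + q)
          ≈⟨ +-congʳ (trans (*-cong half*2 (*-congˡ (product-to-sum p q))) (*-identityˡ _)) ⟩
        half * ((ρ * (ρ * p) + σ * (σ * q)) + (p + q)) - half * (p + q)
          ≈⟨ solve 3 (λ h a b → h :* (a :+ b) :- h :* b := h :* a) refl half (ρ * (ρ * p) + σ * (σ * q)) (p + q) ⟩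
        half * (ρ * (ρ * p) + σ * (σ * q)) ∎
        where
        y = half * φ
        p = ρ ^ s
        q = σ ^ s

      -- The factor by which the offset-s part of the Laplacian multiplies x ↦ ρ^x.
      symbol : ∀ k → Fin k → F
      symbol k i = (1# + 1#) - (ρ ^ suc (toℕ i) + σ ^ suc (toℕ i))

      private
        eval-chebyshevSum : ∀ k → ⟦ k ⟧ - eval (chebyshevSum k) φ ≈ half * sum (symbol k)
        eval-chebyshevSum zero    = solve 1 (λ h → :0 :- :0 := h :* :0) refl half
        eval-chebyshevSum (suc k) = begin
          (1# + ⟦ k ⟧) - eval (chebyshevSum k ⊕ dilate half (chebyshevT (suc k))) φ
            ≈⟨ +-congˡ (-‿cong (trans (eval-⊕ (chebyshevSum k) (dilate half (chebyshevT (suc k))) φ)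
                 (+-congˡ (trans (eval-dilate half (chebyshevT (suc k)) φ) (eval-chebyshevT (suc k)))))) ⟩
          (1# + ⟦ k ⟧) - (E + half * T)
            ≈⟨ +-congʳ (+-congʳ half+half) ⟨
          ((half + half) + ⟦ k ⟧) - (E + half * T)
            ≈⟨ solve 4 (λ h k E T → ((h :+ h) :+ k) :- (E :+ h :* T) := (k :- E) :+ h :* ((:1 :+ :1) :- T)) refl half ⟦ k ⟧ E T ⟩
          (⟦ k ⟧ - E) + half * ((1# + 1#) - T)
            ≈⟨ +-congʳ (eval-chebyshevSum k) ⟩
          half * sum (symbol k) + half * ((1# + 1#) - T)
            ≈⟨ distribˡ half _ _ ⟨
          half * (sum (symbol k) + ((1# + 1#) - T))
            ≈⟨ *-congˡ (trans (sum-init-last {k} (symbol (suc k))) (+-cong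
                 (sum-cong-≋ {k} λ i → reflexive (≡.cong term (toℕ-inject₁ i))) (reflexive (≡.cong term (toℕ-fromℕ k))))) ⟨
          half * sum (symbol (suc k)) ∎
          where
          E = eval (chebyshevSum k) φ
          T = ρ ^ suc k + σ ^ suc k
          term : ℕ → F
          term j = (1# + 1#) - (ρ ^ suc j + σ ^ suc j)

      eval-D : ∀ k ν → eval (D k ν) φ ≈ half * (ν + sum (symbol k))
      eval-D k ν = begin
        eval ((⟦ k ⟧ + ν * half ∷ []) ⊕ ⊖ chebyshevSum k) φ
          ≈⟨ trans (eval-⊕ (⟦ k ⟧ + ν * half ∷ []) (⊖ chebyshevSum k) φ) (+-congˡ (eval-⊖ (chebyshevSum k) φ)) ⟩
        (⟦ k ⟧ + ν * half + φ * 0#) - eval (chebyshevSum k) φ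
          ≈⟨ solve 5 (λ k ν h φ E → (k :+ ν :* h :+ φ :* :0) :- E := h :* ν :+ (k :- E)) refl ⟦ k ⟧ ν half φ (eval (chebyshevSum k) φ) ⟩
        half * ν + (⟦ k ⟧ - eval (chebyshevSum k) φ)
          ≈⟨ +-congˡ (eval-chebyshevSum k) ⟩
        half * ν + half * sum (symbol k)
          ≈⟨ distribˡ half ν _ ⟨
        half * (ν + sum (symbol k)) ∎

      -- Up to the factor 1/2, D(ρ + ρ⁻¹) is the eigenvalue of L + ν on x ↦ ρ^x, so a root of D
      -- yields a homogeneous solution.
      root⇒characteristic : ∀ k ν → eval (D k ν) φ ≈ 0# → ν + sum (symbol k) ≈ 0#
      root⇒characteristic k ν root = *-cancelʳ-#0 half#0 (trans (*-comm _ half)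
        (trans (sym (eval-D k ν)) (trans root (sym (zeroˡ half)))))

    degree-chebyshevT : ∀ s → degree chebyshevT s < suc s
    degree-chebyshevT zero          (suc j) _ = refl
    degree-chebyshevT (suc zero)    (suc zero) (s≤s ())
    degree-chebyshevT (suc zero)    (suc (suc j)) _ = refl
    degree-chebyshevT (suc (suc s)) (suc j) (s≤s s+2≤j) = begin
      coefficient (chebyshevT (suc (suc s))) (suc j)
        ≈⟨ trans (coefficient-⊕ (scale ⟦ 2 ⟧ (0# ∷ chebyshevT (suc s))) (⊖ chebyshevT s) (suc j))
             (+-cong (coefficient-scale ⟦ 2 ⟧ (chebyshevT (suc s)) j) (coefficient-⊖ (chebyshevT s) (suc j))) ⟩
      ⟦ 2 ⟧ * coefficient (chebyshevT (suc s)) j - coefficient (chebyshevT s) (suc j)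
        ≈⟨ +-cong (*-congˡ (degree-chebyshevT (suc s) j s+2≤j)) (-‿cong (degree-chebyshevT s (suc j)
             (s≤s (ℕₚ.≤-trans (ℕₚ.n≤1+n s) (ℕₚ.≤-trans (ℕₚ.n≤1+n (suc s)) s+2≤j))))) ⟩
      ⟦ 2 ⟧ * 0# - 0#
        ≈⟨ solve 1 (λ t → t :* :0 :- :0 := :0) refl ⟦ 2 ⟧ ⟩
      0# ∎

    leading-chebyshevT : ∀ s → coefficient (chebyshevT (suc s)) (suc s) ≈ ⟦ 2 ⟧ ^ s
    leading-chebyshevT zero    = refl
    leading-chebyshevT (suc s) = begin
      coefficient (chebyshevT (suc (suc s))) (suc (suc s))
        ≈⟨ trans (coefficient-⊕ (scale ⟦ 2 ⟧ (0# ∷ chebyshevT (suc s))) (⊖ chebyshevT s) (suc (suc s)))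
             (+-cong (coefficient-scale ⟦ 2 ⟧ (chebyshevT (suc s)) (suc s)) (coefficient-⊖ (chebyshevT s) (suc (suc s)))) ⟩
      ⟦ 2 ⟧ * coefficient (chebyshevT (suc s)) (suc s) - coefficient (chebyshevT s) (suc (suc s))
        ≈⟨ +-cong (*-congˡ (leading-chebyshevT s)) (-‿cong (degree-chebyshevT s (suc (suc s)) (ℕₚ.n≤1+n (suc s)))) ⟩
      ⟦ 2 ⟧ * ⟦ 2 ⟧ ^ s - 0#
        ≈⟨ solve 1 (λ x → x :- :0 := x) refl (⟦ 2 ⟧ * ⟦ 2 ⟧ ^ s) ⟩
      ⟦ 2 ⟧ * ⟦ 2 ⟧ ^ s ∎

    degree-chebyshevSum : ∀ k → degree chebyshevSum k < suc k
    degree-chebyshevSum zero    j k<j = refl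
    degree-chebyshevSum (suc k) j k<j = begin
      coefficient (chebyshevSum k ⊕ dilate half (chebyshevT (suc k))) j
        ≈⟨ trans (coefficient-⊕ (chebyshevSum k) (dilate half (chebyshevT (suc k))) j)
             (+-congˡ (coefficient-dilate half (chebyshevT (suc k)) j)) ⟩
      coefficient (chebyshevSum k) j + half ^ j * coefficient (chebyshevT (suc k)) j
        ≈⟨ +-cong (degree-chebyshevSum k j (ℕₚ.≤-trans (ℕₚ.n≤1+n (suc k)) k<j)) (*-congˡ (degree-chebyshevT (suc k) j k<j)) ⟩
      0# + half ^ j * 0#
        ≈⟨ solve 1 (λ x → :0 :+ x :* :0 := :0) refl (half ^ j) ⟩
      0# ∎

    coefficient-D : ∀ k ν j → coefficient (D k ν) (suc j) ≈ - coefficient (chebyshevSum k) (suc j)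
    coefficient-D k ν j = trans (coefficient-⊕ (⟦ k ⟧ + ν * half ∷ []) (⊖ chebyshevSum k) (suc j))
      (trans (+-identityˡ _) (coefficient-⊖ (chebyshevSum k) (suc j)))

    degree-D : ∀ k ν → degree D k ν < suc k
    degree-D k ν (suc j) k<j = trans (coefficient-D k ν j) (trans (-‿cong (degree-chebyshevSum k (suc j) k<j)) -0#≈0#)

    -- Only T_k reaches degree k; its leading coefficient 2^(k - 1) is multiplied by 2^(-k) when the
    -- argument is halved.
    leading-D : ∀ n ν → coefficient (D (suc n) ν) (suc n) ≈ - half
    leading-D n ν = trans (coefficient-D (suc n) ν n) (-‿cong (begin
      coefficient (chebyshevSum n ⊕ dilate half (chebyshevT (suc n))) (suc n)
        ≈⟨ trans (coefficient-⊕ (chebyshevSum n) (dilate half (chebyshevT (suc n))) (suc n))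
             (+-cong (degree-chebyshevSum n (suc n) ℕₚ.≤-refl) (coefficient-dilate half (chebyshevT (suc n)) (suc n))) ⟩
      0# + half * half ^ n * coefficient (chebyshevT (suc n)) (suc n)
        ≈⟨ trans (+-identityˡ _) (*-congˡ (leading-chebyshevT n)) ⟩
      half * half ^ n * ⟦ 2 ⟧ ^ n
        ≈⟨ trans (*-assoc _ _ _) (*-congˡ (sym (^-distrib-* half ⟦ 2 ⟧ n))) ⟩
      half * (half * ⟦ 2 ⟧) ^ n
        ≈⟨ *-congˡ (^-congˡ n half*2) ⟩
      half * 1# ^ n
        ≈⟨ *-congˡ (1^n≈1 n) ⟩
      half * 1#
        ≈⟨ *-identityʳ half ⟩
      half ∎))

    -- U_{t-1}(x/2), so that (ρ - ρ⁻¹) W_t(ρ + ρ⁻¹) = ρ^t - ρ^{-t}.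
    W : ℕ → Poly
    W zero          = []
    W (suc zero)    = 1# ∷ []
    W (suc (suc t)) = (0# ∷ W (suc t)) ⊕ ⊖ W t

    eval-W : ∀ {φ ρ σ} → ρ * σ ≈ 1# → ρ + σ ≈ φ → ∀ t → (ρ - σ) * eval (W t) φ ≈ ρ ^ t - σ ^ t
    eval-W {φ} {ρ} {σ} ρσ≈1 ρ+σ≈φ zero = solve 2 (λ r s → (r :- s) :* :0 := :1 :- :1) refl ρ σ
    eval-W {φ} {ρ} {σ} ρσ≈1 ρ+σ≈φ (suc zero) = solve 3 (λ r s φ →
      (r :- s) :* (:1 :+ φ :* :0) := r :* :1 :- s :* :1) refl ρ σ φ
    eval-W {φ} {ρ} {σ} ρσ≈1 ρ+σ≈φ (suc (suc t)) = begin
      (ρ - σ) * eval ((0# ∷ W (suc t)) ⊕ ⊖ W t) φ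
        ≈⟨ *-congˡ (trans (eval-⊕ (0# ∷ W (suc t)) (⊖ W t) φ) (+-congˡ (eval-⊖ (W t) φ))) ⟩
      (ρ - σ) * ((0# + φ * A) - B)
        ≈⟨ solve 5 (λ r s φ a b → (r :- s) :* ((:0 :+ φ :* a) :- b) := φ :* ((r :- s) :* a) :- (r :- s) :* b) refl ρ σ φ A B ⟩
      φ * ((ρ - σ) * A) - (ρ - σ) * B
        ≈⟨ +-cong (*-cong (sym ρ+σ≈φ) (eval-W ρσ≈1 ρ+σ≈φ (suc t))) (-‿cong (eval-W ρσ≈1 ρ+σ≈φ t)) ⟩
      (ρ + σ) * (ρ * p - σ * q) - (p - q)
        ≈⟨ solve 4 (λ r s p q → (r :+ s) :* (r :* p :- s :* q) :- (p :- q) :=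
             r :* (r :* p) :- s :* (s :* q) :+ (r :* s :- :1) :* (p :- q)) refl ρ σ p q ⟩
      ρ * (ρ * p) - σ * (σ * q) + (ρ * σ - 1#) * (p - q)
        ≈⟨ +-congˡ (trans (*-congʳ (trans (+-congʳ ρσ≈1) (-‿inverseʳ 1#))) (zeroˡ _)) ⟩
      ρ * (ρ * p) - σ * (σ * q) + 0#
        ≈⟨ +-identityʳ _ ⟩
      ρ * (ρ * p) - σ * (σ * q) ∎
      where
      A = eval (W (suc t)) φ
      B = eval (W t) φ
      p = ρ ^ t
      q = σ ^ t

    degree-W : ∀ t → degree W t < t
    degree-W zero          j       _           = refl
    degree-W (suc zero)    (suc j) _           = refl
    degree-W (suc (suc t)) (suc j) (s≤s t+1≤j) = trans (coefficient-⊕ (0# ∷ W (suc t)) (⊖ W t) (suc j))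
      (trans (+-cong (degree-W (suc t) j t+1≤j) (trans (coefficient-⊖ (W t) (suc j))
        (-‿cong (degree-W t (suc j) (ℕₚ.≤-trans (ℕₚ.n≤1+n t) (ℕₚ.≤-trans t+1≤j (ℕₚ.n≤1+n j))))))) (-‿inverseʳ 0#))

    leading-W : ∀ t → coefficient (W (suc t)) t ≈ 1#
    leading-W zero    = refl
    leading-W (suc t) = trans (coefficient-⊕ (0# ∷ W (suc t)) (⊖ W t) (suc t))
      (trans (+-cong (leading-W t) (trans (coefficient-⊖ (W t) (suc t)) (trans (-‿cong (degree-W t (suc t) (ℕₚ.n≤1+n t))) -0#≈0#)))
        (+-identityʳ 1#))

    module _ {n ν} (φ : Fin (suc n) → F) (distinct : Distinct φ) (root : ∀ c → eval (D (suc n) ν) (φ c) ≈ 0#)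
      (w : Fin (suc n) → F) (w-inverse : ∀ c → w c * eval (D′ (suc n) ν) (φ c) ≈ 1#) where

      residueSum : ℕ → F
      residueSum t = sum (λ c → eval (W t) (φ c) * w c)

      private
        euler : ∀ t → t ≤ suc n → residueSum t * (- half) ≈ coefficient (W t) n
        euler t t≤k = trans (*-congˡ (sym (leading-D n ν)))
          (euler-identity n (D (suc n) ν) φ distinct (degree-D (suc n) ν) root w w-inverse (W t)
            (λ j k≤j → degree-W t j (ℕₚ.≤-trans t≤k k≤j)))

        cancel : ∀ x → x * (- half) * (- ⟦ 2 ⟧) ≈ x
        cancel x = trans (solve 3 (λ x h t → x :* (:- h) :* (:- t) := x :* (h :* t)) refl x half ⟦ 2 ⟧)
          (trans (*-congˡ half*2) (*-identityʳ x))

      residueSum-< : ∀ t → t ≤ n → residueSum t ≈ 0#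
      residueSum-< t t≤n = trans (sym (cancel (residueSum t))) (trans (*-congʳ
        (trans (euler t (ℕₚ.≤-trans t≤n (ℕₚ.n≤1+n n))) (degree-W t n t≤n))) (zeroˡ _))

      -- The quotient of the leading coefficients: 1 for `W k`, and - 1/2 for D.
      residueSum-= : residueSum (suc n) ≈ - ⟦ 2 ⟧
      residueSum-= = trans (sym (cancel (residueSum (suc n)))) (trans (*-congʳ
        (trans (euler (suc n) ℕₚ.≤-refl) (leading-W n))) (*-identityˡ _))

-- Apartness from zero of all denominators.

module Denominators where

  open IntegerSolver
  open PeriodicSequences
  open Fields
  open RationalEmbedding
  open GreenFunctions
  open PolynomialIdentities
  open ChebyshevIdentities
  open import Algebra.Apartness.Bundles using (HeytingField)
  open import Algebra.Bundles using (CommutativeRing)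
  import Algebra.Properties.Semiring.Exp
  import Algebra.Properties.CommutativeSemiring.Exp
  import Algebra.Properties.Semiring.Sum
  open import Data.Fin.Base using (Fin; zero; suc; toℕ)
  open import Data.Nat.Base as ℕ using (ℕ; zero; suc; NonZero; _≤_; _<_; z≤n; s≤s)
  import Data.Nat.Properties as ℕₚ
  open import Data.Product.Base using (∃; _,_; proj₁; proj₂)
  open import Data.Rational.Base as ℚ using (ℚ; 0ℚ)
  import Data.Rational.Properties as ℚₚ
  import Relation.Binary.PropositionalEquality as ≡

  open ≡ using (_≡_; _≢_)
  import Relation.Binary.Reasoning.Setoid

  module Nonvanishing {c ℓ₁ ℓ₂} (K : HeytingField c ℓ₁ ℓ₂) (char0 : CharacteristicZero K) where
    open FieldProperties K
    open CommutativeRing commutativeRing hiding (zero)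
    open HeytingField K using (_#_)
    open OverField K char0
    open Chebyshev K char0
    open FromRational K char0
    open Algebra.Properties.Semiring.Sum semiring
    open Algebra.Properties.Semiring.Exp semiring
    open Powers commutativeRing using (^-inverse)
    open Algebra.Properties.CommutativeSemiring.Exp commutativeSemiring using (^-distrib-*)
    open IntegerCoefficients commutativeRing using (module Solver)
    open Solver using (solve; _:=_; _:+_; _:*_; _:-_; :-_; :0; :1)
    open Relation.Binary.Reasoning.Setoid setoid

    private F = Carrier

    fromℚ-homomorphism : ℚ-Homomorphism commutativeRing
    fromℚ-homomorphism = record
      { ψ = fromℚ ; ψ-0 = fromℚ-0 ; ψ-1 = fromℚ-1 ; ψ-+ = fromℚ-+ ; ψ-* = fromℚ-* ; ψ-neg = fromℚ-neg }

    0<ι : ∀ {m} → 1 ≤ m → 0ℚ ℚ.< Opaque.ι m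
    0<ι (s≤s {n = m} _) = Opaque.0<ι m

    ι≢0 : ∀ {m} → 1 ≤ m → Opaque.ι m ≢ 0ℚ
    ι≢0 1≤m ιm≡0 = ℚₚ.<⇒≢ (0<ι 1≤m) (≡.sym ιm≡0)

    -- In K / (ρ ^ M - 1) the root ρ becomes an M-th root of unity, which forces
    -- that quotient to be trivial; hence ρ ^ M - 1 is a unit.
    ρ^M-1#0 : ∀ M k .{{_ : NonZero M}} → 1 ≤ k → k ≤ M → ∀ {m} → 1 ≤ m → ∀ {ρ σ} (ρσ≈1 : ρ * σ ≈ 1#) →
      ⟦ m ⟧ + sum (symbol ρσ≈1 refl k) ≈ 0# → (ρ ^ M - 1#) # 0#
    ρ^M-1#0 M k 1≤k k≤M {m} 1≤m {ρ} {σ} ρσ≈1 characteristic = unit⇒#0 z (trans (*-comm z e)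
      (trans (sym (+-identityˡ (e * z))) (sym (proj₂ trivial))))
      where
      e = ρ ^ M - 1#
      open Quotient commutativeRing e
      open Green M k 1≤k k≤M (Opaque.ι m) (ℚₚ.<⇒≤ (0<ι 1≤m)) (ι≢0 1≤m)
      module Q = Algebra.Properties.Semiring.Exp (CommutativeRing.semiring quotient)
      symbol-quotient : ∀ (i : Fin k) → (1# + 1#) - (ρ Q.^ suc (toℕ i) + σ Q.^ suc (toℕ i)) ≡ symbol ρσ≈1 refl k i
      symbol-quotient i = ≡.cong₂ (λ p q → (1# + 1#) - (p + q)) (^-quotient ρ (suc (toℕ i))) (^-quotient σ (suc (toℕ i)))
      trivial : 1# ~ 0#
      trivial = Over.root-of-unity⇒trivial quotient (quotient-homomorphism fromℚ-homomorphism) ρ σ (≈⇒~ {ρ * σ} {1#} ρσ≈1)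
        (≈⇒~ (trans (+-cong (fromℚ-ι m) (reflexive (sum-quotient _ (symbol ρσ≈1 refl k) symbol-quotient))) characteristic))
        (1# , trans (reflexive (^-quotient ρ M)) (solve 1 (λ r → r := :1 :+ (r :- :1) :* :1) refl (ρ ^ M)))
      z = proj₁ trivial

    geometric : ∀ y n → ∃ λ z → y ^ n - 1# ≈ z * (y - 1#)
    geometric y zero    = 0# , solve 1 (λ y → :1 :- :1 := :0 :* (y :- :1)) refl y
    geometric y (suc n) = let z , eq = geometric y n in y ^ n + z , (begin
      y * y ^ n - 1#                          ≈⟨ solve 2 (λ y p → y :* p :- :1 := p :* (y :- :1) :+ (p :- :1)) refl y (y ^ n) ⟩
      y ^ n * (y - 1#) + (y ^ n - 1#)         ≈⟨ +-congˡ eq ⟩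
      y ^ n * (y - 1#) + z * (y - 1#)         ≈⟨ distribʳ (y - 1#) (y ^ n) z ⟨
      (y ^ n + z) * (y - 1#)                  ∎)

    module RootData (N n m : ℕ) .{{_ : NonZero N}} (k≤N : suc n ≤ N) (1≤m : 1 ≤ m) (roots : Roots (suc n) ⟦ m ⟧)
      (simple : AllRootsSimple (suc n) ⟦ m ⟧) where
      open Roots roots public

      k = suc n

      ρρ⁻¹ : ∀ c → ρ c * ρ⁻¹ c ≈ 1#
      ρρ⁻¹ c = trans (*-comm _ _) (inverseˡ (ρ c) (ρ#0 c))

      characteristic : ∀ c → ⟦ m ⟧ + sum (symbol (ρρ⁻¹ c) refl k) ≈ 0#
      characteristic c = root⇒characteristic (ρρ⁻¹ c) (ρ+ρ⁻¹ c) k ⟦ m ⟧ (φ-root c)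

      private
        -- Taken at 2N and not at N because ρ^(2N) - 1 has both ρ^N - 1 and ρ² - 1 as factors; every
        -- denominator is built from these two and from D′(φ).
        ρ^2N-1#0 : ∀ c → (ρ c ^ (N ℕ.+ N) - 1#) # 0#
        ρ^2N-1#0 c = ρ^M-1#0 (N ℕ.+ N) k {{ℕ.>-nonZero (ℕₚ.≤-trans (ℕ.>-nonZero⁻¹ N) (ℕₚ.m≤m+n N N))}}
          (s≤s z≤n) (ℕₚ.≤-trans k≤N (ℕₚ.m≤m+n N N)) 1≤m (ρρ⁻¹ c) (characteristic c)

      ρ^N-1#0 : ∀ c → (ρ c ^ N - 1#) # 0#
      ρ^N-1#0 c = #0-factorʳ {ρ c ^ N + 1#} (ρ^2N-1#0 c) (trans (+-congʳ (^-homo-* (ρ c) N N))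
        (solve 1 (λ p → p :* p :- :1 := (p :+ :1) :* (p :- :1)) refl (ρ c ^ N)))

      ρ²-1#0 : ∀ c → (ρ c ^ 2 - 1#) # 0#
      ρ²-1#0 c = #0-factorʳ (ρ^2N-1#0 c) (trans
        (+-congʳ (trans (^-congʳ (ρ c) (≡.cong (N ℕ.+_) (≡.sym (ℕₚ.+-identityʳ N)))) (sym (^-assocʳ (ρ c) 2 N))))
        (proj₂ (geometric (ρ c ^ 2) N)))

      ρ-ρ⁻¹#0 : ∀ c → (ρ c - ρ⁻¹ c) # 0#
      ρ-ρ⁻¹#0 c = #0-factorʳ {ρ c} (ρ²-1#0 c) (sym (begin
        ρ c * (ρ c - ρ⁻¹ c)                ≈⟨ solve 2 (λ r s → r :* (r :- s) := r :* (r :* :1) :- r :* s) refl (ρ c) (ρ⁻¹ c) ⟩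
        ρ c ^ 2 - ρ c * ρ⁻¹ c              ≈⟨ +-congˡ (-‿cong (ρρ⁻¹ c)) ⟩
        ρ c ^ 2 - 1#                       ∎))

      η⁻¹ : Fin k → F
      η⁻¹ c = inverse (η c) (η#0 c)

      ηη⁻¹ : ∀ c → η c * η⁻¹ c ≈ 1#
      ηη⁻¹ c = trans (*-comm _ _) (inverseˡ (η c) (η#0 c))

      -- η γ = ρ + 1, which is again a factor of ρ² - 1.
      γ#0 : ∀ c → γ c # 0#
      γ#0 c = #0-factorʳ {(ρ c - 1#) * η c} (ρ²-1#0 c) (sym (begin
        (ρ c - 1#) * η c * (η c + η⁻¹ c)
          ≈⟨ solve 3 (λ r e f → (r :- :1) :* e :* (e :+ f) := (r :- :1) :* (e :* (e :* :1) :+ e :* f)) refl (ρ c) (η c) (η⁻¹ c) ⟩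
        (ρ c - 1#) * (η c ^ 2 + η c * η⁻¹ c)
          ≈⟨ *-congˡ (+-cong (sym (ρ≈η² c)) (ηη⁻¹ c)) ⟩
        (ρ c - 1#) * (ρ c + 1#)
          ≈⟨ solve 1 (λ r → (r :- :1) :* (r :+ :1) := r :* (r :* :1) :- :1) refl (ρ c) ⟩
        ρ c ^ 2 - 1# ∎))

      -- Binet's formula with its denominator cleared.
      V-closed : ∀ c j → (η c - η⁻¹ c) * V c j ≈ η c ^ j - η⁻¹ c ^ j
      V-closed c zero          = solve 2 (λ e f → (e :- f) :* :0 := :1 :- :1) refl (η c) (η⁻¹ c)
      V-closed c (suc zero)    = solve 2 (λ e f → (e :- f) :* :1 := e :* :1 :- f :* :1) refl (η c) (η⁻¹ c)
      V-closed c (suc (suc j)) = begin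
        (e - f) * ((e + f) * V c (suc j) - V c j)
          ≈⟨ solve 4 (λ e f a b → (e :- f) :* ((e :+ f) :* a :- b) := (e :+ f) :* ((e :- f) :* a) :- (e :- f) :* b) refl e f (V c (suc j)) (V c j) ⟩
        (e + f) * ((e - f) * V c (suc j)) - (e - f) * V c j
          ≈⟨ +-cong (*-congˡ (V-closed c (suc j))) (-‿cong (V-closed c j)) ⟩
        (e + f) * (e * p - f * q) - (p - q)
          ≈⟨ solve 4 (λ e f p q → (e :+ f) :* (e :* p :- f :* q) :- (p :- q) :=
               e :* (e :* p) :- f :* (f :* q) :+ (e :* f :- :1) :* (p :- q)) refl e f p q ⟩
        e * (e * p) - f * (f * q) + (e * f - 1#) * (p - q)
          ≈⟨ +-congˡ (trans (*-congʳ (trans (+-congʳ (ηη⁻¹ c)) (-‿inverseʳ 1#))) (zeroˡ _)) ⟩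
        e * (e * p) - f * (f * q) + 0#
          ≈⟨ +-identityʳ _ ⟩
        e * (e * p) - f * (f * q) ∎
        where
        e = η c
        f = η⁻¹ c
        p = e ^ j
        q = f ^ j

      η^2 : ∀ c j → η c ^ j * η c ^ j ≈ ρ c ^ j
      η^2 c j = trans (sym (^-distrib-* (η c) (η c) j))
        (^-congˡ j (trans (*-congˡ (sym (*-identityʳ (η c)))) (sym (ρ≈η² c))))

      -- Multiplying Binet's formula by η^j leaves only powers of η² = ρ, so V can be compared with
      -- the powers of ρ in 𝒢.
      η^V : ∀ c j → η c ^ j * (η c - η⁻¹ c) * V c j ≈ ρ c ^ j - 1#
      η^V c j = begin
        η c ^ j * (η c - η⁻¹ c) * V c j                ≈⟨ trans (*-assoc _ _ _) (*-congˡ (V-closed c j)) ⟩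
        η c ^ j * (η c ^ j - η⁻¹ c ^ j)                ≈⟨ solve 2 (λ p q → p :* (p :- q) := p :* p :- p :* q) refl (η c ^ j) (η⁻¹ c ^ j) ⟩
        η c ^ j * η c ^ j - η c ^ j * η⁻¹ c ^ j        ≈⟨ +-cong (η^2 c j) (-‿cong (^-inverse (ηη⁻¹ c) j)) ⟩
        ρ c ^ j - 1#                                   ∎

      -- Opaque, lest comparing two inverses unfold these proofs.
      opaque
        D′φ#0 : ∀ c → D′φ c # 0#
        D′φ#0 c = simple (φ c) (φ-root c)

        𝒢-den#0 : ∀ c → 𝒢-denominator N c # 0#
        𝒢-den#0 c = #0-* (ρ-ρ⁻¹#0 c) (ρ^N-1#0 c)

        γD′φ#0 : ∀ c → (γ c * D′φ c) # 0#
        γD′φ#0 c = #0-* (γ#0 c) (D′φ#0 c)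

        V#0 : ∀ c → V c N # 0#
        V#0 c = #0-factorʳ (ρ^N-1#0 c) (sym (η^V c N))

      denominatorsNonzero : DenominatorsNonzero N
      denominatorsNonzero = record { D′φ#0 = D′φ#0 ; 𝒢-den#0 = 𝒢-den#0 ; γD′φ#0 = γD′φ#0 ; V#0 = V#0 }

-- The Green function over the field as a sum over the roots.

module SpectralGreenFunctions where

  open IntegerSolver
  open PeriodicSequences
  open Fields
  open RationalEmbedding
  open GreenFunctions
  open PolynomialIdentities
  open ChebyshevIdentities
  open Denominators
  open import Algebra.Apartness.Bundles using (HeytingField)
  open import Algebra.Bundles using (CommutativeRing)
  import Algebra.Properties.Semiring.Exp
  import Algebra.Properties.Semiring.Sum
  open import Data.Fin.Base using (Fin; zero; suc; toℕ; fromℕ)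
  open import Data.Fin.Properties using (toℕ<n; toℕ-fromℕ; toℕ-injective)
  open import Data.Nat.DivMod using (_%_; m%n<n; m<n⇒m%n≡m; [m+n]%n≡m%n; m≤n⇒[n∸m]%m≡n%m)
  open import Data.Sum.Base using (inj₁; inj₂)
  open import Data.Nat.Base as ℕ using (ℕ; zero; suc; NonZero; _≤_; _<_; z≤n; s≤s)
  import Data.Nat.Properties as ℕₚ
  open import Data.Nat.Tactic.RingSolver using (solve-∀)
  import Data.Rational.Properties as ℚₚ
  open import Function.Base using (_∘_)
  import Relation.Binary.PropositionalEquality as ≡

  open ≡ using (_≡_; _≢_)
  import Relation.Binary.Reasoning.Setoid

  module GreenOverField {c ℓ₁ ℓ₂} (K : HeytingField c ℓ₁ ℓ₂) (char0 : CharacteristicZero K) where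
    open FieldProperties K
    open CommutativeRing commutativeRing hiding (zero)
    open OverField K char0
    open Polynomials K char0
    open Chebyshev K char0
    open FromRational K char0
    open Nonvanishing K char0
    open Algebra.Properties.Semiring.Sum semiring
    open Algebra.Properties.Semiring.Exp semiring
    open Powers commutativeRing using (^-inverse)
    open IntegerCoefficients commutativeRing using (module Solver)
    open Solver using (solve; _:=_; _:+_; _:*_; _:-_; :-_; :0; :1)
    open Relation.Binary.Reasoning.Setoid setoid

    private F = Carrier

    module Spectral (N n m : ℕ) .{{_ : NonZero N}} (k≤N : suc n ≤ N) (1≤m : 1 ≤ m) (roots : Roots (suc n) ⟦ m ⟧)
      (simple : AllRootsSimple (suc n) ⟦ m ⟧) where
      open RootData N n m k≤N 1≤m roots simple
      open Periodic commutativeRing N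

      module Gℚ = Green N k (s≤s z≤n) k≤N (Opaque.ι m) (ℚₚ.<⇒≤ (0<ι 1≤m)) (ι≢0 1≤m)
      open Gℚ using (G)
      open Gℚ.Over commutativeRing fromℚ-homomorphism using (κ; unique)

      -- The symmetrisation makes `u c` take equal values at 0 and N, so the periodic extension
      -- `ũ c` has its only kink at the multiples of N.
      u ũ : Fin k → ℕ → F
      u c x = ρ c ^ x + ρ c ^ (N ℕ.∸ x)
      ũ c x = u c (x % N)

      den : Fin k → F
      den = 𝒢-denominator N

      Wφ : Fin k → ℕ → F
      Wφ c t = eval (W t) (φ c)

      den*W : ∀ c t → den c * Wφ c t ≈ (ρ c ^ N - 1#) * (ρ c ^ t - ρ⁻¹ c ^ t)
      den*W c t = trans (solve 3 (λ a b w → a :* b :* w := b :* (a :* w)) refl (ρ c - ρ⁻¹ c) (ρ c ^ N - 1#) (Wφ c t))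
        (*-congˡ (eval-W (ρρ⁻¹ c) (ρ+ρ⁻¹ c) t))

      den*W₀ : ∀ c → den c * Wφ c 0 ≈ 0#
      den*W₀ c = zeroʳ (den c)

      -- The N-periodic extension of u deviates from ρ^x + ρ^(N - x) beyond
      -- [0, N] by a multiple of W; truncated subtraction makes the deviation 0
      -- inside.
      module Deviation (c : Fin k) (x : ℕ) (x<N : x < N) (s : ℕ) (s≤N : s ≤ N) where
        private
          r = ρ c
          r̄ = ρ⁻¹ c
          X = r ^ x
          X̄ = r̄ ^ x
          a = r ^ s
          b = r̄ ^ s
          Z = r ^ N
          Z̄ = r̄ ^ N
          rr̄ = ρρ⁻¹ c
          r̄r = trans (*-comm r̄ r) rr̄
          Q≈ : r ^ (N ℕ.∸ x) ≈ Z * X̄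
          Q≈ = ^-∸ rr̄ (ℕₚ.<⇒≤ x<N)

          no-deviation : ∀ {y t} p → t ≡ 0 → y ≈ p → y ≈ p - den c * Wφ c t
          no-deviation p ≡.refl y≈p = trans y≈p (trans (solve 1 (λ p → p := p :- :0) refl p)
            (+-congˡ (-‿cong (sym (den*W₀ c)))))

        ahead : ũ c (x ℕ.+ s) ≈ (X * a + r ^ (N ℕ.∸ x) * b) - den c * Wφ c ((x ℕ.+ s) ℕ.∸ N)
        ahead with ℕₚ.<-≤-connex (x ℕ.+ s) N
        ... | inj₁ x+s<N = no-deviation (X * a + r ^ (N ℕ.∸ x) * b) (ℕₚ.m≤n⇒m∸n≡0 (ℕₚ.<⇒≤ x+s<N)) (begin
          ũ c (x ℕ.+ s)                         ≡⟨ ≡.cong (u c) (m<n⇒m%n≡m x+s<N) ⟩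
          r ^ (x ℕ.+ s) + r ^ (N ℕ.∸ (x ℕ.+ s)) ≈⟨ +-cong (^-homo-* r x s) (^-∸ rr̄ (ℕₚ.<⇒≤ x+s<N)) ⟩
          X * a + Z * r̄ ^ (x ℕ.+ s)             ≈⟨ +-congˡ (*-congˡ (^-homo-* r̄ x s)) ⟩
          X * a + Z * (X̄ * b)                   ≈⟨ +-congˡ (*-assoc Z X̄ b) ⟨
          X * a + Z * X̄ * b                     ≈⟨ +-congˡ (*-congʳ Q≈) ⟨
          X * a + r ^ (N ℕ.∸ x) * b             ∎)
        ... | inj₂ N≤x+s = begin
          ũ c (x ℕ.+ s)
            ≡⟨ ≡.cong (u c) (≡.trans (≡.sym (m≤n⇒[n∸m]%m≡n%m N≤x+s)) (m<n⇒m%n≡m t<N)) ⟩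
          r ^ t + r ^ (N ℕ.∸ t)
            ≈⟨ +-cong r^t (trans (^-∸ rr̄ (ℕₚ.<⇒≤ t<N)) (*-congˡ r̄^t)) ⟩
          X * a * Z̄ + Z * (X̄ * b * Z)
            -- Past N the wrapped value differs from the continued one by (Z - 1)(ρ^t - ρ^(-t)),
            -- which is `den` times `W t`; the last summand vanishes because Z Z̄ = 1.
            ≈⟨ solve 6 (λ X a Z̄ Z X̄ b → X :* a :* Z̄ :+ Z :* (X̄ :* b :* Z) :=
                 (X :* a :+ Z :* X̄ :* b) :- (Z :- :1) :* (X :* a :* Z̄ :- X̄ :* b :* Z) :+ (Z :* Z̄ :- :1) :* (X :* a)) refl X a Z̄ Z X̄ b ⟩
          (X * a + Z * X̄ * b) - (Z - 1#) * (X * a * Z̄ - X̄ * b * Z) + (Z * Z̄ - 1#) * (X * a)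
            ≈⟨ trans (+-congˡ (trans (*-congʳ (trans (+-congʳ (^-inverse rr̄ N)) (-‿inverseʳ 1#))) (zeroˡ _))) (+-identityʳ _) ⟩
          (X * a + Z * X̄ * b) - (Z - 1#) * (X * a * Z̄ - X̄ * b * Z)
            ≈⟨ +-cong (+-congˡ (*-congʳ Q≈)) (-‿cong (trans (den*W c t) (*-congˡ (+-cong r^t (-‿cong r̄^t))))) ⟨
          (X * a + r ^ (N ℕ.∸ x) * b) - den c * Wφ c t ∎
          where
          t = (x ℕ.+ s) ℕ.∸ N
          t<N : t < N
          t<N = ℕₚ.+-cancelʳ-< N t N (≡.subst (_< N ℕ.+ N) (≡.sym (ℕₚ.m∸n+n≡m N≤x+s)) (ℕₚ.+-mono-<-≤ x<N s≤N))
          r^t : r ^ t ≈ X * a * Z̄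
          r^t = trans (^-∸ rr̄ N≤x+s) (*-congʳ (^-homo-* r x s))
          r̄^t : r̄ ^ t ≈ X̄ * b * Z
          r̄^t = trans (^-∸ r̄r N≤x+s) (*-congʳ (^-homo-* r̄ x s))

        behind : ũ c (x ℕ.+ (N ℕ.∸ s)) ≈ (X * b + r ^ (N ℕ.∸ x) * a) - den c * Wφ c (s ℕ.∸ x)
        behind with ℕₚ.<-≤-connex x s
        ... | inj₂ s≤x = no-deviation (X * b + r ^ (N ℕ.∸ x) * a) (ℕₚ.m≤n⇒m∸n≡0 s≤x) (begin
          ũ c (x ℕ.+ (N ℕ.∸ s))                 ≡⟨ ≡.cong (u c) index ⟩
          r ^ (x ℕ.∸ s) + r ^ (N ℕ.∸ (x ℕ.∸ s)) ≈⟨ +-cong (^-∸ rr̄ s≤x) (^-∸ rr̄ (ℕₚ.≤-trans (ℕₚ.m∸n≤m x s) (ℕₚ.<⇒≤ x<N))) ⟩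
          X * b + Z * r̄ ^ (x ℕ.∸ s)             ≈⟨ +-congˡ (*-congˡ (^-∸ r̄r s≤x)) ⟩
          X * b + Z * (X̄ * a)                   ≈⟨ +-congˡ (*-assoc Z X̄ a) ⟨
          X * b + Z * X̄ * a                     ≈⟨ +-congˡ (*-congʳ Q≈) ⟨
          X * b + r ^ (N ℕ.∸ x) * a             ∎)
          where
          index : (x ℕ.+ (N ℕ.∸ s)) % N ≡ x ℕ.∸ s
          index = ≡.trans (≡.cong (_% N) (≡.trans (≡.sym (ℕₚ.+-∸-assoc x s≤N)) (ℕₚ.+-∸-comm N s≤x)))
            (≡.trans ([m+n]%n≡m%n (x ℕ.∸ s) N) (m<n⇒m%n≡m (ℕₚ.≤-<-trans (ℕₚ.m∸n≤m x s) x<N)))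
        ... | inj₁ x<s = begin
          ũ c (x ℕ.+ (N ℕ.∸ s))
            ≡⟨ ≡.cong (u c) index ⟩
          r ^ (N ℕ.∸ t) + r ^ (N ℕ.∸ (N ℕ.∸ t))
            ≈⟨ +-cong (trans (^-∸ rr̄ t≤N) (*-congˡ r̄^t)) (trans (^-congʳ r (ℕₚ.m∸[m∸n]≡n t≤N)) r^t) ⟩
          Z * (b * X) + a * X̄
            ≈⟨ solve 5 (λ Z b X a X̄ → Z :* (b :* X) :+ a :* X̄ := (X :* b :+ Z :* X̄ :* a) :- (Z :- :1) :* (a :* X̄ :- b :* X)) refl Z b X a X̄ ⟩
          (X * b + Z * X̄ * a) - (Z - 1#) * (a * X̄ - b * X)
            ≈⟨ +-cong (+-congˡ (*-congʳ Q≈)) (-‿cong (trans (den*W c t) (*-congˡ (+-cong r^t (-‿cong r̄^t))))) ⟨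
          (X * b + r ^ (N ℕ.∸ x) * a) - den c * Wφ c t ∎
          where
          t = s ℕ.∸ x
          t≤N : t ≤ N
          t≤N = ℕₚ.≤-trans (ℕₚ.m∸n≤m s x) s≤N
          r^t : r ^ t ≈ a * X̄
          r^t = ^-∸ rr̄ (ℕₚ.<⇒≤ x<s)
          r̄^t : r̄ ^ t ≈ b * X
          r̄^t = ^-∸ r̄r (ℕₚ.<⇒≤ x<s)
          x+N-s : x ℕ.+ (N ℕ.∸ s) ≡ N ℕ.∸ t
          x+N-s = ≡.trans (≡.sym (ℕₚ.m+n∸n≡m (x ℕ.+ (N ℕ.∸ s)) t)) (≡.cong (ℕ._∸ t) (≡.trans
            (ℕ-lemma x (N ℕ.∸ s) t) (≡.trans (≡.cong ((N ℕ.∸ s) ℕ.+_) (ℕₚ.m+[n∸m]≡n (ℕₚ.<⇒≤ x<s))) (ℕₚ.m∸n+n≡m s≤N))))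
            where
            ℕ-lemma : ∀ x y t → x ℕ.+ y ℕ.+ t ≡ y ℕ.+ (x ℕ.+ t)
            ℕ-lemma = solve-∀
          index : (x ℕ.+ (N ℕ.∸ s)) % N ≡ N ℕ.∸ t
          index = ≡.trans (m<n⇒m%n≡m (≡.subst (_< N) (≡.sym x+N-s) (ℕₚ.∸-monoʳ-< {N} {t} {0} (ℕₚ.m<n⇒0<n∸m x<s) t≤N))) x+N-s

      ũ-periodic : ∀ c → IsPeriodic (ũ c)
      ũ-periodic c x = reflexive (≡.cong (u c) ([m+n]%n≡m%n x N))

      defect : Fin k → ℕ → Fin k → F
      defect c x i = Wφ c ((x ℕ.+ suc (toℕ i)) ℕ.∸ N) + Wφ c (suc (toℕ i) ℕ.∸ x)

      -- The continued powers of ρ are annihilated by the characteristic equation, so only the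
      -- deviations of the wrapped values contribute.
      Schrödinger-ũ : ∀ c x → x < N → Schrödinger k κ (ũ c) x ≈ den c * sum (defect c x)
      Schrödinger-ũ c x x<N = begin
        fromℚ (Opaque.ι m) * ũ c x + sum {k} (λ i → (ũ c x + ũ c x) - step (ũ c) (suc (toℕ i)) x)
          ≈⟨ +-cong (*-cong (fromℚ-ι m) ũ≈) (sum-cong-≋ {k} pointwise) ⟩
        ⟦ m ⟧ * U + sum {k} (λ i → sy i * U + den c * defect c x i)
          ≈⟨ +-congˡ (trans (∑-distrib-+ {k} (λ i → sy i * U) (λ i → den c * defect c x i))
               (+-cong (sym (*-distribʳ-sum {k} U sy)) (sym (*-distribˡ-sum {k} (den c) (defect c x))))) ⟩
        ⟦ m ⟧ * U + (sum sy * U + den c * sum (defect c x))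
          ≈⟨ solve 4 (λ m U s d → m :* U :+ (s :* U :+ d) := (m :+ s) :* U :+ d) refl ⟦ m ⟧ U (sum sy) (den c * sum (defect c x)) ⟩
        (⟦ m ⟧ + sum sy) * U + den c * sum (defect c x)
          ≈⟨ trans (+-congʳ (trans (*-congʳ (characteristic c)) (zeroˡ U))) (+-identityˡ _) ⟩
        den c * sum (defect c x) ∎
        where
        U = u c x
        sy = symbol (ρρ⁻¹ c) refl k
        ũ≈ : ũ c x ≈ U
        ũ≈ = reflexive (≡.cong (u c) (m<n⇒m%n≡m x<N))
        pointwise : ∀ i → (ũ c x + ũ c x) - step (ũ c) (suc (toℕ i)) x ≈ sy i * U + den c * defect c x i
        pointwise i = begin
          (ũ c x + ũ c x) - step (ũ c) s x
            ≈⟨ +-cong (+-cong ũ≈ ũ≈) (-‿cong (+-cong (Deviation.ahead c x x<N s s≤N) (Deviation.behind c x x<N s s≤N))) ⟩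
          (U + U) - (((X * a + Q * b) - den c * w₁) + ((X * b + Q * a) - den c * w₂))
            ≈⟨ solve 7 (λ X Q a b d w₁ w₂ → ((X :+ Q) :+ (X :+ Q)) :- (((X :* a :+ Q :* b) :- d :* w₁) :+ ((X :* b :+ Q :* a) :- d :* w₂)) :=
                 ((:1 :+ :1) :- (a :+ b)) :* (X :+ Q) :+ d :* (w₁ :+ w₂)) refl X Q a b (den c) w₁ w₂ ⟩
          sy i * U + den c * defect c x i ∎
          where
          s = suc (toℕ i)
          s≤N = ℕₚ.≤-trans (toℕ<n i) k≤N
          X = ρ c ^ x
          Q = ρ c ^ (N ℕ.∸ x)
          a = ρ c ^ s
          b = ρ⁻¹ c ^ s
          w₁ = Wφ c ((x ℕ.+ s) ℕ.∸ N)
          w₂ = Wφ c (s ℕ.∸ x)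

      w i : Fin k → F
      w c = inverse (D′φ c) (D′φ#0 c)
      i c = inverse (den c) (𝒢-den#0 c)

      -- 1 / D′(φ_c) prepares Euler's identity, 1 / `den` cancels the common factor of the defects,
      -- and - 1/2 normalises the one surviving residue sum - 2 to 1.
      g : ℕ → F
      g y = sum (λ c → - (half * (w c * i c)) * ũ c y)

      g-periodic : IsPeriodic g
      g-periodic x = sum-cong-≋ {k} λ c → *-congˡ {x = - (half * (w c * i c))} (ũ-periodic c x)

      Λ : ℕ → F
      Λ = residueSum φ φ-distinct φ-root w (λ c → inverseˡ (D′φ c) (D′φ#0 c))

      private
        Λ-< : ∀ {t} → t ≤ n → Λ t ≈ 0#
        Λ-< {t} = residueSum-< φ φ-distinct φ-root w (λ c → inverseˡ (D′φ c) (D′φ#0 c)) t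

        Λ-= : Λ k ≈ - ⟦ 2 ⟧
        Λ-= = residueSum-= φ φ-distinct φ-root w (λ c → inverseˡ (D′φ c) (D′φ#0 c))

      Schrödinger-g : ∀ x → x < N → Schrödinger k κ g x ≈
        - half * sum {k} (λ j → Λ ((x ℕ.+ suc (toℕ j)) ℕ.∸ N) + Λ (suc (toℕ j) ℕ.∸ x))
      Schrödinger-g x x<N = begin
        Schrödinger k κ g x
          ≈⟨ Schrödinger-sum k κ k (λ c → - (half * (w c * i c))) ũ x ⟩
        sum (λ c → - (half * (w c * i c)) * Schrödinger k κ (ũ c) x)
          ≈⟨ sum-cong-≋ {k} (λ c → begin
               - (half * (w c * i c)) * Schrödinger k κ (ũ c) x
                 ≈⟨ *-congˡ (Schrödinger-ũ c x x<N) ⟩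
               - (half * (w c * i c)) * (den c * sum (defect c x))
                 ≈⟨ solve 5 (λ h w i d s → :- (h :* (w :* i)) :* (d :* s) := :- h :* ((i :* d) :* (s :* w))) refl half (w c) (i c) (den c) (sum (defect c x)) ⟩
               - half * ((i c * den c) * (sum (defect c x) * w c))
                 ≈⟨ *-congˡ (trans (*-congʳ (inverseˡ (den c) (𝒢-den#0 c))) (*-identityˡ _)) ⟩
               - half * (sum (defect c x) * w c)
                 ≈⟨ *-congˡ (*-distribʳ-sum {k} (w c) (defect c x)) ⟩
               - half * sum (λ j → defect c x j * w c) ∎) ⟩
        sum (λ c → - half * sum (λ j → defect c x j * w c))
          ≈⟨ *-distribˡ-sum {k} (- half) (λ c → sum (λ j → defect c x j * w c)) ⟨
        - half * sum (λ c → sum (λ j → defect c x j * w c))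
          ≈⟨ *-congˡ (∑-comm {k} {k} (λ c j → defect c x j * w c)) ⟩
        - half * sum (λ j → sum (λ c → defect c x j * w c))
          ≈⟨ *-congˡ (sum-cong-≋ {k} λ j → trans (sum-cong-≋ {k} (λ c → distribʳ (w c) (Wφ c ((x ℕ.+ suc (toℕ j)) ℕ.∸ N)) (Wφ c (suc (toℕ j) ℕ.∸ x))))
               (∑-distrib-+ {k} (λ c → Wφ c ((x ℕ.+ suc (toℕ j)) ℕ.∸ N) * w c) (λ c → Wφ c (suc (toℕ j) ℕ.∸ x) * w c))) ⟩
        - half * sum {k} (λ j → Λ ((x ℕ.+ suc (toℕ j)) ℕ.∸ N) + Λ (suc (toℕ j) ℕ.∸ x)) ∎

      private
        -- From x ≤ N - 1 a forward step overshoots N by at most k - 1. The index k, the only one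
        -- with a nonzero residue sum, is thus reached only by the backward step of length k from x
        -- = 0.
        ahead<k : ∀ x → x < N → (j : Fin k) → (x ℕ.+ suc (toℕ j)) ℕ.∸ N ≤ n
        ahead<k x x<N j = ℕₚ.≤-trans (ℕₚ.∸-monoˡ-≤ {x ℕ.+ suc (toℕ j)} {N ℕ.+ n} N
          (≡.subst (_≤ N ℕ.+ n) (≡.sym (ℕₚ.+-suc x (toℕ j))) (ℕₚ.+-mono-≤ x<N (ℕ.s≤s⁻¹ (toℕ<n j)))))
          (ℕₚ.≤-reflexive (ℕₚ.m+n∸m≡n N n))

        at-zero : Schrödinger k κ g 0 ≈ 1#
        at-zero = begin
          Schrödinger k κ g 0
            ≈⟨ Schrödinger-g 0 (ℕ.>-nonZero⁻¹ N) ⟩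
          - half * sum {k} (λ j → Λ (suc (toℕ j) ℕ.∸ N) + Λ (suc (toℕ j)))
            ≈⟨ *-congˡ (trans (sum-single {k} (λ j → Λ (suc (toℕ j) ℕ.∸ N) + Λ (suc (toℕ j))) last off) (+-cong
                 (Λ-< (ahead<k 0 (ℕ.>-nonZero⁻¹ N) last)) (trans (reflexive (≡.cong (Λ ∘ suc) (toℕ-fromℕ n))) Λ-=))) ⟩
          - half * (0# + - ⟦ 2 ⟧)
            ≈⟨ solve 2 (λ h t → :- h :* (:0 :+ :- t) := h :* t) refl half ⟦ 2 ⟧ ⟩
          half * ⟦ 2 ⟧
            ≈⟨ half*2 ⟩
          1# ∎
          where
          last = fromℕ n
          off : ∀ j → j ≢ last → Λ (suc (toℕ j) ℕ.∸ N) + Λ (suc (toℕ j)) ≈ 0#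
          off j j≢last = trans (+-cong (Λ-< (ahead<k 0 (ℕ.>-nonZero⁻¹ N) j)) (Λ-< (ℕₚ.≤∧≢⇒< (ℕ.s≤s⁻¹ (toℕ<n j))
            λ eq → j≢last (toℕ-injective (≡.trans eq (≡.sym (toℕ-fromℕ n))))))) (+-identityˡ 0#)

        at-suc : ∀ x → suc x < N → Schrödinger k κ g (suc x) ≈ 0#
        at-suc x x<N = trans (Schrödinger-g (suc x) x<N) (trans (*-congˡ (sum≈0 {k} (λ j → Λ ((suc x ℕ.+ suc (toℕ j)) ℕ.∸ N) + Λ (toℕ j ℕ.∸ x)) λ j →
          trans (+-cong (Λ-< (ahead<k (suc x) x<N j)) (Λ-< (ℕₚ.≤-trans (ℕₚ.m∸n≤m (toℕ j) x) (ℕ.s≤s⁻¹ (toℕ<n j))))) (+-identityˡ 0#)))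
          (zeroʳ _))

        on-period : ∀ y → y < N → Schrödinger k κ g y ≈ fromℚ (δ N y)
        on-period zero    _   = trans at-zero (sym (trans (reflexive (≡.cong fromℚ (δ-zero N))) fromℚ-1))
        on-period (suc x) x<N = trans (at-suc x x<N) (sym (trans (reflexive (≡.cong fromℚ (δ-suc N x x<N))) fromℚ-0))

      g≈G : ∀ y → g y ≈ fromℚ (G y)
      g≈G = unique {g} g-periodic λ x →
        trans (sym (periodic-% {Schrödinger k κ g} (Schrödinger-periodic k {κ} {g} (λ _ → refl) g-periodic) x))
          (trans (on-period (x % N) (m%n<n x N))
            (periodic-% {λ x → fromℚ (δ N x)} (λ x → reflexive (≡.cong fromℚ (δ-periodic N x))) x))

-- Explicit rational hitting times on the circulant graph and on the product.

module RationalHittingTimes where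

  open PeriodicSequences
  open Opaque
  open RationalSchrödinger
  open FirstStepAnalysis using (ι-suc; ι-mono-≤)
  open Walks
  open Neighbourhoods
  open GreenFunctions using (δ; δ-periodic; δ-zero; δ-suc; module Green; ℚ-Homomorphism)
  open import Data.Bool.Base using (true; false; if_then_else_)
  open import Data.Fin.Base using (Fin; zero; suc; toℕ)
  open import Data.Fin.Properties using (toℕ<n; toℕ-fromℕ<; toℕ-injective) renaming (_≟_ to _≟ᶠ_)
  open import Data.Nat.Base as ℕ using (ℕ; zero; suc; NonZero; s≤s)
  open import Data.Nat.DivMod using (_%_; m%n<n; m<n⇒m%n≡m; _mod_; [m+n]%n≡m%n)
  import Data.Nat.Properties as ℕₚ
  open import Data.Product.Base using (∃; _×_; _,_; proj₁; proj₂)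
  open import Data.Rational.Base using (ℚ; 0ℚ; 1ℚ; _≤_; _<_)
  import Data.Rational.Properties as ℚₚ
  open import Data.Sum.Base using (inj₁; inj₂)
  open import Function.Base using (id)
  open import Relation.Binary.PropositionalEquality
    using (_≡_; _≢_; refl; sym; trans; cong; cong₂; subst; module ≡-Reasoning)
  open import Relation.Nullary.Decidable using (yes; no; does; Dec; dec-true; dec-false)
  open import Relation.Nullary.Negation using (contradiction)

  open ℚ-Integers.Solver using (solve; _:=_; _:+_; _:*_; _:-_; :-_; :0; :1)

  sum-const : ∀ n c → sum {n} (λ _ → c) ≡ ι n * c
  sum-const zero    c = sym (trans (cong (_* c) ι-0) (zeroˡ c))
  sum-const (suc n) c = trans (cong (c +_) (sum-const n c)) (sym (trans (cong (_* c) (ι-suc n))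
    (solve 2 (λ c i → (:1 :+ i) :* c := c :+ i :* c) refl c (ι n))))

  ℚ-identity : ℚ-Homomorphism ℚ-ring
  ℚ-identity = record
    { ψ = id ; ψ-0 = refl ; ψ-1 = refl ; ψ-+ = λ _ _ → refl ; ψ-* = λ _ _ → refl ; ψ-neg = λ _ → refl }

  ι-positive : ∀ {n} → 1 ℕ.≤ n → 0ℚ < ι n
  ι-positive (s≤s {n = n} _) = 0<ι n

  ι-nonzero : ∀ {n} → 1 ℕ.≤ n → ι n ≢ 0ℚ
  ι-nonzero 1≤n ιn≡0 = ℚₚ.<⇒≢ (ι-positive 1≤n) (sym ιn≡0)

  module HittingTimes (N k m : ℕ) .{{_ : NonZero N}} (1≤k : 1 ℕ.≤ k) (1≤m : 1 ℕ.≤ m)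
    (2k+1≤N : 2 ℕ.* k ℕ.+ 1 ℕ.≤ N) (k≤N : k ℕ.≤ N) where

    open Periodic ℚ-ring N
    open ℚSchrödinger N k using (extend; Schrödinger-solvable)
    module Gℚ = Green N k 1≤k k≤N (ι m) (ℚₚ.<⇒≤ (ι-positive 1≤m)) (ι-nonzero 1≤m)
    open Gℚ using (G; G-periodic; G-equation)
    open Gℚ.Over ℚ-ring ℚ-identity using (Σ₀-δ)

    X Y : Graph
    X = C N k 2k+1≤N
    Y = X □ complete m

    2k : ℚ
    2k = ι (2 ℕ.* k)

    2k≡k+k : 2k ≡ ι k + ι k
    2k≡k+k = trans (cong (λ j → ι (k ℕ.+ j)) (ℕₚ.+-identityʳ k)) (ι-+ k k)

    sum-pairs : ∀ c → sum {k} (λ _ → c + c) ≡ 2k * c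
    sum-pairs c = trans (sum-const k (c + c)) (trans
      (solve 2 (λ i c → i :* (c :+ c) := (i :+ i) :* c) refl (ι k) c) (cong (_* c) (sym 2k≡k+k)))

    Schrödinger+neighbourSum : ∀ κ f x → Schrödinger k κ f x + neighbourSum k f x ≡ κ x * f x + 2k * f x
    Schrödinger+neighbourSum κ f x = begin
      (κ x * f x + sum {k} (λ i → (f x + f x) - s i)) + sum {k} s
        ≡⟨ +-assoc (κ x * f x) (sum {k} (λ i → (f x + f x) - s i)) (sum {k} s) ⟩
      κ x * f x + (sum {k} (λ i → (f x + f x) - s i) + sum {k} s)
        ≡⟨ cong (κ x * f x +_) (trans (sym (ℚΣ.∑-distrib-+ {k} (λ i → (f x + f x) - s i) s))
             (trans (ℚΣ.sum-cong-≗ {k} λ i → solve 2 (λ a b → (a :- b) :+ b := a) refl (f x + f x) (s i)) (sum-pairs (f x)))) ⟩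
      κ x * f x + 2k * f x ∎
      where
      open ≡-Reasoning
      s : Fin k → ℚ
      s i = step f (suc (toℕ i)) x

    neighbourSum-cong : ∀ {f g} → (∀ x → f x ≡ g x) → ∀ x → neighbourSum k f x ≡ neighbourSum k g x
    neighbourSum-cong f≡g x = ℚΣ.sum-cong-≗ {k} λ i →
      cong₂ _+_ (f≡g (x ℕ.+ suc (toℕ i))) (f≡g (x ℕ.+ (N ℕ.∸ suc (toℕ i))))

    neighbourSum-affine : ∀ α β γ f g x →
      neighbourSum k (λ y → α * f y + β + γ * g y) x ≡ α * neighbourSum k f x + 2k * β + γ * neighbourSum k g x
    neighbourSum-affine α β γ f g x = begin
      sum {k} (λ i → (α * f (a i) + β + γ * g (a i)) + (α * f (b i) + β + γ * g (b i)))
        ≡⟨ ℚΣ.sum-cong-≗ {k} (λ i → solve 7 (λ α β γ p q r s →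
             (α :* p :+ β :+ γ :* q) :+ (α :* r :+ β :+ γ :* s) := (α :* (p :+ r) :+ (β :+ β)) :+ γ :* (q :+ s))
             refl α β γ (f (a i)) (g (a i)) (f (b i)) (g (b i))) ⟩
      sum {k} (λ i → (α * F i + (β + β)) + γ * G′ i)
        ≡⟨ trans (ℚΣ.∑-distrib-+ {k} (λ i → α * F i + (β + β)) (λ i → γ * G′ i))
             (cong₂ _+_ (trans (ℚΣ.∑-distrib-+ {k} (λ i → α * F i) (λ _ → β + β))
               (cong₂ _+_ (sym (ℚΣ.*-distribˡ-sum {k} α F)) (sum-pairs β))) (sym (ℚΣ.*-distribˡ-sum {k} γ G′))) ⟩
      α * sum F + 2k * β + γ * sum G′ ∎
      where
      open ≡-Reasoning
      a b : Fin k → ℕ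
      a i = x ℕ.+ suc (toℕ i)
      b i = x ℕ.+ (N ℕ.∸ suc (toℕ i))
      F G′ : Fin k → ℚ
      F i  = f (a i) + f (b i)
      G′ i = g (a i) + g (b i)

    private
      0≤δ : ∀ x → 0ℚ ≤ δ N x
      0≤δ x = 0≤if (does (x % N ℕₚ.≟ 0))
        where
        0≤if : ∀ b → 0ℚ ≤ (if b then 1ℚ else 0ℚ)
        0≤if true  = ℚₚ.<⇒≤ 0<1
        0≤if false = ℚₚ.≤-refl

      δ₀≢0 : δ N 0 ≢ 0ℚ
      δ₀≢0 δ₀≡0 = ℚₚ.<⇒≢ 0<1 (trans (sym δ₀≡0) (δ-zero N))

      source : ℕ → ℚ
      source x = 2k - 2k * ι N * δ N x

    -- The hitting time of 0 satisfies L H = 2k (1 - N δ₀) and H 0 = 0; adding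
    -- the potential δ₀ makes this equation uniquely solvable.
    solution : ∃ λ f → IsPeriodic f × (∀ x → Schrödinger k (δ N) f x ≡ source x)
    solution = Schrödinger-solvable (δ N) 0≤δ δ₀≢0 1≤k k≤N (δ-periodic N) source
      (λ x → cong (λ z → 2k - 2k * ι N * z) (δ-periodic N x))

    H : ℕ → ℚ
    H = proj₁ solution

    H-periodic : IsPeriodic H
    H-periodic = proj₁ (proj₂ solution)

    -- Sum the equation over ℤ/N. The Laplacian contributes nothing, so the auxiliary potential
    -- leaves H 0 on one side; on the other the source has total 0, which is why it carries the
    -- weight N at 0.
    H0≡0 : H 0 ≡ 0ℚ
    H0≡0 = begin
      H 0
        ≡⟨ Σ₀-δ N H ⟨
      Σ₀ (λ x → H x * δ N x)
        ≡⟨ ℚΣ.sum-cong-≗ {N} (λ i → cong (H (toℕ i) *_) (sym (Schrödinger-1 (toℕ i)))) ⟩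
      Σ₀ (λ x → H x * Schrödinger k (δ N) (λ _ → 1ℚ) x)
        ≡⟨ Schrödinger-selfAdjoint k k≤N {δ N} {λ _ → 1ℚ} {H} (λ _ → refl) H-periodic ⟩
      Σ₀ (λ x → 1ℚ * Schrödinger k (δ N) H x)
        ≡⟨ ℚΣ.sum-cong-≗ {N} (λ i → trans (*-identityˡ _) (trans (proj₂ (proj₂ solution) (toℕ i))
             (solve 3 (λ t n d → t :- t :* n :* d := t :+ (:- (t :* n)) :* d) refl 2k (ι N) (δ N (toℕ i))))) ⟩
      Σ₀ (λ x → 2k + - (2k * ι N) * δ N x)
        ≡⟨ ℚΣ.∑-distrib-+ {N} (λ _ → 2k) (λ i → - (2k * ι N) * δ N (toℕ i)) ⟩
      sum {N} (λ _ → 2k) + Σ₀ (λ x → - (2k * ι N) * δ N x)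
        ≡⟨ cong₂ _+_ (sum-const N 2k) (Σ₀-δ N (λ _ → - (2k * ι N))) ⟩
      ι N * 2k + - (2k * ι N)
        ≡⟨ solve 2 (λ n t → n :* t :+ :- (t :* n) := :0) refl (ι N) 2k ⟩
      0ℚ ∎
      where
      open ≡-Reasoning
      Schrödinger-1 : ∀ x → Schrödinger k (δ N) (λ _ → 1ℚ) x ≡ δ N x
      Schrödinger-1 x = trans (cong₂ _+_ (*-identityʳ (δ N x))
        (sum-zero {k} (λ _ → (1ℚ + 1ℚ) - (1ℚ + 1ℚ)) λ _ → solve 1 (λ x → x :- x := :0) refl (1ℚ + 1ℚ)))
        (+-identityʳ (δ N x))

    -- The auxiliary potential acts only where H vanishes, so it drops out of the equation again.
    δH≡0 : ∀ x → δ N x * H x ≡ 0ℚ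
    δH≡0 x = by-cases (x % N ℕₚ.≟ 0)
      where
      by-cases : (d : Dec (x % N ≡ 0)) → (if does d then 1ℚ else 0ℚ) * H x ≡ 0ℚ
      by-cases (yes x%N≡0) = trans (*-identityˡ (H x)) (trans (sym (periodic-% {H} H-periodic x)) (trans (cong H x%N≡0) H0≡0))
      by-cases (no _)      = zeroˡ (H x)

    neighbourSum-H : ∀ x → neighbourSum k H x ≡ 2k * H x - (2k - 2k * ι N * δ N x)
    neighbourSum-H x = begin
      n                                    ≡⟨ solve 2 (λ s n → n := (s :+ n) :- s) refl (Schrödinger k (δ N) H x) n ⟩
      (Schrödinger k (δ N) H x + n) - Schrödinger k (δ N) H x
        ≡⟨ cong₂ _-_ (trans (Schrödinger+neighbourSum (δ N) H x) (trans (cong (_+ 2k * H x) (δH≡0 x)) (+-identityˡ (2k * H x))))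
             (proj₂ (proj₂ solution) x) ⟩
      2k * H x - (2k - 2k * ι N * δ N x)   ∎
      where
      open ≡-Reasoning
      n = neighbourSum k H x

    neighbourSum-G : ∀ x → neighbourSum k G x ≡ (ι m + 2k) * G x - δ N x
    neighbourSum-G x = begin
      n                                    ≡⟨ solve 2 (λ s n → n := (s :+ n) :- s) refl S n ⟩
      (S + n) - S                          ≡⟨ cong₂ _-_ (trans (Schrödinger+neighbourSum (λ _ → ι m) G x)
                                                (sym (distribʳ (G x) (ι m) 2k))) (G-equation x) ⟩
      (ι m + 2k) * G x - δ N x             ∎
      where
      open ≡-Reasoning
      n = neighbourSum k G x
      S = Schrödinger k (λ _ → ι m) G x

    neighbourhood-X-1 : ∀ x → neighbourhood X (λ _ → 1ℚ) x ≡ 2k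
    neighbourhood-X-1 x = trans (neighbourhood-circulant N k 2k+1≤N x (λ _ → 1ℚ)) (trans (sum-pairs 1ℚ) (*-identityʳ 2k))

    neighbourhood-X : ∀ f t x → IsPeriodic f → neighbourhood X (λ y → f (toℕ y ℕ.+ t)) x ≡ neighbourSum k f (toℕ x ℕ.+ t)
    neighbourhood-X f t x pf = trans (neighbourhood-circulant N k 2k+1≤N x (λ y → f (toℕ y ℕ.+ t)))
      (trans (neighbourSum-cong {extend (λ y → f (toℕ y ℕ.+ t))} {λ y → f (y ℕ.+ t)} unfold (toℕ x))
        (ℚΣ.sum-cong-≗ {k} λ i → cong₂ _+_ (cong f (swap (suc (toℕ i)))) (cong f (swap (N ℕ.∸ suc (toℕ i))))))
      where
      unfold : ∀ y → f (toℕ (y mod N) ℕ.+ t) ≡ f (y ℕ.+ t)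
      unfold y = trans (cong (λ z → f (z ℕ.+ t)) (toℕ-fromℕ< (m%n<n y N)))
        (periodic-% {λ z → f (z ℕ.+ t)} (shift-periodic {f} pf t) y)
      swap : ∀ s → toℕ x ℕ.+ s ℕ.+ t ≡ toℕ x ℕ.+ t ℕ.+ s
      swap s = trans (ℕₚ.+-assoc (toℕ x) s t) (trans (cong (toℕ x ℕ.+_) (ℕₚ.+-comm s t)) (sym (ℕₚ.+-assoc (toℕ x) t s)))

    -- The degree of the regular graph `Y`.
    D : ℚ
    D = 2k + ι m - 1ℚ

    neighbourhood-Y-1 : ∀ u → neighbourhood Y (λ _ → 1ℚ) u ≡ D
    neighbourhood-Y-1 (x , a) = trans (neighbourhood-□ X (complete m) (λ _ → 1ℚ) x a) (trans
      (cong₂ _+_ (neighbourhood-X-1 x) (begin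
        n                    ≡⟨ solve 1 (λ n → n := (n :+ :1) :- :1) refl n ⟩
        (n + 1ℚ) - 1ℚ        ≡⟨ cong (_- 1ℚ) (trans (neighbourhood-complete m (λ _ → 1ℚ) a) (trans (sum-const m 1ℚ) (*-identityʳ (ι m)))) ⟩
        ι m - 1ℚ             ∎))
      (sym (+-assoc 2k (ι m) (- 1ℚ))))
      where
      open ≡-Reasoning
      n = neighbourhood (complete m) (λ _ → 1ℚ) a

    private
      0<2k : 0ℚ < 2k
      0<2k = ι-positive (ℕₚ.≤-trans 1≤k (ℕₚ.m≤m+n k (k ℕ.+ 0)))

      0<D : 0ℚ < D
      0<D = ℚₚ.<-≤-trans 0<2k (p≤q⇐0≤q-p (subst (0ℚ ≤_)
        (solve 2 (λ t m → m :- :1 := (t :+ m :- :1) :- t) refl 2k (ι m))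
        (0≤q-p (subst (_≤ ι m) ι-1 (ι-mono-≤ 1≤m)))))

      positive⇒≢0 : ∀ {d q} → ι d ≡ q → 0ℚ < q → d ≢ 0
      positive⇒≢0 ιd≡q 0<q refl = ℚₚ.<⇒≢ 0<q (trans (sym ι-0) ιd≡q)

    2k≢0 : 2k ≢ 0ℚ
    2k≢0 eq = ℚₚ.<⇒≢ 0<2k (sym eq)

    degree-X : ∀ u → ι (Graph.degree X u) ≡ 2k
    degree-X u = trans (degree≡ X u) (neighbourhood-X-1 u)

    degree-Y : ∀ u → ι (Graph.degree Y u) ≡ D
    degree-Y u = trans (degree≡ Y u) (neighbourhood-Y-1 u)

    module Target (ℓ : ℕ) (ℓ<N : ℓ ℕ.< N) where
      private
        -- Adding N - ℓ represents subtraction of ℓ, which moves the target to 0 modulo N.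
        t = N ℕ.∸ ℓ
        v : Fin N
        v = ℓ mod N

        toℕ-v : toℕ v ≡ ℓ
        toℕ-v = trans (toℕ-fromℕ< (m%n<n ℓ N)) (m<n⇒m%n≡m ℓ<N)

        v+t : toℕ v ℕ.+ t ≡ N
        v+t = trans (cong (ℕ._+ t) toℕ-v) (ℕₚ.m+[n∸m]≡n (ℕₚ.<⇒≤ ℓ<N))

      δ-off-target : ∀ x → x ≢ v → δ N (toℕ x ℕ.+ t) ≡ 0ℚ
      δ-off-target x x≢v = cong (if_then 1ℚ else 0ℚ) (dec-false ((toℕ x ℕ.+ t) % N ℕₚ.≟ 0) nonzero)
        where
        nonzero : (toℕ x ℕ.+ t) % N ≢ 0
        nonzero eq with ℕₚ.<-≤-connex (toℕ x) ℓ
        ... | inj₁ x<ℓ = ℕₚ.<⇒≢ (ℕₚ.≤-trans (ℕₚ.m<n⇒0<n∸m ℓ<N) (ℕₚ.m≤n+m t (toℕ x))) (sym (trans (sym (m<n⇒m%n≡m x+t<N)) eq))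
          where
          x+t<N : toℕ x ℕ.+ t ℕ.< N
          x+t<N = subst (toℕ x ℕ.+ t ℕ.<_) (ℕₚ.m+[n∸m]≡n (ℕₚ.<⇒≤ ℓ<N)) (ℕₚ.+-monoˡ-< t x<ℓ)
        ... | inj₂ ℓ≤x = x≢v (toℕ-injective (trans (ℕₚ.≤-antisym (ℕₚ.m∸n≡0⇒m≤n x∸ℓ≡0) ℓ≤x) (sym toℕ-v)))
          where
          x+t : toℕ x ℕ.+ t ≡ toℕ x ℕ.∸ ℓ ℕ.+ N
          x+t = trans (sym (ℕₚ.+-∸-assoc (toℕ x) (ℕₚ.<⇒≤ ℓ<N))) (ℕₚ.+-∸-comm N ℓ≤x)
          x∸ℓ≡0 : toℕ x ℕ.∸ ℓ ≡ 0
          x∸ℓ≡0 = trans (sym (m<n⇒m%n≡m (ℕₚ.≤-<-trans (ℕₚ.m∸n≤m (toℕ x) ℓ) (toℕ<n x))))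
            (trans (sym ([m+n]%n≡m%n (toℕ x ℕ.∸ ℓ) N)) (trans (cong (_% N) (sym x+t)) eq))

      hX : Fin N → ℚ
      hX x = H (toℕ x ℕ.+ t)

      hX-v : hX v ≡ 0ℚ
      hX-v = trans (cong H v+t) (trans (H-periodic 0) H0≡0)

      hittingTime-X : ∀ x → ExpectedHittingTime X x v (hX x)
      hittingTime-X = harmonic⇒hittingTime X v (λ u → positive⇒≢0 (degree-X u) 0<2k) hX hX-v λ x x≢v → begin
        ι (Graph.degree X x) * hX x               ≡⟨ cong (_* hX x) (degree-X x) ⟩
        2k * hX x                                 ≡⟨ solve 3 (λ t h n → t :* h := t :+ (t :* h :- (t :- t :* n :* :0))) refl 2k (hX x) (ι N) ⟩
        2k + (2k * hX x - (2k - 2k * ι N * 0ℚ))   ≡⟨ cong (λ z → 2k + (2k * hX x - (2k - 2k * ι N * z))) (δ-off-target x x≢v) ⟨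
        2k + (2k * hX x - (2k - 2k * ι N * δ N (toℕ x ℕ.+ t)))
          ≡⟨ cong₂ _+_ (sym (degree-X x)) (sym (trans (neighbourhood-X H t x H-periodic) (neighbourSum-H (toℕ x ℕ.+ t)))) ⟩
        ι (Graph.degree X x) + neighbourhood X hX x ∎
        where open ≡-Reasoning

      module _ (b : Fin m) where
        Δ : Fin m → ℚ
        Δ a = if does (a ≟ᶠ b) then 1ℚ else 0ℚ

        -- With δ the point mass at ℓ, the source D(1 - N m δ Δ) equals D(1 - N δ) - D N (m Δ - 1)
        -- δ. The factor α rescales H from degree 2k to the first part, `γ` is the coefficient of G
        -- for the second, and β is the free additive constant, fixed by vanishing at the target.
        α β : ℚ
        α = D * recipℚ 2k 2k≢0
        β = D * ι N * ((ι m - 1ℚ) * G 0)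

        γ : Fin m → ℚ
        γ a = - (D * ι N * (ι m * Δ a - 1ℚ))

        hY : Fin N × Fin m → ℚ
        hY (x , a) = α * H (toℕ x ℕ.+ t) + β + γ a * G (toℕ x ℕ.+ t)

        private
          sum-Δ : sum Δ ≡ 1ℚ
          sum-Δ = trans (ℚΣ.sum-cong-≗ {m} λ a → cong (if_then 1ℚ else 0ℚ) (does-sym a (a ≟ᶠ b) (b ≟ᶠ a))) (sum-indicator b (λ _ → 1ℚ))
            where
            does-sym : ∀ a (d : Dec (a ≡ b)) (d′ : Dec (b ≡ a)) → does d ≡ does d′
            does-sym a (yes _)   (yes _)   = refl
            does-sym a (yes a≡b) (no b≢a)  = contradiction (sym a≡b) b≢a
            does-sym a (no a≢b)  (yes b≡a) = contradiction (sym b≡a) a≢b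
            does-sym a (no _)    (no _)    = refl

          Δ-b : Δ b ≡ 1ℚ
          Δ-b = cong (if_then 1ℚ else 0ℚ) (dec-true (b ≟ᶠ b) refl)

          sum-γ : sum γ ≡ 0ℚ
          sum-γ = begin
            sum γ
              ≡⟨ ℚΣ.sum-cong-≗ {m} (λ a → solve 4 (λ d n m δ → :- (d :* n :* (m :* δ :- :1)) := (:- (d :* n :* m)) :* δ :+ d :* n) refl D (ι N) (ι m) (Δ a)) ⟩
            sum {m} (λ a → - (D * ι N * ι m) * Δ a + D * ι N)
              ≡⟨ ℚΣ.∑-distrib-+ {m} (λ a → - (D * ι N * ι m) * Δ a) (λ _ → D * ι N) ⟩
            sum {m} (λ a → - (D * ι N * ι m) * Δ a) + sum {m} (λ _ → D * ι N)
              ≡⟨ cong₂ _+_ (trans (sym (ℚΣ.*-distribˡ-sum {m} (- (D * ι N * ι m)) Δ)) (cong (- (D * ι N * ι m) *_) sum-Δ)) (sum-const m (D * ι N)) ⟩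
            - (D * ι N * ι m) * 1ℚ + ι m * (D * ι N)
              ≡⟨ solve 3 (λ d n m → :- (d :* n :* m) :* :1 :+ m :* (d :* n) := :0) refl D (ι N) (ι m) ⟩
            0ℚ ∎
            where open ≡-Reasoning

          sum-hY : ∀ x → sum {m} (λ a → hY (x , a)) ≡ ι m * (α * H (toℕ x ℕ.+ t) + β)
          sum-hY x = trans (ℚΣ.∑-distrib-+ {m} (λ _ → α * H y + β) (λ a → γ a * G y))
            (trans (cong₂ _+_ (sum-const m (α * H y + β)) (trans (sym (ℚΣ.*-distribʳ-sum {m} (G y) γ))
              (trans (cong (_* G y) sum-γ) (zeroˡ (G y))))) (+-identityʳ _))
            where y = toℕ x ℕ.+ t

          α*2k : α * 2k ≡ D
          α*2k = trans (*-assoc D (recipℚ 2k 2k≢0) 2k) (trans (cong (D *_) (*-inverseˡ 2k 2k≢0)) (*-identityʳ D))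

        hY-v : hY (v , b) ≡ 0ℚ
        hY-v = begin
          α * H (toℕ v ℕ.+ t) + β + γ b * G (toℕ v ℕ.+ t)
            ≡⟨ cong₂ (λ h g → α * h + β + γ b * g) hX-v (trans (cong G v+t) (G-periodic 0)) ⟩
          α * 0ℚ + β + γ b * G 0
            ≡⟨ cong (λ z → α * 0ℚ + β + - (D * ι N * (ι m * z - 1ℚ)) * G 0) Δ-b ⟩
          α * 0ℚ + β + - (D * ι N * (ι m * 1ℚ - 1ℚ)) * G 0
            ≡⟨ solve 5 (λ α d n m g → α :* :0 :+ d :* n :* ((m :- :1) :* g) :+ (:- (d :* n :* (m :* :1 :- :1))) :* g := :0)
                 refl α D (ι N) (ι m) (G 0) ⟩
          0ℚ ∎
          where open ≡-Reasoning

        private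
          δΔ≡0 : ∀ x a → (x , a) ≢ (v , b) → δ N (toℕ x ℕ.+ t) * Δ a ≡ 0ℚ
          δΔ≡0 x a ne = by-cases (a ≟ᶠ b)
            where
            by-cases : (d : Dec (a ≡ b)) → δ N (toℕ x ℕ.+ t) * (if does d then 1ℚ else 0ℚ) ≡ 0ℚ
            by-cases (yes a≡b) = trans (cong (_* 1ℚ) (δ-off-target x λ x≡v → ne (cong₂ _,_ x≡v a≡b))) (zeroˡ 1ℚ)
            by-cases (no _)    = zeroʳ (δ N (toℕ x ℕ.+ t))

          neighbourhood-hY : ∀ x a → neighbourhood Y hY (x , a) ≡
            (α * neighbourSum k H (toℕ x ℕ.+ t) + 2k * β + γ a * neighbourSum k G (toℕ x ℕ.+ t)) +
            (ι m * (α * H (toℕ x ℕ.+ t) + β) - hY (x , a))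
          neighbourhood-hY x a = trans (neighbourhood-□ X (complete m) hY x a) (cong₂ _+_
            (trans (neighbourhood-X (λ y → α * H y + β + γ a * G y) t x
                (λ y → cong₂ (λ h g → α * h + β + γ a * g) (H-periodic y) (G-periodic y)))
              (neighbourSum-affine α β (γ a) H G (toℕ x ℕ.+ t)))
            (trans (solve 2 (λ n h → n := (n :+ h) :- h) refl (neighbourhood (complete m) (λ c → hY (x , c)) a) (hY (x , a)))
              (cong (_- hY (x , a)) (trans (neighbourhood-complete m (λ c → hY (x , c)) a) (sum-hY x)))))

        hittingTime-Y : ∀ u → ExpectedHittingTime Y u (v , b) (hY u)
        hittingTime-Y = harmonic⇒hittingTime Y (v , b) (λ u → positive⇒≢0 (degree-Y u) 0<D) hY hY-v
          λ { (x , a) ne → harmonic x a ne }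
          where
          open ≡-Reasoning
          harmonic : ∀ x a → (x , a) ≢ (v , b) → ι (Graph.degree Y (x , a)) * hY (x , a) ≡
            ι (Graph.degree Y (x , a)) + neighbourhood Y hY (x , a)
          harmonic x a ne = sym (begin
            ι (Graph.degree Y (x , a)) + neighbourhood Y hY (x , a)
              ≡⟨ cong₂ _+_ (degree-Y (x , a)) (trans (neighbourhood-hY x a)
                   (cong₂ (λ p q → (α * p + 2k * β + γ a * q) + (ι m * (α * h + β) - hY (x , a))) (neighbourSum-H y) (neighbourSum-G y))) ⟩
            D + ((α * (2k * h - (2k - 2k * ι N * d)) + 2k * β + γ a * ((ι m + 2k) * g - d)) + (ι m * (α * h + β) - (α * h + β + γ a * g)))
              -- The error terms are multiples of D - 2kα, zero by the choice of α, and one multiple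
              -- of δ Δ, which lives at the target alone.
              ≡⟨ solve 10 (λ D α β t n d h g m e →
                   D :+ ((α :* (t :* h :- (t :- t :* n :* d)) :+ t :* β :+ (:- (D :* n :* (m :* e :- :1))) :* ((m :+ t) :* g :- d)) :+
                     (m :* (α :* h :+ β) :- (α :* h :+ β :+ (:- (D :* n :* (m :* e :- :1))) :* g))) :=
                   (t :+ m :- :1) :* (α :* h :+ β :+ (:- (D :* n :* (m :* e :- :1))) :* g) :+
                     (D :- α :* t) :+ (α :* t :- D) :* (n :* d) :+ D :* n :* m :* (d :* e))
                   refl D α β 2k (ι N) d h g (ι m) (Δ a) ⟩
            D * hY (x , a) + (D - α * 2k) + (α * 2k - D) * (ι N * d) + D * ι N * ι m * (d * Δ a)
              ≡⟨ cong₂ (λ z w → D * hY (x , a) + (D - z) + (z - D) * (ι N * d) + D * ι N * ι m * w) α*2k (δΔ≡0 x a ne) ⟩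
            D * hY (x , a) + (D - D) + (D - D) * (ι N * d) + D * ι N * ι m * 0ℚ
              ≡⟨ solve 5 (λ p D n d m → p :+ (D :- D) :+ (D :- D) :* (n :* d) :+ D :* n :* m :* :0 := p) refl (D * hY (x , a)) D (ι N) d (ι m) ⟩
            D * hY (x , a)
              ≡⟨ cong (_* hY (x , a)) (degree-Y (x , a)) ⟨
            ι (Graph.degree Y (x , a)) * hY (x , a) ∎)
            where
            y = toℕ x ℕ.+ t
            d = δ N y
            h = H y
            g = G y

-- Translation of the rational hitting times into the closed formulas over the field.

module Formula where

  open IntegerSolver
  open Fields
  open RationalEmbedding
  open GreenFunctions using (δ; module Green)
  open PolynomialIdentities
  open ChebyshevIdentities
  open Denominators
  open SpectralGreenFunctions
  open import Algebra.Apartness.Bundles using (HeytingField)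
  open import Algebra.Bundles using (CommutativeRing)
  import Algebra.Properties.Semiring.Exp
  import Algebra.Properties.Semiring.Mult
  import Algebra.Properties.Semiring.Sum
  open import Data.Bool.Base using (true; false; if_then_else_)
  open import Data.Fin.Base using (Fin; zero; suc; toℕ)
  open import Data.Fin.Properties using (toℕ-fromℕ<) renaming (_≟_ to _≟ᶠ_)
  open import Data.Nat.Base as ℕ
    using (ℕ; zero; suc; NonZero; _≤_; _<_; z≤n; s≤s) renaming (_+_ to _+ℕ_; _*_ to _*ℕ_)
  open import Data.Nat.DivMod using (_mod_; _%_; m<n⇒m%n≡m; m%n<n; n%n≡0)
  open import Data.Nat.Properties using (m*n≢0)
  import Data.Nat.Properties as ℕₚ
  open import Data.Product.Base using (_,_)
  open import Data.Rational.Base using (0ℚ; 1ℚ)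
  open import Function.Base using (_∘_)
  import Relation.Binary.PropositionalEquality as ≡

  open ≡ using (_≡_)
  import Relation.Binary.Reasoning.Setoid
  open import Relation.Nullary.Decidable using (does; dec-true)

  module HittingTimeFormula {c ℓ₁ ℓ₂} (K : HeytingField c ℓ₁ ℓ₂) (char0 : CharacteristicZero K) where
    open FieldProperties K
    open CommutativeRing commutativeRing hiding (zero)
    open HeytingField K using (_#_)
    open OverField K char0
    open Chebyshev K char0
    open FromRational K char0
    open Nonvanishing K char0
    open GreenOverField K char0 using (module Spectral)
    open Algebra.Properties.Semiring.Sum semiring
    open Algebra.Properties.Semiring.Exp semiring
    open Algebra.Properties.Semiring.Mult semiring using (×-homo-+)
    open IntegerCoefficients commutativeRing using (module Solver)
    open Solver using (solve; _:=_; _:+_; _:*_; _:-_; :-_; :1)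
    open Relation.Binary.Reasoning.Setoid setoid

    private F = Carrier

    2k+1≤N⇒k≤N : ∀ {k N} → 2 *ℕ k +ℕ 1 ≤ N → k ≤ N
    2k+1≤N⇒k≤N {k} = ℕₚ.≤-trans (ℕₚ.≤-trans (ℕₚ.m≤m+n k (k +ℕ 0)) (ℕₚ.m≤m+n (2 *ℕ k) 1))

    module _ (N n m : ℕ) .{{_ : NonZero N}} (2k+1≤N : 2 *ℕ suc n +ℕ 1 ≤ N) (2≤m : 2 ≤ m)
      (simple : AllRootsSimple (suc n) ⟦ m ⟧) (roots : Roots (suc n) ⟦ m ⟧) where

      private
        k≤N : suc n ≤ N
        k≤N = 2k+1≤N⇒k≤N 2k+1≤N
        1≤m : 1 ≤ m
        1≤m = ℕₚ.≤-trans (s≤s z≤n) 2≤m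

      open RootData N n m k≤N 1≤m roots simple
      module GF = Spectral N n m k≤N 1≤m roots simple
      open GF using (u; ũ; den; w; i; g; g≈G)
      module HT = RationalHittingTimes.HittingTimes N k m (s≤s z≤n) 1≤m 2k+1≤N k≤N
      open GF.Gℚ using (G)
      open Sums N denominatorsNonzero using (𝒢; 𝒜; correction) renaming (δ to δF)

      d 2k : F
      d  = ⟦ 2 *ℕ k +ℕ m ⟧ - 1#
      2k = ⟦ 2 *ℕ k ⟧

      2k#0 : 2k # 0#
      2k#0 = char0 (2 *ℕ k) {{m*n≢0 2 k}}

      fromℚ-D : fromℚ HT.D ≈ d
      fromℚ-D = trans (fromℚ-+ (HT.2k Opaque.+ Opaque.ι m) (Opaque.- 1ℚ)) (+-cong
        (trans (fromℚ-+ HT.2k (Opaque.ι m)) (trans (+-cong (fromℚ-ι (2 *ℕ k)) (fromℚ-ι m)) (sym (×-homo-+ 1# (2 *ℕ k) m))))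
        (trans (fromℚ-neg 1ℚ) (-‿cong fromℚ-1)))

      -- The factor - 2 undoes the normalisation - 1/2 in `g`, and N is the numerator factor of 𝒢.
      sum-𝒢 : ∀ ℓ → ℓ < N → sum (λ c → 𝒢 c ℓ * w c) ≈ - (⟦ 2 ⟧ * ⟦ N ⟧) * g ℓ
      sum-𝒢 ℓ ℓ<N = sym (begin
        - (⟦ 2 ⟧ * ⟦ N ⟧) * g ℓ
          ≈⟨ *-distribˡ-sum {k} (- (⟦ 2 ⟧ * ⟦ N ⟧)) (λ c → - (half * (w c * i c)) * ũ c ℓ) ⟩
        sum {k} (λ c → - (⟦ 2 ⟧ * ⟦ N ⟧) * (- (half * (w c * i c)) * ũ c ℓ))
          ≈⟨ sum-cong-≋ {k} (λ c → begin
               - (⟦ 2 ⟧ * ⟦ N ⟧) * (- (half * (w c * i c)) * ũ c ℓ)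
                 ≈⟨ solve 6 (λ t N h w i u → :- (t :* N) :* (:- (h :* (w :* i)) :* u) := (h :* t) :* (N :* u :* i :* w))
                      refl ⟦ 2 ⟧ ⟦ N ⟧ half (w c) (i c) (ũ c ℓ) ⟩
               (half * ⟦ 2 ⟧) * (⟦ N ⟧ * ũ c ℓ * i c * w c)
                 ≈⟨ trans (*-congʳ half*2) (*-identityˡ _) ⟩
               ⟦ N ⟧ * ũ c ℓ * i c * w c
                 ≡⟨ ≡.cong (λ x → ⟦ N ⟧ * u c x * i c * w c) (m<n⇒m%n≡m ℓ<N) ⟩
               𝒢 c ℓ * w c ∎) ⟩
        sum {k} (λ c → 𝒢 c ℓ * w c) ∎)

      correction≈ : ∀ (a b : Fin m) ℓ → ℓ < N → correction a b ℓ ≈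
        - (⟦ 2 ⟧ * ⟦ N ⟧) * ((⟦ m ⟧ - 1#) * g 0 - (⟦ m ⟧ * δF a b - 1#) * g ℓ)
      correction≈ a b ℓ ℓ<N = begin
        sum {k} (λ c → (p * 𝒢 c 0 - q * 𝒢 c ℓ) * w c)
          ≈⟨ sum-cong-≋ {k} (λ c → solve 5 (λ p q x y w → (p :* x :- q :* y) :* w := p :* (x :* w) :+ (:- q) :* (y :* w))
               refl p q (𝒢 c 0) (𝒢 c ℓ) (w c)) ⟩
        sum {k} (λ c → p * (𝒢 c 0 * w c) + - q * (𝒢 c ℓ * w c))
          ≈⟨ trans (∑-distrib-+ {k} (λ c → p * (𝒢 c 0 * w c)) (λ c → - q * (𝒢 c ℓ * w c)))
               (+-cong (sym (*-distribˡ-sum {k} p (λ c → 𝒢 c 0 * w c))) (sym (*-distribˡ-sum {k} (- q) (λ c → 𝒢 c ℓ * w c)))) ⟩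
        p * sum {k} (λ c → 𝒢 c 0 * w c) + - q * sum {k} (λ c → 𝒢 c ℓ * w c)
          ≈⟨ +-cong (*-congˡ (sum-𝒢 0 (ℕ.>-nonZero⁻¹ N))) (*-congˡ (sum-𝒢 ℓ ℓ<N)) ⟩
        p * (- (⟦ 2 ⟧ * ⟦ N ⟧) * g 0) + - q * (- (⟦ 2 ⟧ * ⟦ N ⟧) * g ℓ)
          ≈⟨ solve 5 (λ p q t x y → p :* (:- t :* x) :+ :- q :* (:- t :* y) := :- t :* (p :* x :- q :* y)) refl p q (⟦ 2 ⟧ * ⟦ N ⟧) (g 0) (g ℓ) ⟩
        - (⟦ 2 ⟧ * ⟦ N ⟧) * (p * g 0 - q * g ℓ) ∎
        where
        p = ⟦ m ⟧ - 1#
        q = ⟦ m ⟧ * δF a b - 1#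

      -- The walk starts at 0, so G is evaluated at 0 - ℓ, represented by N - ℓ, while the formula
      -- has ℓ. The powers of ρ are symmetric under this reflection; ℓ = 0 is separate because N
      -- reduces to 0.
      g-reflect : ∀ ℓ → ℓ < N → g (N ℕ.∸ ℓ) ≈ g ℓ
      g-reflect ℓ ℓ<N = sum-cong-≋ {k} λ c → *-congˡ {x = - (half * (w c * i c))} (ũ-reflect c ℓ ℓ<N)
        where
        ũ-reflect : ∀ c ℓ → ℓ < N → ũ c (N ℕ.∸ ℓ) ≈ ũ c ℓ
        ũ-reflect c zero    ℓ<N = reflexive (≡.cong (u c) (≡.trans (n%n≡0 N) (≡.sym (m<n⇒m%n≡m ℓ<N))))
        ũ-reflect c ℓ@(suc _) ℓ<N = begin
          u c ((N ℕ.∸ ℓ) % N)                             ≡⟨ ≡.cong (u c) (m<n⇒m%n≡m (ℕₚ.∸-monoʳ-< {N} {ℓ} {0} (s≤s z≤n) (ℕₚ.<⇒≤ ℓ<N))) ⟩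
          ρ c ^ (N ℕ.∸ ℓ) + ρ c ^ (N ℕ.∸ (N ℕ.∸ ℓ))       ≡⟨ ≡.cong (λ x → ρ c ^ (N ℕ.∸ ℓ) + ρ c ^ x) (ℕₚ.m∸[m∸n]≡n (ℕₚ.<⇒≤ ℓ<N)) ⟩
          ρ c ^ (N ℕ.∸ ℓ) + ρ c ^ ℓ                       ≈⟨ +-comm _ _ ⟩
          u c ℓ                                           ≡⟨ ≡.cong (u c) (m<n⇒m%n≡m ℓ<N) ⟨
          ũ c ℓ                                           ∎

      -- The numerator factors as (ρ^ℓ - 1)(ρ^(N - ℓ) - 1), and `η^V` turns each factor into a value
      -- of V. Their powers of η combine to η^N, which with one factor η - η⁻¹ and V_N rebuilds ρ^N
      -- - 1; the other factor η - η⁻¹ joins γ to give ρ - ρ⁻¹.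
      𝒜-term : ∀ c ℓ → ℓ < N → (𝒢 c 0 - 𝒢 c ℓ) * w c ≈
        ⟦ N ⟧ * (1# / (γ c * D′φ c) [ γD′φ#0 c ] *
          (V c ℓ * V c (N ℕ.∸ ℓ) / V c N [ V#0 c ]))
      -- `D′φ c` enters the common denominator twice, because one side inverts it alone and the
      -- other inverts its product with `γ c`.
      𝒜-term c ℓ ℓ<N = *-cancelʳ-#0 scale#0 (begin
        (⟦ N ⟧ * (1# + ρ c ^ N) * i c - ⟦ N ⟧ * (L + L′) * i c) * w c * (den c * D′φ c * (γ c * D′φ c) * V c N)
          ≈⟨ solve 10 (λ N Z L L′ i w d D γ V →
               (N :* (:1 :+ Z) :* i :- N :* (L :+ L′) :* i) :* w :* (d :* D :* (γ :* D) :* V) :=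
               (i :* d) :* (w :* D) :* (N :* (:1 :+ Z :- (L :+ L′)) :* (γ :* D) :* V))
               refl ⟦ N ⟧ (ρ c ^ N) L L′ (i c) (w c) (den c) (D′φ c) (γ c) (V c N) ⟩
        (i c * den c) * (w c * D′φ c) * (⟦ N ⟧ * (1# + ρ c ^ N - (L + L′)) * (γ c * D′φ c) * V c N)
          ≈⟨ trans (*-congʳ (trans (*-cong (inverseˡ (den c) (𝒢-den#0 c)) (inverseˡ (D′φ c) (D′φ#0 c))) (*-identityˡ 1#))) (*-identityˡ _) ⟩
        ⟦ N ⟧ * (1# + ρ c ^ N - (L + L′)) * (γ c * D′φ c) * V c N
          ≈⟨ *-congʳ (*-congʳ (*-congˡ factored)) ⟩
        ⟦ N ⟧ * ((η c ^ ℓ * e * V c ℓ) * (η c ^ (N ℕ.∸ ℓ) * e * V c (N ℕ.∸ ℓ))) * (γ c * D′φ c) * V c N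
          ≈⟨ solve 9 (λ N p q e v v′ γ D V → N :* ((p :* e :* v) :* (q :* e :* v′)) :* (γ :* D) :* V :=
               N :* (v :* v′) :* D :* ((e :* γ) :* ((p :* q) :* e :* V)))
               refl ⟦ N ⟧ (η c ^ ℓ) (η c ^ (N ℕ.∸ ℓ)) e (V c ℓ) (V c (N ℕ.∸ ℓ)) (γ c) (D′φ c) (V c N) ⟩
        ⟦ N ⟧ * (V c ℓ * V c (N ℕ.∸ ℓ)) * D′φ c * ((e * γ c) * ((η c ^ ℓ * η c ^ (N ℕ.∸ ℓ)) * e * V c N))
          ≈⟨ *-congˡ (*-cong eγ (trans (*-congʳ (*-congʳ η^ℓη^N-ℓ)) (η^V c N))) ⟩
        ⟦ N ⟧ * (V c ℓ * V c (N ℕ.∸ ℓ)) * D′φ c * den c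
          ≈⟨ *-congʳ (*-congʳ (trans (*-congˡ (trans (*-cong (inverseˡ (γ c * D′φ c) (γD′φ#0 c)) (inverseˡ (V c N) (V#0 c))) (*-identityˡ 1#))) (*-identityʳ _))) ⟨
        ⟦ N ⟧ * (V c ℓ * V c (N ℕ.∸ ℓ)) * ((j * (γ c * D′φ c)) * (v̄ * V c N)) * D′φ c * den c
          ≈⟨ solve 8 (λ N x j y v V D d → N :* x :* ((j :* y) :* (v :* V)) :* D :* d :=
               N :* (:1 :* j :* (x :* v)) :* (d :* D :* y :* V))
               refl ⟦ N ⟧ (V c ℓ * V c (N ℕ.∸ ℓ)) j (γ c * D′φ c) v̄ (V c N) (D′φ c) (den c) ⟩
        ⟦ N ⟧ * (1# * j * (V c ℓ * V c (N ℕ.∸ ℓ) * v̄)) * (den c * D′φ c * (γ c * D′φ c) * V c N) ∎)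
        where
        j = inverse (γ c * D′φ c) (γD′φ#0 c)
        v̄ = inverse (V c N) (V#0 c)
        L = ρ c ^ ℓ
        L′ = ρ c ^ (N ℕ.∸ ℓ)
        e = η c - η⁻¹ c
        scale#0 : (den c * D′φ c * (γ c * D′φ c) * V c N) # 0#
        scale#0 = #0-* (#0-* (#0-* (𝒢-den#0 c) (D′φ#0 c)) (γD′φ#0 c)) (V#0 c)
        ℓ+[N-ℓ] : ℓ +ℕ (N ℕ.∸ ℓ) ≡ N
        ℓ+[N-ℓ] = ℕₚ.m+[n∸m]≡n (ℕₚ.<⇒≤ ℓ<N)
        η^ℓη^N-ℓ : η c ^ ℓ * η c ^ (N ℕ.∸ ℓ) ≈ η c ^ N
        η^ℓη^N-ℓ = trans (sym (^-homo-* (η c) ℓ (N ℕ.∸ ℓ))) (^-congʳ (η c) ℓ+[N-ℓ])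
        factored : 1# + ρ c ^ N - (L + L′) ≈ (η c ^ ℓ * e * V c ℓ) * (η c ^ (N ℕ.∸ ℓ) * e * V c (N ℕ.∸ ℓ))
        factored = begin
          1# + ρ c ^ N - (L + L′)      ≈⟨ +-congʳ (+-congˡ (trans (^-congʳ (ρ c) (≡.sym ℓ+[N-ℓ])) (^-homo-* (ρ c) ℓ (N ℕ.∸ ℓ)))) ⟩
          1# + L * L′ - (L + L′)       ≈⟨ solve 2 (λ x y → :1 :+ x :* y :- (x :+ y) := (x :- :1) :* (y :- :1)) refl L L′ ⟩
          (L - 1#) * (L′ - 1#)         ≈⟨ *-cong (η^V c ℓ) (η^V c (N ℕ.∸ ℓ)) ⟨
          _                            ∎
        η⁻²≈ρ⁻¹ : η⁻¹ c * η⁻¹ c ≈ ρ⁻¹ c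
        η⁻²≈ρ⁻¹ = inverse-unique (ρ#0 c) (begin
          η⁻¹ c * η⁻¹ c * ρ c               ≈⟨ *-congˡ (trans (ρ≈η² c) (*-congˡ (*-identityʳ (η c)))) ⟩
          η⁻¹ c * η⁻¹ c * (η c * η c)       ≈⟨ solve 2 (λ x y → y :* y :* (x :* x) := (x :* y) :* (x :* y)) refl (η c) (η⁻¹ c) ⟩
          (η c * η⁻¹ c) * (η c * η⁻¹ c)     ≈⟨ *-cong (ηη⁻¹ c) (ηη⁻¹ c) ⟩
          1# * 1#                           ≈⟨ *-identityˡ 1# ⟩
          1#                                ∎)
        eγ : e * γ c ≈ ρ c - ρ⁻¹ c
        eγ = begin
          (η c - η⁻¹ c) * (η c + η⁻¹ c)     ≈⟨ solve 2 (λ x y → (x :- y) :* (x :+ y) := x :* (x :* :1) :- y :* y) refl (η c) (η⁻¹ c) ⟩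
          η c ^ 2 - η⁻¹ c * η⁻¹ c           ≈⟨ +-cong (sym (ρ≈η² c)) (-‿cong η⁻²≈ρ⁻¹) ⟩
          ρ c - ρ⁻¹ c                       ∎

      δ-diagonal : ∀ (a : Fin m) → δF a a ≈ 1#
      δ-diagonal a = reflexive (≡.cong (if_then 1# else 0#) (dec-true (a ≟ᶠ a) ≡.refl))

      -- On the diagonal both coefficients equal m - 1, so each summand is a multiple of 𝒢(0) -
      -- 𝒢(ℓ).
      correction-diagonal : ∀ (a : Fin m) ℓ → ℓ < N → correction a a ℓ ≈ (⟦ m ⟧ - 1#) * (⟦ N ⟧ * 𝒜 ℓ)
      correction-diagonal a ℓ ℓ<N = begin
        sum {k} (λ c → ((⟦ m ⟧ - 1#) * 𝒢 c 0 - (⟦ m ⟧ * δF a a - 1#) * 𝒢 c ℓ) * w c)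
          ≈⟨ sum-cong-≋ {k} (λ c → trans (*-congʳ (+-congˡ (-‿cong (*-congʳ (+-congʳ (trans (*-congˡ (δ-diagonal a)) (*-identityʳ ⟦ m ⟧)))))))
               (trans (solve 4 (λ p x y w → (p :* x :- p :* y) :* w := p :* ((x :- y) :* w)) refl (⟦ m ⟧ - 1#) (𝒢 c 0) (𝒢 c ℓ) (w c))
                 (*-congˡ (𝒜-term c ℓ ℓ<N)))) ⟩
        sum {k} (λ c → (⟦ m ⟧ - 1#) * (⟦ N ⟧ * A c))
          ≈⟨ *-distribˡ-sum {k} (⟦ m ⟧ - 1#) (λ c → ⟦ N ⟧ * A c) ⟨
        (⟦ m ⟧ - 1#) * sum {k} (λ c → ⟦ N ⟧ * A c)
          ≈⟨ *-congˡ (*-distribˡ-sum {k} ⟦ N ⟧ A) ⟨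
        (⟦ m ⟧ - 1#) * (⟦ N ⟧ * 𝒜 ℓ) ∎
        where
        A : Fin k → F
        A c = 1# / (γ c * D′φ c) [ γD′φ#0 c ] *
          (V c ℓ * V c (N ℕ.∸ ℓ) / V c N [ V#0 c ])

      module _ (ℓ : ℕ) (ℓ<N : ℓ < N) (a b : Fin m) where
        open HT.Target ℓ ℓ<N

        private
          x₀ : Fin N
          x₀ = 0 mod N

          toℕ-x₀ : toℕ x₀ +ℕ (N ℕ.∸ ℓ) ≡ N ℕ.∸ ℓ
          toℕ-x₀ = ≡.cong (_+ℕ (N ℕ.∸ ℓ)) (≡.trans (toℕ-fromℕ< (m%n<n 0 N)) (m<n⇒m%n≡m (ℕ.>-nonZero⁻¹ N)))

          fromℚ-Δ : fromℚ (Δ b a) ≈ δF a b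
          fromℚ-Δ = fromℚ-if (does (a ≟ᶠ b))
            where
            fromℚ-if : ∀ t → fromℚ (if t then 1ℚ else 0ℚ) ≈ (if t then 1# else 0#)
            fromℚ-if true  = fromℚ-1
            fromℚ-if false = fromℚ-0

          fromℚ-α : fromℚ (α b) ≈ d * inverse 2k 2k#0
          fromℚ-α = trans (fromℚ-* HT.D (Opaque.recipℚ HT.2k HT.2k≢0)) (*-cong fromℚ-D (inverse-unique 2k#0
            (trans (*-congˡ (sym (fromℚ-ι (2 *ℕ k)))) (trans (sym (fromℚ-* (Opaque.recipℚ HT.2k HT.2k≢0) HT.2k))
              (trans (reflexive (≡.cong fromℚ (Opaque.*-inverseˡ HT.2k HT.2k≢0))) fromℚ-1)))))

          fromℚ-m-1 : fromℚ (Opaque.ι m Opaque.- 1ℚ) ≈ ⟦ m ⟧ - 1#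
          fromℚ-m-1 = trans (fromℚ-+ (Opaque.ι m) (Opaque.- 1ℚ)) (+-cong (fromℚ-ι m) (trans (fromℚ-neg 1ℚ) (-‿cong fromℚ-1)))

          fromℚ-DN : fromℚ (HT.D Opaque.* Opaque.ι N) ≈ d * ⟦ N ⟧
          fromℚ-DN = trans (fromℚ-* HT.D (Opaque.ι N)) (*-cong fromℚ-D (fromℚ-ι N))

          fromℚ-β : fromℚ (β b) ≈ d * ⟦ N ⟧ * ((⟦ m ⟧ - 1#) * g 0)
          fromℚ-β = trans (fromℚ-* (HT.D Opaque.* Opaque.ι N) ((Opaque.ι m Opaque.- 1ℚ) Opaque.* G 0)) (*-cong fromℚ-DN
            (trans (fromℚ-* (Opaque.ι m Opaque.- 1ℚ) (G 0)) (*-cong fromℚ-m-1 (sym (g≈G 0)))))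

          fromℚ-γ : fromℚ (HT.Target.γ ℓ ℓ<N b a) ≈ - (d * ⟦ N ⟧ * (⟦ m ⟧ * δF a b - 1#))
          fromℚ-γ = trans (fromℚ-neg (HT.D Opaque.* Opaque.ι N Opaque.* (Opaque.ι m Opaque.* Δ b a Opaque.- 1ℚ))) (-‿cong
            (trans (fromℚ-* (HT.D Opaque.* Opaque.ι N) (Opaque.ι m Opaque.* Δ b a Opaque.- 1ℚ)) (*-cong fromℚ-DN
              (trans (fromℚ-+ (Opaque.ι m Opaque.* Δ b a) (Opaque.- 1ℚ)) (+-cong
                (trans (fromℚ-* (Opaque.ι m) (Δ b a)) (*-cong (fromℚ-ι m) fromℚ-Δ))
                (trans (fromℚ-neg 1ℚ) (-‿cong fromℚ-1)))))))

          fromℚ-G : fromℚ (G (toℕ x₀ +ℕ (N ℕ.∸ ℓ))) ≈ g ℓ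
          fromℚ-G = trans (reflexive (≡.cong (fromℚ ∘ G) toℕ-x₀)) (trans (sym (g≈G (N ℕ.∸ ℓ))) (g-reflect ℓ ℓ<N))

        formula : fromℚ (hY b (x₀ , a)) ≈ d / 2k [ 2k#0 ] * fromℚ (hX x₀) - d / ⟦ 2 ⟧ [ char0 2 ] * correction a b ℓ
        formula = begin
          fromℚ (hY b (x₀ , a))
            ≈⟨ trans (fromℚ-+ (α b Opaque.* h Opaque.+ β b) (c₀ Opaque.* y)) (+-cong
                 (trans (fromℚ-+ (α b Opaque.* h) (β b)) (+-cong (trans (fromℚ-* (α b) h) (*-congʳ fromℚ-α)) fromℚ-β))
                 (trans (fromℚ-* c₀ y) (*-cong fromℚ-γ fromℚ-G))) ⟩
          d * inverse 2k 2k#0 * fromℚ h + d * ⟦ N ⟧ * (p * g 0) + - (d * ⟦ N ⟧ * q) * g ℓ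
            ≈⟨ solve 7 (λ x d N p q s t → x :+ d :* N :* (p :* s) :+ :- (d :* N :* q) :* t := x :+ :1 :* (d :* N :* (p :* s :- q :* t)))
                 refl (d * inverse 2k 2k#0 * fromℚ h) d ⟦ N ⟧ p q (g 0) (g ℓ) ⟩
          d * inverse 2k 2k#0 * fromℚ h + 1# * (d * ⟦ N ⟧ * (p * g 0 - q * g ℓ))
            -- The factor 1/2 · 2 is inserted so that the 2 can be absorbed into the - 2N of
            -- `correction≈` and the 1/2 stays in front.
            ≈⟨ +-congˡ (*-congʳ half*2) ⟨
          d * inverse 2k 2k#0 * fromℚ h + half * ⟦ 2 ⟧ * (d * ⟦ N ⟧ * (p * g 0 - q * g ℓ))
            ≈⟨ solve 6 (λ x h t d N z → x :+ h :* t :* (d :* N :* z) := x :- d :* h :* (:- (t :* N) :* z))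
                 refl (d * inverse 2k 2k#0 * fromℚ h) half ⟦ 2 ⟧ d ⟦ N ⟧ (p * g 0 - q * g ℓ) ⟩
          d * inverse 2k 2k#0 * fromℚ h - d * half * (- (⟦ 2 ⟧ * ⟦ N ⟧) * (p * g 0 - q * g ℓ))
            ≈⟨ +-congˡ (-‿cong (*-congˡ (correction≈ a b ℓ ℓ<N))) ⟨
          d * inverse 2k 2k#0 * fromℚ h - d * half * correction a b ℓ ∎
          where
          h = hX x₀
          y = G (toℕ x₀ +ℕ (N ℕ.∸ ℓ))
          c₀ = HT.Target.γ ℓ ℓ<N b a
          p = ⟦ m ⟧ - 1#
          q = ⟦ m ⟧ * δF a b - 1#

        diagonal-formula : a ≡ b → fromℚ (hY b (x₀ , a)) ≈ d / 2k [ 2k#0 ] * fromℚ (hX x₀)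
          - ⟦ N ⟧ * d * (⟦ m ⟧ - 1#) / ⟦ 2 ⟧ [ char0 2 ] * 𝒜 ℓ
        diagonal-formula ≡.refl = trans formula (+-congˡ (-‿cong (trans (*-congˡ (correction-diagonal a ℓ ℓ<N))
          (solve 5 (λ d h p N A → d :* h :* (p :* (N :* A)) := N :* d :* p :* h :* A) refl d half (⟦ m ⟧ - 1#) ⟦ N ⟧ (𝒜 ℓ)))))

open import Algebra.Apartness.Bundles using (HeytingField)
open import Data.Fin.Base using (Fin)
open import Data.Nat.Base using (ℕ; NonZero; _≤_; _<_; suc; s≤s; z≤n) renaming (_+_ to _+ℕ_; _*_ to _*ℕ_)
open import Data.Nat.DivMod using (_mod_)
open import Data.Nat.Properties using (m*n≢0; ≤-trans)
open import Data.Product.Base using (Σ; ∃; _×_; _,_)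
open import Data.Rational.Base using (ℚ)
open import Relation.Binary.PropositionalEquality using (_≡_)

proposition6p5 : ∀ {c ℓ₁ ℓ₂} (K : HeytingField c ℓ₁ ℓ₂) (char0 : CharacteristicZero K) →
    let open HeytingField K
        open OverField K char0
    in
    (N k m : ℕ) .{{_ : NonZero N}} .{{_ : NonZero k}} →
    (2k+1≤N : 2 *ℕ k +ℕ 1 ≤ N) → 2 ≤ m →
    AllRootsSimple k ⟦ m ⟧ → (roots : Roots k ⟦ m ⟧) →
    let open Roots roots
        X = C N k 2k+1≤N
        Y = X □ complete m
        2k+m-1 = ⟦ 2 *ℕ k +ℕ m ⟧ - 1#
    in
    Σ (DenominatorsNonzero N) λ nz →
    let open Sums N nz
    in
    (a b : Fin m) (ℓ : ℕ) → ℓ < N →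
    ∃ λ (hX : ℚ) → ∃ λ (hY : ℚ) →
      ExpectedHittingTime X (0 mod N) (ℓ mod N) hX ×
      ExpectedHittingTime Y (0 mod N , a) (ℓ mod N , b) hY ×
      (fromℚ hY ≈ 2k+m-1 / ⟦ 2 *ℕ k ⟧ [ char0 (2 *ℕ k) {{m*n≢0 2 k}} ] * fromℚ hX
                  - 2k+m-1 / ⟦ 2 ⟧ [ char0 2 ] * correction a b ℓ) ×
      (a ≡ b →
       fromℚ hY ≈ 2k+m-1 / ⟦ 2 *ℕ k ⟧ [ char0 (2 *ℕ k) {{m*n≢0 2 k}} ] * fromℚ hX
                  - ⟦ N ⟧ * 2k+m-1 * (⟦ m ⟧ - 1#) / ⟦ 2 ⟧ [ char0 2 ] * 𝒜 ℓ)
proposition6p5 K char0 N (suc n) m 2k+1≤N 2≤m simple roots =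
  RootData.denominatorsNonzero N n m k≤N (≤-trans (s≤s z≤n) 2≤m) roots simple , λ a b ℓ ℓ<N →
    let open HT.Target ℓ ℓ<N in
    hX (0 mod N) , hY b (0 mod N , a) , hittingTime-X (0 mod N) , hittingTime-Y b (0 mod N , a) ,
    formula N n m 2k+1≤N 2≤m simple roots ℓ ℓ<N a b ,
    diagonal-formula N n m 2k+1≤N 2≤m simple roots ℓ ℓ<N a b
  where
  open Formula.HittingTimeFormula K char0 using (2k+1≤N⇒k≤N; formula; diagonal-formula)
  open Denominators.Nonvanishing K char0 using (module RootData)
  k≤N = 2k+1≤N⇒k≤N 2k+1≤N
  module HT = RationalHittingTimes.HittingTimes N (suc n) m (s≤s z≤n) (≤-trans (s≤s z≤n) 2≤m) 2k+1≤N k≤N
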